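{- Let $P\in\mathbb{Z}[x]$ be a monic polynomial such that $\Delta(P_n)\neq0$ for all integers $n\ge1$. Then the integers $\delta_n(P)$, $n\ge1$, all have the same sign.
   Context: If $P$ has degree $d$ and roots $\alpha_1,\dots,\alpha_d$ (with multiplicity), then $P_n(x):=\prod_{j=1}^d(x-\alpha_j^n)\in\mathbb{Z}[x]$ and $\Delta(P_n)=\prod_{1\le j<k\le d}(\alpha_j^n-\alpha_k^n)^2$ is its discriminant. Define $\delta_n(P):=\sum_{m\mid n}\mu(n/m)\Delta(P_m)$, where $\mu$ is the Möbius function. -}

module Defs where

open import Level using (Level)
open import Data.Nat as ℕ using (ℕ; zero; suc; _∸_)
open import Data.Nat.Divisibility using (_∣?_)
open import Data.Nat.Primality using (prime?)
open import Data.Nat.DivMod using (_/_)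
open import Data.Integer as ℤ using (ℤ; +_; -[1+_]; 0ℤ; 1ℤ)
open import Data.List as List using (List; []; _∷_; upTo; filter; length; map; zipWith; _++_; foldr)
open import Data.Bool.ListAction using (any)
open import Data.Vec as Vec using (Vec)
open import Data.Bool using (if_then_else_)
open import Data.List.Relation.Binary.Pointwise using (Pointwise)
open import Relation.Nullary.Decidable using (_×-dec_; does)
open import Algebra.Bundles using (CommutativeRing)

μ : ℕ → ℤ
μ n =
  if any (λ d → does ((d ℕ.* d) ∣? n)) (List.map (2 ℕ.+_) (upTo (n ∸ 1)))
  then 0ℤ
  else ((ℤ.- 1ℤ) ℤ.^ length (filter (λ p → prime? p ×-dec p ∣? n) (upTo (suc n))))

δ : (ℕ → ℤ) → ℕ → ℤ
δ D n = foldr ℤ._+_ 0ℤ (List.map term (upTo n))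
  where
  term : ℕ → ℤ
  term k = if does (suc k ∣? n) then μ (n / suc k) ℤ.* D (suc k) else 0ℤ

SameSign : (ℕ → ℤ) → Set
SameSign f = (∀ n → 1 ℕ.≤ n → 0ℤ ℤ.≤ f n) ⊎′ (∀ n → 1 ℕ.≤ n → f n ℤ.≤ 0ℤ)
  where open import Data.Sum using () renaming (_⊎_ to _⊎′_)

module _ {c ℓ : Level} (K : CommutativeRing c ℓ) where
  open CommutativeRing K

  natK : ℕ → Carrier
  natK zero    = 0#
  natK (suc n) = 1# + natK n

  ιK : ℤ → Carrier
  ιK (+ n)     = natK n
  ιK -[1+ n ]  = - natK (suc n)

  powK : ℕ → Carrier → Carrier
  powK zero    a = 1#
  powK (suc n) a = a * powK n a

  -- polynomials over K as coefficient lists, lowest degree first.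
  -- (x - a) · p
  mulLin : Carrier → List Carrier → List Carrier
  mulLin a p = zipWith (λ u v → u + (- v)) (0# ∷ p) (map (a *_) p ++ (0# ∷ []))

  prodLin : List Carrier → List Carrier
  prodLin []       = 1# ∷ []
  prodLin (a ∷ as) = mulLin a (prodLin as)

  monicK : ∀ {d} → Vec ℤ d → List Carrier
  monicK coef = map ιK (Vec.toList coef) ++ (1# ∷ [])

  Splits : ∀ {d} → Vec ℤ d → Vec Carrier d → Set (c Level.⊔ ℓ)
  Splits coef α = Pointwise _≈_ (prodLin (Vec.toList α)) (monicK coef)

  discK : List Carrier → Carrier
  discK []       = 1#
  discK (b ∷ bs) = List.foldr (λ b' r → ((b + (- b')) * (b + (- b'))) * r) 1# bs * discK bs

  -- Δ(P_n) computed from the roots: ∏_{j<k} (α_j^n - α_k^n)^2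
  ΔnK : ∀ {d} → ℕ → Vec Carrier d → Carrier
  ΔnK n α = discK (map (powK n) (Vec.toList α))

  CharZero : Set ℓ
  CharZero = ∀ z → ιK z ≈ 0# → z ≡ 0ℤ
    where open import Relation.Binary.PropositionalEquality using (_≡_)

module Submission where

-- The homogeneous cyclotomic forms Φₑ satisfy xⁿ - yⁿ = ∏_{e ∣ n} Φₑ(x, y), so Δ(Pₙ) = Δ(P) ∏_{1 < e ∣ n} Eₑ² with
-- Eₑ = ∏_{j<k} Φₑ(αⱼ, αₖ). For e > 1 the form Φₑ is symmetric, so Eₑ is an integer, and it is nonzero because it
-- divides Δ(Pₑ). Write Eₑ² = 1 + xₑ with xₑ ≥ 0 and expand the product: Möbius summation keeps exactly the monomials
-- ∏_{e ∈ S} xₑ with lcm S = n, hence δₙ(P) = Δ(P) t with t ≥ 0.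
-- The ring K need not be a domain, but modulo torsion the αⱼᵏ - αᵢᵏ are cancellable, as they divide the nonzero
-- integer Δ(Pₖ).

open import Defs
open import Level using (Level; _⊔_)
open import Data.Nat as ℕ using (ℕ; zero; suc; _≤_; z≤n; s≤s)
import Data.Nat.Properties as ℕₚ
open import Data.Nat.Coprimality as Coprimality using (Coprime; coprime-divisor; 1-coprimeTo)
open import Data.Nat.Divisibility as ℕ∣ using (_∣_; _∣?_; divides; ∣⇒≤; ∣-refl; ∣-trans; ∣-antisym; ∣1⇒≡1; 1∣_)
open import Data.Nat.DivMod using (m*n/n≡m)
open import Data.Nat.GCD
  using (gcd; gcd-GCD; gcd[m,n]∣m; gcd[m,n]∣n; gcd[m,n]≢0; gcd-greatest; module Bézout)
open import Data.Nat.LCM using (lcm; lcm-least; m∣lcm[m,n]; n∣lcm[m,n])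
open import Data.Nat.Primality
  using (Prime; prime?; euclidsLemma; prime⇒irreducible; prime⇒nonZero; prime⇒nonTrivial; ¬prime[1])
open import Data.Nat.Primality.Factorisation using (factorise)
open import Data.Nat.Tactic.RingSolver using () renaming (solve-∀ to ℕ-solve-∀)
open import Data.Integer as ℤ using (ℤ; +_; -[1+_]; 0ℤ; 1ℤ; ∣_∣; +≤+)
import Data.Integer.Properties as ℤₚ
import Data.Integer.Divisibility.Signed as ℤ∣
open import Data.Integer.Tactic.RingSolver using () renaming (solve-∀ to ℤ-solve-∀)
open import Data.Bool using (Bool; true; false; if_then_else_; T)
open import Data.Bool.ListAction using (any)
open import Data.Bool.Properties using (T-≡; ⇔→≡)
open import Data.Fin as Fin using (Fin; zero; suc)
import Data.Fin.Properties as Finₚ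
open import Data.List as List
  using (List; []; _∷_; _++_; allFin; applyUpTo; filter; foldr; length; replicate; upTo; zipWith)
open import Data.List.Membership.Propositional using (_∈_)
open import Data.List.Membership.Propositional.Properties using (∈-allFin; ∈-lookup)
open import Data.List.Membership.Propositional.Properties.WithK using (unique∧set⇒bag)
open import Data.List.Properties using (length-++; length-replicate; map-applyUpTo; map-cong; map-id; map-tabulate)
open import Data.List.Relation.Binary.BagAndSetEquality using (∼bag⇒↭)
open import Data.List.Relation.Binary.Permutation.Propositional as Perm using (_↭_; prep; swap)
open import Data.List.Relation.Binary.Pointwise as Pointwise using (Pointwise; []; _∷_)
open import Data.List.Relation.Unary.All as All using (All; []; _∷_)
import Data.List.Relation.Unary.All.Properties as Allₚ
open import Data.List.Relation.Unary.AllPairs using ([]; _∷_)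
open import Data.List.Relation.Unary.Any using (here; there)
open import Data.List.Relation.Unary.Any.Properties using (any⁺; any⁻; map⁺; map⁻; applyUpTo⁺; applyUpTo⁻)
open import Data.List.Relation.Unary.Unique.Propositional using (Unique)
open import Data.List.Relation.Unary.Unique.Propositional.Properties using (allFin⁺)
import Data.Maybe as Maybe
open import Data.Product using (_×_; _,_; ∃-syntax; ∃₂; map₂; proj₁; proj₂)
open import Data.Sum using (_⊎_; inj₁; inj₂)
open import Data.Vec as Vec using (Vec; []; _∷_; lookup; toList)
import Data.Vec.Properties as Vecₚ
open import Data.Empty using (⊥-elim)
open import Function using (_∘_; id; mk⇔; Equivalence)
open import Algebra.Bundles using (CommutativeRing)
import Algebra.Solver.Ring
import Algebra.Solver.Ring.AlmostCommutativeRing as ACR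
open import Relation.Nullary using (Dec; yes; no; ¬_; does; contradiction)
open import Relation.Nullary.Decidable using (_×-dec_; ¬?; dec-true; dec-false; dec⇒maybe; does-⇔)
open import Relation.Binary.Definitions using (WeaklyDecidable)
import Relation.Binary.PropositionalEquality as ≡
open ≡ using (_≡_; _≢_)

-- Two points shape the proof. First, the Φₑ must have integer coefficients and their factorisations
-- must hold over K, where neither unique factorisation nor roots of unity are at hand. They are
-- built by long division of coefficient lists by monic ones. Only the vanishing of the remainder
-- needs an argument, and it is given over ℤ: at large integers x the values of different Φₑ are
-- coprime up to a factor independent of x, so the divisor's value divides a fixed multiple of the
-- remainder's, which has smaller degree. The same coefficients then serve K. Second, Eₑ is to be an
-- integer without Galois theory or a theorem on symmetric polynomials. Newton's identities express
-- power sums integrally, and a sum of an integer polynomial over all d-tuples of roots is a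
-- combination of products of power sums. The factor Δ removes the tuples with repetition, which
-- leaves a fixed nonzero multiple of Eₑᵏ for every k. Bounded denominators of all powers force Eₑ
-- itself to be an integer.

-- Möbius sums over divisors and the sign of δ.

module MöbiusSums where
  open import Data.Integer using (_+_; _*_; -_; _^_)
  open import Data.Integer.Properties hiding (_≟_)
  open import Data.Integer.Tactic.RingSolver using (solve-∀)
  open import Data.Nat.Divisibility
  open ≡

  ∑₁ : ℕ → (ℕ → ℤ) → ℤ
  ∑₁ zero    f = 0ℤ
  ∑₁ (suc n) f = ∑₁ n f + f (suc n)

  ∑₁-cong : ∀ n {f g} → (∀ k → 1 ℕ.≤ k → k ℕ.≤ n → f k ≡ g k) → ∑₁ n f ≡ ∑₁ n g
  ∑₁-cong zero    eq = refl
  ∑₁-cong (suc n) eq =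
    cong₂ _+_ (∑₁-cong n (λ k 1≤k k≤n → eq k 1≤k (ℕₚ.m≤n⇒m≤1+n k≤n))) (eq (suc n) (s≤s z≤n) ℕₚ.≤-refl)

  ∑₁-zero : ∀ n {f} → (∀ k → 1 ℕ.≤ k → k ℕ.≤ n → f k ≡ 0ℤ) → ∑₁ n f ≡ 0ℤ
  ∑₁-zero n eq = trans (∑₁-cong n eq) (const n)
    where
    const : ∀ n → ∑₁ n (λ _ → 0ℤ) ≡ 0ℤ
    const zero    = refl
    const (suc n) = trans (+-identityʳ _) (const n)

  ∑₁-+ : ∀ n f g → ∑₁ n (λ k → f k + g k) ≡ ∑₁ n f + ∑₁ n g
  ∑₁-+ zero    f g = refl
  ∑₁-+ (suc n) f g = trans (cong (_+ (f (suc n) + g (suc n))) (∑₁-+ n f g)) (lemma (∑₁ n f) (∑₁ n g) (f (suc n)) (g (suc n)))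
    where
    lemma : ∀ a b c d → a + b + (c + d) ≡ a + c + (b + d)
    lemma = solve-∀

  ∑₁-* : ∀ n c f → ∑₁ n (λ k → c * f k) ≡ c * ∑₁ n f
  ∑₁-* zero    c f = sym (*-zeroʳ c)
  ∑₁-* (suc n) c f = trans (cong (_+ (c * f (suc n))) (∑₁-* n c f)) (sym (*-distribˡ-+ c (∑₁ n f) (f (suc n))))

  ∑₁-swap : ∀ m n (f : ℕ → ℕ → ℤ) → ∑₁ m (λ i → ∑₁ n (f i)) ≡ ∑₁ n (λ j → ∑₁ m (λ i → f i j))
  ∑₁-swap zero    n f = sym (∑₁-zero n (λ _ _ _ → refl))
  ∑₁-swap (suc m) n f = trans (cong (_+ ∑₁ n (f (suc m))) (∑₁-swap m n f)) (sym (∑₁-+ n (λ j → ∑₁ m (λ i → f i j)) (f (suc m))))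

  ∑₁-truncate : ∀ {m n} f → m ℕ.≤ n → (∀ k → m ℕ.< k → k ℕ.≤ n → f k ≡ 0ℤ) → ∑₁ n f ≡ ∑₁ m f
  ∑₁-truncate {m} {zero}  f z≤n eq = refl
  ∑₁-truncate {m} {suc n} f m≤1+n eq with m ℕ.≟ suc n
  ... | yes refl = refl
  ... | no  m≢1+n =
    let m<1+n = ℕₚ.≤∧≢⇒< m≤1+n m≢1+n in
    trans (cong₂ _+_ (∑₁-truncate f (ℕ.s≤s⁻¹ m<1+n) (λ k m<k k≤n → eq k m<k (ℕₚ.m≤n⇒m≤1+n k≤n)))
                     (eq (suc n) m<1+n ℕₚ.≤-refl))
          (+-identityʳ _)

  ∑₁-single : ∀ {n} a f → 1 ℕ.≤ a → a ℕ.≤ n → (∀ k → k ≢ a → f k ≡ 0ℤ) → ∑₁ n f ≡ f a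
  ∑₁-single {n} (suc a) f 1≤a a≤n eq =
    trans (∑₁-truncate f a≤n (λ k a<k _ → eq k (ℕₚ.>⇒≢ a<k)))
          (trans (cong (_+ f (suc a)) (∑₁-zero a (λ k _ k≤a → eq k (ℕₚ.<⇒≢ (s≤s k≤a)))))
                 (+-identityˡ _))

  ∑₁-front : ∀ n f → ∑₁ (suc n) f ≡ f 1 + ∑₁ n (f ∘ suc)
  ∑₁-front zero    f = +-comm 0ℤ (f 1)
  ∑₁-front (suc n) f = trans (cong (_+ f (suc (suc n))) (∑₁-front n f)) (+-assoc (f 1) (∑₁ n (f ∘ suc)) (f (suc (suc n))))

  foldr-applyUpTo : ∀ n (f : ℕ → ℤ) → foldr _+_ 0ℤ (applyUpTo f n) ≡ ∑₁ n (f ∘ ℕ.pred)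
  foldr-applyUpTo zero    f = refl
  foldr-applyUpTo (suc n) f =
    trans (cong (λ z → f 0 + z) (trans (foldr-applyUpTo n (f ∘ suc)) (∑₁-cong n λ { (suc k) _ _ → refl })))
          (sym (∑₁-front n (f ∘ ℕ.pred)))

  𝟙 : ∀ {p} {P : Set p} → Dec P → ℤ
  𝟙 P? = if does P? then 1ℤ else 0ℤ

  module _ {p} {P : Set p} where
    𝟙-yes : (P? : Dec P) → P → 𝟙 P? ≡ 1ℤ
    𝟙-yes P? p = cong (if_then 1ℤ else 0ℤ) (dec-true P? p)

    𝟙-no : (P? : Dec P) → ¬ P → 𝟙 P? ≡ 0ℤ
    𝟙-no P? ¬p = cong (if_then 1ℤ else 0ℤ) (dec-false P? ¬p)

  𝟙-cong : ∀ {p q} {P : Set p} {Q : Set q} (P? : Dec P) (Q? : Dec Q) →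
    (P → Q) → (Q → P) → 𝟙 P? ≡ 𝟙 Q?
  𝟙-cong P? Q? to from = cong (if_then 1ℤ else 0ℤ) (does-⇔ (mk⇔ to from) P? Q?)

  𝟙-∧ : ∀ {p q r} {P : Set p} {Q : Set q} {R : Set r} (P? : Dec P) (Q? : Dec Q) (R? : Dec R) →
    (P × Q → R) → (R → P × Q) → 𝟙 P? * 𝟙 Q? ≡ 𝟙 R?
  𝟙-∧ (yes p) (yes q) R? to from = sym (𝟙-yes R? (to (p , q)))
  𝟙-∧ (yes p) (no ¬q) R? to from = sym (𝟙-no R? (¬q ∘ proj₂ ∘ from))
  𝟙-∧ (no ¬p) Q?      R? to from = sym (𝟙-no R? (¬p ∘ proj₁ ∘ from))

  -- The list starts at 1 although `ω` filters from 0: the entry 0 is discarded by computation,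
  -- since 0 is not prime.
  length-filter : ∀ {p} {P : ℕ → Set p} (P? : ∀ k → Dec (P k)) n →
    + length (filter P? (applyUpTo suc n)) ≡ ∑₁ n (𝟙 ∘ P?)
  length-filter P? n = trans (go n suc) (∑₁-cong n λ { (suc k) _ _ → refl })
    where
    go : ∀ n (f : ℕ → ℕ) → + length (filter P? (applyUpTo f n)) ≡ ∑₁ n (𝟙 ∘ P? ∘ f ∘ ℕ.pred)
    go zero    f = refl
    go (suc n) f with ih ← trans (go n (f ∘ suc)) (∑₁-cong n λ { (suc k) _ _ → refl })
                    | ∑-eq ← ∑₁-front n (𝟙 ∘ P? ∘ f ∘ ℕ.pred)
                    with does (P? (f 0))
    ... | true  = trans (cong (λ z → 1ℤ + z) ih) (sym ∑-eq)
    ... | false = trans ih (trans (sym (+-identityˡ _)) (sym ∑-eq))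

  _∣□_ : ℕ → ℕ → Set
  d ∣□ n = d ℕ.* d ∣ n

  -- `hasSquare` and `ω` repeat the two ingredients of `μ` verbatim, so that `μ n` unfolds
  -- definitionally to them.
  hasSquare : ℕ → Bool
  hasSquare n = any (λ d → does ((d ℕ.* d) ∣? n)) (List.map (2 ℕ.+_) (upTo (n ℕ.∸ 1)))

  ω : ℕ → ℕ
  ω n = length (filter (λ p → prime? p ×-dec p ∣? n) (upTo (suc n)))

  T-does⁺ : ∀ {p} {P : Set p} (P? : Dec P) → P → T (does P?)
  T-does⁺ P? p = Equivalence.from T-≡ (dec-true P? p)

  T-does⁻ : ∀ {p} {P : Set p} (P? : Dec P) → T (does P?) → P
  T-does⁻ (yes p) _ = p

  hasSquare⁺ : ∀ {n d} → 1 ℕ.≤ n → 2 ℕ.≤ d → d ∣□ n → T (hasSquare n)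
  hasSquare⁺ {n} {suc (suc d)} 1≤n 2≤d@(s≤s (s≤s _)) d²∣n =
    any⁺ _ (map⁺ (applyUpTo⁺ _ (T-does⁺ (_ ∣? n) d²∣n) d<n∸1))
    where
    instance _ = ℕ.>-nonZero 1≤n
    D = suc (suc d)
    D≤n : D ℕ.≤ n
    D≤n = ℕₚ.≤-trans (ℕₚ.m≤m*n D D) (∣⇒≤ d²∣n)
    d<n∸1 : d ℕ.< n ℕ.∸ 1
    d<n∸1 = ℕₚ.≤-trans (ℕₚ.≤-reflexive (sym (ℕₚ.m+n∸m≡n 1 (suc d)))) (ℕₚ.∸-monoˡ-≤ 1 D≤n)

  hasSquare⁻ : ∀ {n} → T (hasSquare n) → ∃[ d ] 2 ℕ.≤ d × d ∣□ n
  hasSquare⁻ {n} t with applyUpTo⁻ id (map⁻ {f = 2 ℕ.+_} (any⁻ (λ d → does ((d ℕ.* d) ∣? n)) (List.map (2 ℕ.+_) (upTo (n ℕ.∸ 1))) t))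
  ... | d , _ , d²∣n = 2 ℕ.+ d , s≤s (s≤s z≤n) , T-does⁻ (_ ∣? n) d²∣n

  μ-square : ∀ {n d} → 1 ℕ.≤ n → 2 ℕ.≤ d → d ∣□ n → μ n ≡ 0ℤ
  μ-square {n} 1≤n 2≤d d²∣n with hasSquare n in eq
  ... | true  = refl
  ... | false = ⊥-elim (subst T eq (hasSquare⁺ 1≤n 2≤d d²∣n))

  module _ {p} (p-prime : Prime p) where

    private
      2≤p : 2 ℕ.≤ p
      2≤p = ℕ.nonTrivial⇒n>1 p {{ prime⇒nonTrivial p-prime }}

      instance _ = prime⇒nonZero p-prime

    -- If d² ∣ t p and p ∣ d, then p² ∣ t p and p ∣ t. So for p ∤ t such a d² is coprime to p and
    -- already divides t.
    hasSquare-* : ∀ {t} → 1 ℕ.≤ t → ¬ p ∣ t → hasSquare (t ℕ.* p) ≡ hasSquare t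
    hasSquare-* {t} 1≤t p∤t = ⇔→≡ {z = true} (mk⇔ (Equivalence.to T-≡ ∘ to ∘ Equivalence.from T-≡)
                                         (Equivalence.to T-≡ ∘ from ∘ Equivalence.from T-≡))
      where
      to : T (hasSquare (t ℕ.* p)) → T (hasSquare t)
      to h with hasSquare⁻ {t ℕ.* p} h
      ... | d , 2≤d , d²∣tp = hasSquare⁺ 1≤t 2≤d (coprime-divisor d²⊥p (subst (d ℕ.* d ∣_) (ℕₚ.*-comm t p) d²∣tp))
        where
        p∤d : ¬ p ∣ d
        p∤d p∣d = p∤t (*-cancelʳ-∣ p (∣-trans (*-pres-∣ p∣d p∣d) d²∣tp))
        d²⊥p : Coprime (d ℕ.* d) p
        d²⊥p {k} (k∣d² , k∣p) with prime⇒irreducible p-prime k∣p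
        ... | inj₁ k≡1  = k≡1
        ... | inj₂ refl with euclidsLemma d d p-prime k∣d²
        ...   | inj₁ p∣d = contradiction p∣d p∤d
        ...   | inj₂ p∣d = contradiction p∣d p∤d
      from : T (hasSquare t) → T (hasSquare (t ℕ.* p))
      from h with hasSquare⁻ {t} h
      ... | d , 2≤d , d²∣t = hasSquare⁺ (ℕₚ.*-mono-≤ 1≤t (ℕₚ.≤-trans (s≤s z≤n) 2≤p)) 2≤d (∣m⇒∣m*n p d²∣t)

    ω-* : ∀ {t} → 1 ℕ.≤ t → ¬ p ∣ t → ω (t ℕ.* p) ≡ suc (ω t)
    ω-* {t} 1≤t p∤t = +-injective (begin
      + ω (t ℕ.* p)                                  ≡⟨ length-filter _ (t ℕ.* p) ⟩
      ∑₁ (t ℕ.* p) (λ q → 𝟙 (primeDiv? (t ℕ.* p) q)) ≡⟨ ∑₁-cong (t ℕ.* p) (λ q _ _ → split q) ⟩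
      ∑₁ (t ℕ.* p) (λ q → 𝟙 (primeDiv? t q) + 𝟙 (q ℕ.≟ p)) ≡⟨ ∑₁-+ (t ℕ.* p) _ _ ⟩
      ∑₁ (t ℕ.* p) (λ q → 𝟙 (primeDiv? t q)) + ∑₁ (t ℕ.* p) (λ q → 𝟙 (q ℕ.≟ p))
        ≡⟨ cong₂ _+_
             (∑₁-truncate {t} {t ℕ.* p} (λ q → 𝟙 (primeDiv? t q)) (ℕₚ.m≤m*n t p)
               (λ q t<q _ → 𝟙-no (primeDiv? t q) (ℕₚ.<⇒≱ t<q ∘ ∣⇒≤ ∘ proj₂)))
             (trans (∑₁-single p (λ q → 𝟙 (q ℕ.≟ p)) (ℕₚ.≤-trans (s≤s z≤n) 2≤p) (ℕₚ.m≤n*m p t)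
                       (λ q → 𝟙-no (q ℕ.≟ p)))
                    (𝟙-yes (p ℕ.≟ p) refl)) ⟩
      ∑₁ t (λ q → 𝟙 (primeDiv? t q)) + 1ℤ            ≡⟨ cong (_+ 1ℤ) (sym (length-filter _ t)) ⟩
      + ω t + 1ℤ                                     ≡⟨ +-comm (+ ω t) 1ℤ ⟩
      + suc (ω t)                                    ∎)
      where
      open ≡-Reasoning
      instance _ = ℕ.>-nonZero 1≤t
      primeDiv? : ∀ n q → Dec (Prime q × q ∣ n)
      primeDiv? n q = prime? q ×-dec q ∣? n
      split : ∀ q → 𝟙 (primeDiv? (t ℕ.* p) q) ≡ 𝟙 (primeDiv? t q) + 𝟙 (q ℕ.≟ p)
      split q with q ℕ.≟ p
      ... | yes refl = trans (𝟙-yes (primeDiv? (t ℕ.* p) p) (p-prime , n∣m*n t))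
                             (sym (cong₂ _+_ (𝟙-no (primeDiv? t p) (p∤t ∘ proj₂)) (𝟙-yes (p ℕ.≟ p) refl)))
      ... | no q≢p = trans (𝟙-cong (primeDiv? (t ℕ.* p) q) (primeDiv? t q) to
                             (λ (q-prime , q∣t) → q-prime , ∣m⇒∣m*n p q∣t))
                           (sym (trans (cong (λ z → 𝟙 (primeDiv? t q) + z) (𝟙-no (q ℕ.≟ p) q≢p)) (+-identityʳ (𝟙 (primeDiv? t q)))))
        where
        to : Prime q × q ∣ t ℕ.* p → Prime q × q ∣ t
        to (q-prime , q∣tp) with euclidsLemma t p q-prime q∣tp
        ... | inj₁ q∣t = q-prime , q∣t
        ... | inj₂ q∣p with prime⇒irreducible p-prime q∣p
        ...   | inj₁ refl = contradiction q-prime ¬prime[1]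
        ...   | inj₂ q≡p  = contradiction q≡p q≢p

    μ-* : ∀ {t} → 1 ℕ.≤ t → ¬ p ∣ t → μ (t ℕ.* p) ≡ - μ t
    μ-* {t} 1≤t p∤t = trans (cong₂ (λ b k → if b then 0ℤ else (- 1ℤ) ^ k) (hasSquare-* 1≤t p∤t) (ω-* 1≤t p∤t))
                            (lemma (hasSquare t) (ω t))
      where
      lemma : ∀ b k → (if b then 0ℤ else (- 1ℤ) ^ suc k) ≡ - (if b then 0ℤ else (- 1ℤ) ^ k)
      lemma true  k = refl
      lemma false k = -1*i≡-i ((- 1ℤ) ^ k)

    μ-*-∣ : ∀ {t} → 1 ℕ.≤ t → p ∣ t → μ (t ℕ.* p) ≡ 0ℤ
    μ-*-∣ 1≤t p∣t = μ-square (ℕₚ.*-mono-≤ 1≤t (ℕₚ.≤-trans (s≤s z≤n) 2≤p)) 2≤p (*-monoˡ-∣ p p∣t)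

  -- The substitution m = t L: the indicator of L ∣ m is the sum over t of the indicators of m = t
  -- L, and the sums are exchanged.
  ∑-multiples : ∀ N L .{{_ : ℕ.NonZero L}} (g : ℕ → ℤ) →
    ∑₁ (N ℕ.* L) (λ m → 𝟙 (L ∣? m) * g m) ≡ ∑₁ N (λ t → g (t ℕ.* L))
  ∑-multiples N L g = begin
    ∑₁ (N ℕ.* L) (λ m → 𝟙 (L ∣? m) * g m)
      ≡⟨ ∑₁-cong (N ℕ.* L) (λ m 1≤m m≤NL → trans (cong (_* g m) (sym (indicator m 1≤m m≤NL)))
           (trans (*-comm _ (g m)) (sym (∑₁-* N (g m) _)))) ⟩
    ∑₁ (N ℕ.* L) (λ m → ∑₁ N (λ t → g m * 𝟙 (m ℕ.≟ t ℕ.* L)))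
      ≡⟨ ∑₁-swap (N ℕ.* L) N _ ⟩
    ∑₁ N (λ t → ∑₁ (N ℕ.* L) (λ m → g m * 𝟙 (m ℕ.≟ t ℕ.* L)))
      ≡⟨ ∑₁-cong N (λ t 1≤t t≤N → trans
           (∑₁-single (t ℕ.* L) (λ m → g m * 𝟙 (m ℕ.≟ t ℕ.* L)) (ℕₚ.*-mono-≤ 1≤t (ℕ.>-nonZero⁻¹ L)) (ℕₚ.*-monoˡ-≤ L t≤N)
             (λ m m≢tL → trans (cong (g m *_) (𝟙-no (m ℕ.≟ t ℕ.* L) m≢tL)) (*-zeroʳ (g m))))
           (trans (cong (g (t ℕ.* L) *_) (𝟙-yes (t ℕ.* L ℕ.≟ t ℕ.* L) refl)) (*-identityʳ _))) ⟩
    ∑₁ N (λ t → g (t ℕ.* L)) ∎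
    where
    open ≡-Reasoning
    indicator : ∀ m → 1 ℕ.≤ m → m ℕ.≤ N ℕ.* L → ∑₁ N (λ t → 𝟙 (m ℕ.≟ t ℕ.* L)) ≡ 𝟙 (L ∣? m)
    indicator m 1≤m m≤NL with L ∣? m
    ... | no  L∤m = ∑₁-zero N (λ t _ _ → 𝟙-no (m ℕ.≟ t ℕ.* L) (L∤m ∘ divides t))
    ... | yes (divides zero refl) = contradiction 1≤m λ ()
    ... | yes (divides q@(suc _) refl) =
      trans (∑₁-single {N} q (λ t → 𝟙 (q ℕ.* L ℕ.≟ t ℕ.* L)) (s≤s z≤n) (ℕₚ.*-cancelʳ-≤ q N L m≤NL)
              (λ t t≢q → 𝟙-no (q ℕ.* L ℕ.≟ t ℕ.* L) (t≢q ∘ sym ∘ ℕₚ.*-cancelʳ-≡ q t L)))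
            (𝟙-yes (q ℕ.* L ℕ.≟ q ℕ.* L) refl)


  prime-divisor : ∀ {n} → 2 ℕ.≤ n → ∃[ p ] Prime p × p ∣ n
  prime-divisor {n} 2≤n with factorise n {{ ℕ.>-nonZero (ℕₚ.≤-trans (s≤s z≤n) 2≤n) }}
  ... | record { factors = [] ; isFactorisation = refl } = contradiction 2≤n λ { (s≤s ()) }
  ... | record { factors = p ∷ ps ; isFactorisation = refl ; factorsPrime = p-prime ∷ _ } = p , p-prime , m∣m*n _

  ∑-divisors : ℕ → (ℕ → ℤ) → ℤ
  ∑-divisors n f = ∑₁ n (λ d → 𝟙 (d ∣? n) * f d)

  -- Splitting the divisors of N p by divisibility by p pairs each t ∣ N coprime to p with t p.
  ∑-divisors-μ-* : ∀ {p} → Prime p → ∀ N → 1 ℕ.≤ N → ∑-divisors (N ℕ.* p) μ ≡ 0ℤ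
  ∑-divisors-μ-* {p} p-prime N 1≤N = begin
    ∑₁ (N ℕ.* p) (λ d → 𝟙 (d ∣? N ℕ.* p) * μ d)
      ≡⟨ ∑₁-cong (N ℕ.* p) (λ d _ _ → split d) ⟩
    ∑₁ (N ℕ.* p) (λ d → 𝟙 (p ∣? d) * (𝟙 (d ∣? N ℕ.* p) * μ d) + rest d)
      ≡⟨ ∑₁-+ (N ℕ.* p) _ _ ⟩
    ∑₁ (N ℕ.* p) (λ d → 𝟙 (p ∣? d) * (𝟙 (d ∣? N ℕ.* p) * μ d)) + ∑₁ (N ℕ.* p) rest
      ≡⟨ cong₂ _+_ (∑-multiples N p (λ d → 𝟙 (d ∣? N ℕ.* p) * μ d))
                   (∑₁-truncate {N} {N ℕ.* p} rest (ℕₚ.m≤m*n N p)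
                     (λ d N<d _ → trans (cong (λ z → 𝟙 (¬? (p ∣? d)) * (z * μ d)) (𝟙-no (d ∣? N) (ℕₚ.<⇒≱ N<d ∘ ∣⇒≤)))
                                        (*-zeroʳ (𝟙 (¬? (p ∣? d)))))) ⟩
    ∑₁ N (λ t → 𝟙 (t ℕ.* p ∣? N ℕ.* p) * μ (t ℕ.* p)) + ∑₁ N rest
      ≡⟨ ∑₁-+ N _ _ ⟨
    ∑₁ N (λ t → 𝟙 (t ℕ.* p ∣? N ℕ.* p) * μ (t ℕ.* p) + rest t)
      ≡⟨ ∑₁-zero N (λ t 1≤t _ → cancel t 1≤t) ⟩
    0ℤ ∎
    where
    open ≡-Reasoning
    instance
      _ = prime⇒nonZero p-prime
      _ = ℕ.>-nonZero 1≤N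
    rest : ℕ → ℤ
    rest d = 𝟙 (¬? (p ∣? d)) * (𝟙 (d ∣? N) * μ d)
    split : ∀ d → 𝟙 (d ∣? N ℕ.* p) * μ d ≡ 𝟙 (p ∣? d) * (𝟙 (d ∣? N ℕ.* p) * μ d) + rest d
    split d with p ∣? d
    ... | yes p∣d = sym (trans (+-identityʳ _) (*-identityˡ _))
    ... | no  p∤d = trans (cong (_* μ d) (𝟙-cong (d ∣? N ℕ.* p) (d ∣? N) to (∣m⇒∣m*n p)))
                          (sym (trans (+-identityˡ _) (*-identityˡ _)))
      where
      d⊥p : Coprime d p
      d⊥p {k} (k∣d , k∣p) with prime⇒irreducible p-prime k∣p
      ... | inj₁ k≡1  = k≡1
      ... | inj₂ refl = contradiction k∣d p∤d
      to : d ∣ N ℕ.* p → d ∣ N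
      to d∣Np = coprime-divisor d⊥p (subst (d ∣_) (ℕₚ.*-comm N p) d∣Np)
    cancel : ∀ t → 1 ℕ.≤ t → 𝟙 (t ℕ.* p ∣? N ℕ.* p) * μ (t ℕ.* p) + rest t ≡ 0ℤ
    cancel t 1≤t with p ∣? t
    ... | yes p∣t = trans (+-identityʳ _)
                      (trans (cong (𝟙 (t ℕ.* p ∣? N ℕ.* p) *_) (μ-*-∣ p-prime 1≤t p∣t)) (*-zeroʳ (𝟙 (t ℕ.* p ∣? N ℕ.* p))))
    ... | no  p∤t = trans (cong₂ (λ a b → a * b + 1ℤ * (𝟙 (t ∣? N) * μ t))
                            (𝟙-cong (t ℕ.* p ∣? N ℕ.* p) (t ∣? N) (*-cancelʳ-∣ p) (*-monoˡ-∣ p)) (μ-* p-prime 1≤t p∤t))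
                          (lemma (𝟙 (t ∣? N)) (μ t))
      where
      lemma : ∀ a b → a * - b + 1ℤ * (a * b) ≡ 0ℤ
      lemma = solve-∀

  -- The sum is 1 for n = 1, and any prime divisor of a larger n makes it 0.
  ∑-divisors-μ-nonneg : ∀ n → 1 ℕ.≤ n → 0ℤ ℤ.≤ ∑-divisors n μ
  ∑-divisors-μ-nonneg (suc zero)      _ = +≤+ z≤n
  ∑-divisors-μ-nonneg n@(suc (suc _)) _ with prime-divisor {n} (s≤s (s≤s z≤n))
  ... | p , p-prime , divides N@(suc _) eq =
    ≤-reflexive (sym (trans (cong (λ n → ∑-divisors n μ) eq) (∑-divisors-μ-* p-prime N (s≤s z≤n))))

  module _ (c : ℕ → ℤ) where

    -- With `c e` = Eₑ² and the list of all e from 2 to n, this is Δ(Pₘ) / Δ(P) for 1 ≤ m ≤ n.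
    ∏∣ : List ℕ → ℕ → ℤ
    ∏∣ []       m = 1ℤ
    ∏∣ (e ∷ es) m = (if does (e ∣? m) then c e else 1ℤ) * ∏∣ es m

    module _ {n} (1≤n : 1 ℕ.≤ n) where

      private instance _ = ℕ.>-nonZero 1≤n

      -- The Möbius sum of f over the multiples of L: expanding a factor 1 + [e ∣ m] x of f turns L into lcm L e.
      twisted : ℕ → (ℕ → ℤ) → ℤ
      twisted L f = ∑₁ n (λ d → ∑₁ n (λ m → 𝟙 (d ℕ.* m ℕ.≟ n) * (μ d * (𝟙 (L ∣? m) * f m))))

      -- The indicators of L ∣ m and e ∣ m multiply to that of lcm L e ∣ m; the rest is linearity.
      twisted-step : ∀ L e f x →
        twisted L (λ m → (1ℤ + 𝟙 (e ∣? m) * x) * f m) ≡ twisted L f + x * twisted (lcm L e) f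
      twisted-step L e f x = begin
        twisted L (λ m → (1ℤ + 𝟙 (e ∣? m) * x) * f m)
          ≡⟨ ∑₁-cong n (λ d _ _ → trans (∑₁-cong n (λ m _ _ → term d m))
               (trans (∑₁-+ n (inner L d) (λ m → x * inner (lcm L e) d m))
                      (cong (λ z → ∑₁ n (inner L d) + z) (∑₁-* n x (inner (lcm L e) d))))) ⟩
        ∑₁ n (λ d → ∑₁ n (inner L d) + x * ∑₁ n (inner (lcm L e) d))
          ≡⟨ trans (∑₁-+ n (λ d → ∑₁ n (inner L d)) (λ d → x * ∑₁ n (inner (lcm L e) d)))
                   (cong (λ z → twisted L f + z) (∑₁-* n x (λ d → ∑₁ n (inner (lcm L e) d)))) ⟩
        twisted L f + x * twisted (lcm L e) f ∎
        where
        open ≡-Reasoning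
        inner : ℕ → ℕ → ℕ → ℤ
        inner L d m = 𝟙 (d ℕ.* m ℕ.≟ n) * (μ d * (𝟙 (L ∣? m) * f m))
        lemma : ∀ i μd l e x f → i * (μd * (l * ((1ℤ + e * x) * f))) ≡
                                 i * (μd * (l * f)) + x * (i * (μd * (l * e * f)))
        lemma = solve-∀
        term : ∀ d m → 𝟙 (d ℕ.* m ℕ.≟ n) * (μ d * (𝟙 (L ∣? m) * ((1ℤ + 𝟙 (e ∣? m) * x) * f m))) ≡
                       𝟙 (d ℕ.* m ℕ.≟ n) * (μ d * (𝟙 (L ∣? m) * f m)) +
                       x * (𝟙 (d ℕ.* m ℕ.≟ n) * (μ d * (𝟙 (lcm L e ∣? m) * f m)))
        term d m = trans (lemma (𝟙 (d ℕ.* m ℕ.≟ n)) (μ d) (𝟙 (L ∣? m)) (𝟙 (e ∣? m)) x (f m))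
          (cong (λ z → 𝟙 (d ℕ.* m ℕ.≟ n) * (μ d * (𝟙 (L ∣? m) * f m)) + x * (𝟙 (d ℕ.* m ℕ.≟ n) * (μ d * (z * f m))))
            (𝟙-∧ (L ∣? m) (e ∣? m) (lcm L e ∣? m) (λ (L∣m , e∣m) → lcm-least L∣m e∣m)
              (λ l∣m → ∣-trans (m∣lcm[m,n] L e) l∣m , ∣-trans (n∣lcm[m,n] L e) l∣m)))

      -- The only candidate is m = n / d, and L divides it exactly when d L ∣ n.
      ∑-complement : ∀ L d → 1 ℕ.≤ d →
        ∑₁ n (λ m → 𝟙 (d ℕ.* m ℕ.≟ n) * 𝟙 (L ∣? m)) ≡ 𝟙 (d ℕ.* L ∣? n)
      ∑-complement L d 1≤d with d ℕ.* L ∣? n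
      ... | no dL∤n = ∑₁-zero n λ m _ _ → zero-term m
        where
        zero-term : ∀ m → 𝟙 (d ℕ.* m ℕ.≟ n) * 𝟙 (L ∣? m) ≡ 0ℤ
        zero-term m with L ∣? m | d ℕ.* m ℕ.≟ n
        ... | yes L∣m | yes refl = contradiction (*-monoʳ-∣ d L∣m) dL∤n
        ... | yes _   | no dm≢n  = cong (_* 1ℤ) (𝟙-no (d ℕ.* m ℕ.≟ n) dm≢n)
        ... | no _    | _        = *-zeroʳ (𝟙 (d ℕ.* m ℕ.≟ n))
      ... | yes (divides q n≡q*dL) =
        trans (∑₁-single {n} (q ℕ.* L) (λ m → 𝟙 (d ℕ.* m ℕ.≟ n) * 𝟙 (L ∣? m)) 1≤qL qL≤n
                (λ m m≢qL → cong (_* 𝟙 (L ∣? m)) (𝟙-no (d ℕ.* m ℕ.≟ n)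
                   (λ dm≡n → m≢qL (ℕₚ.*-cancelˡ-≡ m (q ℕ.* L) d (trans dm≡n (sym d*qL≡n)))))))
              (cong₂ _*_ (𝟙-yes (d ℕ.* (q ℕ.* L) ℕ.≟ n) d*qL≡n) (𝟙-yes (L ∣? q ℕ.* L) (n∣m*n q)))
        where
        instance _ = ℕ.>-nonZero 1≤d
        d*qL≡n : d ℕ.* (q ℕ.* L) ≡ n
        d*qL≡n = trans (trans (sym (ℕₚ.*-assoc d q L)) (trans (cong (ℕ._* L) (ℕₚ.*-comm d q)) (ℕₚ.*-assoc q d L)))
                       (sym n≡q*dL)
        1≤qL : 1 ℕ.≤ q ℕ.* L
        1≤qL = ℕₚ.n≢0⇒n>0 λ qL≡0 → ℕₚ.>⇒≢ 1≤n (trans (sym d*qL≡n) (trans (cong (d ℕ.*_) qL≡0) (ℕₚ.*-zeroʳ d)))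
        qL≤n : q ℕ.* L ℕ.≤ n
        qL≤n = ℕₚ.≤-trans (ℕₚ.m≤n*m (q ℕ.* L) d) (ℕₚ.≤-reflexive d*qL≡n)

      -- What remains is the sum of μ d over d L ∣ n: it is empty if L ∤ n, and otherwise it is the
      -- sum of μ over the divisors of n / L. So a monomial with least common multiple L survives
      -- only for L = n, with coefficient 1.
      twisted-one-nonneg : ∀ L → 0ℤ ℤ.≤ twisted L (λ _ → 1ℤ)
      twisted-one-nonneg L = subst (0ℤ ℤ.≤_) (sym twisted≡) (nonneg (L ∣? n))
        where
        lemma : ∀ i μd l → i * (μd * (l * 1ℤ)) ≡ μd * (i * l)
        lemma = solve-∀
        twisted≡ : twisted L (λ _ → 1ℤ) ≡ ∑₁ n (λ d → μ d * 𝟙 (d ℕ.* L ∣? n))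
        twisted≡ = ∑₁-cong n (λ d 1≤d _ →
          trans (∑₁-cong n (λ m _ _ → lemma (𝟙 (d ℕ.* m ℕ.≟ n)) (μ d) (𝟙 (L ∣? m))))
                (trans (∑₁-* n (μ d) _) (cong (μ d *_) (∑-complement L d 1≤d))))
        nonneg : Dec (L ∣ n) → 0ℤ ℤ.≤ ∑₁ n (λ d → μ d * 𝟙 (d ℕ.* L ∣? n))
        nonneg (no L∤n) = ≤-reflexive (sym (∑₁-zero n (λ d _ _ →
          trans (cong (μ d *_) (𝟙-no (d ℕ.* L ∣? n) (λ dL∣n → L∤n (∣-trans (n∣m*n d) dL∣n)))) (*-zeroʳ (μ d)))))
        nonneg (yes (divides N n≡NL)) = subst (0ℤ ℤ.≤_) (sym sum≡) (∑-divisors-μ-nonneg N (ℕ.>-nonZero⁻¹ N))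
          where
          NL≢0 : ℕ.NonZero (N ℕ.* L)
          NL≢0 = subst ℕ.NonZero n≡NL (ℕ.>-nonZero 1≤n)
          instance
            _ = ℕₚ.m*n≢0⇒m≢0 N {{NL≢0}}
            _ = ℕₚ.m*n≢0⇒n≢0 N {L} {{NL≢0}}
          sum≡ : ∑₁ n (λ d → μ d * 𝟙 (d ℕ.* L ∣? n)) ≡ ∑-divisors N μ
          sum≡ = trans
            (∑₁-cong n (λ d _ _ → trans (*-comm (μ d) _) (cong (_* μ d) (𝟙-cong (d ℕ.* L ∣? n) (d ∣? N)
              (λ dL∣n → *-cancelʳ-∣ L (subst (d ℕ.* L ∣_) n≡NL dL∣n))
              (λ d∣N → subst (d ℕ.* L ∣_) (sym n≡NL) (*-monoˡ-∣ L d∣N))))))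
            (∑₁-truncate {N} {n} (λ d → 𝟙 (d ∣? N) * μ d) (subst (N ℕ.≤_) (sym n≡NL) (ℕₚ.m≤m*n N L))
              (λ d N<d _ → cong (_* μ d) (𝟙-no (d ∣? N) (ℕₚ.<⇒≱ N<d ∘ ∣⇒≤))))

      -- Each factor is 1 + [e ∣ m] x with x = `c e` - 1 ≥ 0. Expanding it changes L to lcm L e in
      -- one of the two terms, so the induction on the list has to range over all L.
      twisted-nonneg : (∀ e → 1ℤ ℤ.≤ c e) → ∀ es L → 0ℤ ℤ.≤ twisted L (∏∣ es)
      twisted-nonneg c≥1 []       L = twisted-one-nonneg L
      twisted-nonneg c≥1 (e ∷ es) L = subst (0ℤ ℤ.≤_) (sym (trans (∑₁-cong n (λ d _ _ → ∑₁-cong n (λ m _ _ →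
          cong (λ z → 𝟙 (d ℕ.* m ℕ.≟ n) * (μ d * (𝟙 (L ∣? m) * (z * ∏∣ es m)))) (factor m))))
          (twisted-step L e (∏∣ es) (c e + - 1ℤ))))
        (+-mono-≤ (twisted-nonneg c≥1 es L)
                  (*-nonneg (i≤j⇒0≤j-i (c≥1 e)) (twisted-nonneg c≥1 es (lcm L e))))
        where
        *-nonneg : ∀ {x y} → 0ℤ ℤ.≤ x → 0ℤ ℤ.≤ y → 0ℤ ℤ.≤ x * y
        *-nonneg {+ a} {+ b} _ _ = subst (0ℤ ℤ.≤_) (pos-* a b) (+≤+ z≤n)
        lemma₁ : ∀ x → x ≡ 1ℤ + 1ℤ * (x + - 1ℤ)
        lemma₁ = solve-∀
        factor : ∀ m → (if does (e ∣? m) then c e else 1ℤ) ≡ 1ℤ + 𝟙 (e ∣? m) * (c e + - 1ℤ)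
        factor m with does (e ∣? m)
        ... | true  = lemma₁ (c e)
        ... | false = refl

      δ≡twisted : ∀ D es → (∀ m → 1 ℕ.≤ m → m ℕ.≤ n → D m ≡ D 1 * ∏∣ es m) →
        δ D n ≡ D 1 * twisted 1 (∏∣ es)
      δ≡twisted D es D≡ = begin
        δ D n
          ≡⟨ cong (foldr _+_ 0ℤ) (map-applyUpTo id _ n) ⟩
        foldr _+_ 0ℤ (applyUpTo _ n)
          ≡⟨ foldr-applyUpTo n _ ⟩
        ∑₁ n _
          ≡⟨ ∑₁-cong n (λ { (suc k) _ k≤n → summand k k≤n (suc k ∣? n) }) ⟩
        -- The quotient n / m becomes a second summation variable d with d m = n; the factor `1ℤ`
        -- holds the place of the indicator of 1 ∣ m in `twisted 1`.
        ∑₁ n (λ m → ∑₁ n (λ d → 𝟙 (d ℕ.* m ℕ.≟ n) * (μ d * (1ℤ * (D 1 * ∏∣ es m)))))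
          ≡⟨ ∑₁-swap n n _ ⟩
        ∑₁ n (λ d → ∑₁ n (λ m → 𝟙 (d ℕ.* m ℕ.≟ n) * (μ d * (1ℤ * (D 1 * ∏∣ es m)))))
          ≡⟨ ∑₁-cong n (λ d _ _ → trans (∑₁-cong n (λ m _ _ → trans
               (lemma (𝟙 (d ℕ.* m ℕ.≟ n)) (μ d) (D 1) (∏∣ es m))
               (cong (λ z → D 1 * (𝟙 (d ℕ.* m ℕ.≟ n) * (μ d * (z * ∏∣ es m)))) (sym (𝟙-yes (1 ∣? m) (1∣ m))))))
               (∑₁-* n (D 1) _)) ⟩
        ∑₁ n (λ d → D 1 * ∑₁ n (λ m → 𝟙 (d ℕ.* m ℕ.≟ n) * (μ d * (𝟙 (1 ∣? m) * ∏∣ es m))))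
          ≡⟨ ∑₁-* n (D 1) _ ⟩
        D 1 * twisted 1 (∏∣ es) ∎
        where
        open ≡-Reasoning
        lemma : ∀ i μd D f → i * (μd * (1ℤ * (D * f))) ≡ D * (i * (μd * (1ℤ * f)))
        lemma = solve-∀
        term : ∀ {m} → Dec (suc m ∣ n) → ℤ
        term {m} m∣?n = if does m∣?n then μ (n ℕ./ suc m) * D (suc m) else 0ℤ
        summand : ∀ k → suc k ℕ.≤ n → (k∣?n : Dec (suc k ∣ n)) → term k∣?n ≡
          ∑₁ n (λ d → 𝟙 (d ℕ.* suc k ℕ.≟ n) * (μ d * (1ℤ * (D 1 * ∏∣ es (suc k)))))
        summand k k<n (no k∤n) =
          sym (∑₁-zero n (λ d _ _ → cong (_* _) (𝟙-no (d ℕ.* suc k ℕ.≟ n) (k∤n ∘ divides d ∘ sym))))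
        summand k k<n (yes (divides q n≡q*k)) = sym (trans
          (∑₁-single {n} q (λ d → 𝟙 (d ℕ.* suc k ℕ.≟ n) * (μ d * (1ℤ * (D 1 * ∏∣ es (suc k))))) 1≤q q≤n
            (λ d d≢q → cong (_* (μ d * (1ℤ * (D 1 * ∏∣ es (suc k)))))
              (𝟙-no (d ℕ.* suc k ℕ.≟ n) (λ dk≡n → d≢q (ℕₚ.*-cancelʳ-≡ d q (suc k) (trans dk≡n n≡q*k))))))
          (trans (cong (_* (μ q * (1ℤ * (D 1 * ∏∣ es (suc k))))) (𝟙-yes (q ℕ.* suc k ℕ.≟ n) (sym n≡q*k)))
          (trans (*-identityˡ _)
          (cong₂ _*_ (cong μ (sym (trans (cong (ℕ._/ suc k) n≡q*k) (m*n/n≡m q (suc k)))))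
                     (trans (*-identityˡ _) (sym (D≡ (suc k) (s≤s z≤n) k<n)))))))
          where
          q≤n : q ℕ.≤ n
          q≤n = subst (q ℕ.≤_) (sym n≡q*k) (ℕₚ.m≤m*n q (suc k))
          1≤q : 1 ℕ.≤ q
          1≤q = ℕₚ.n≢0⇒n>0 λ { refl → ℕₚ.>⇒≢ 1≤n n≡q*k }

-- The homomorphism from ℤ to a commutative ring.

module IntegerImage {c ℓ : Level} (K : CommutativeRing c ℓ) where
  open CommutativeRing K hiding (zero)
  open import Relation.Binary.Reasoning.Setoid setoid
  open import Algebra.Properties.Ring ring
    using (-‿involutive; -‿+-comm; -0#≈0#; -‿distribˡ-*; -‿distribʳ-*)
  open import Algebra.Properties.CommutativeSemigroup +-commutativeSemigroup using (interchange)

  ι : ℤ → Carrier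
  ι = ιK K

  private
    ν : ℕ → Carrier
    ν = natK K

  ν-+ : ∀ m n → ν (m ℕ.+ n) ≈ ν m + ν n
  ν-+ zero    n = sym (+-identityˡ _)
  ν-+ (suc m) n = trans (+-congˡ (ν-+ m n)) (sym (+-assoc _ _ _))

  ν-* : ∀ m n → ν (m ℕ.* n) ≈ ν m * ν n
  ν-* zero    n = sym (zeroˡ _)
  ν-* (suc m) n = begin
    ν (n ℕ.+ m ℕ.* n)     ≈⟨ ν-+ n (m ℕ.* n) ⟩
    ν n + ν (m ℕ.* n)     ≈⟨ +-cong (sym (*-identityˡ _)) (ν-* m n) ⟩
    1# * ν n + ν m * ν n  ≈⟨ distribʳ _ _ _ ⟨
    (1# + ν m) * ν n      ∎

  ι-neg : ∀ z → ι (ℤ.- z) ≈ - ι z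
  ι-neg (+ zero)  = sym -0#≈0#
  ι-neg (+ suc n) = refl
  ι-neg -[1+ n ]  = sym (-‿involutive _)

  ι-⊖ : ∀ m n → ι (m ℤ.⊖ n) ≈ ν m - ν n
  ι-⊖ m       zero    = sym (trans (+-congˡ -0#≈0#) (+-identityʳ _))
  ι-⊖ zero    (suc n) = sym (+-identityˡ _)
  ι-⊖ (suc m) (suc n) = begin
    ι (suc m ℤ.⊖ suc n)             ≡⟨ ≡.cong ι (ℤₚ.[1+m]⊖[1+n]≡m⊖n m n) ⟩
    ι (m ℤ.⊖ n)                     ≈⟨ ι-⊖ m n ⟩
    ν m - ν n                       ≈⟨ +-identityˡ _ ⟨
    0# + (ν m - ν n)                ≈⟨ +-congʳ (-‿inverseʳ 1#) ⟨
    (1# - 1#) + (ν m - ν n)         ≈⟨ interchange _ _ _ _ ⟩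
    (1# + ν m) + (- 1# - ν n)       ≈⟨ +-congˡ (-‿+-comm 1# (ν n)) ⟩
    ν (suc m) - ν (suc n)           ∎

  ι-+ : ∀ a b → ι (a ℤ.+ b) ≈ ι a + ι b
  ι-+ (+ m)    (+ n)    = ν-+ m n
  ι-+ (+ m)    -[1+ n ] = ι-⊖ m (suc n)
  ι-+ -[1+ m ] (+ n)    = trans (ι-⊖ n (suc m)) (+-comm _ _)
  ι-+ -[1+ m ] -[1+ n ] = begin
    - ν (suc (suc (m ℕ.+ n)))  ≡⟨ ≡.cong (λ k → - ν (suc k)) (ℕₚ.+-suc m n) ⟨
    - ν (suc m ℕ.+ suc n)      ≈⟨ -‿cong (ν-+ (suc m) (suc n)) ⟩
    - (ν (suc m) + ν (suc n))  ≈⟨ -‿+-comm _ _ ⟨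
    - ν (suc m) - ν (suc n)    ∎

  ι-* : ∀ a b → ι (a ℤ.* b) ≈ ι a * ι b
  ι-* (+ m) b = lemma m b
    where
    lemma : ∀ m b → ι (+ m ℤ.* b) ≈ ν m * ι b
    lemma m (+ n)    = trans (reflexive (≡.cong ι (≡.sym (ℤₚ.pos-* m n)))) (ν-* m n)
    lemma m -[1+ n ] = begin
      ι (+ m ℤ.* -[1+ n ])         ≡⟨ ≡.cong ι (ℤₚ.neg-distribʳ-* (+ m) (+ suc n)) ⟨
      ι (ℤ.- (+ m ℤ.* + suc n))    ≈⟨ ι-neg (+ m ℤ.* + suc n) ⟩
      - ι (+ m ℤ.* + suc n)        ≈⟨ -‿cong (lemma m (+ suc n)) ⟩
      - (ν m * ν (suc n))          ≈⟨ -‿distribʳ-* _ _ ⟩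
      ν m * - ν (suc n)            ∎
  ι-* -[1+ m ] b = begin
    ι (-[1+ m ] ℤ.* b)           ≡⟨ ≡.cong ι (ℤₚ.neg-distribˡ-* (+ suc m) b) ⟨
    ι (ℤ.- (+ suc m ℤ.* b))      ≈⟨ ι-neg (+ suc m ℤ.* b) ⟩
    - ι (+ suc m ℤ.* b)          ≈⟨ -‿cong (ι-* (+ suc m) b) ⟩
    - (ν (suc m) * ι b)          ≈⟨ -‿distribˡ-* _ _ ⟩
    - ν (suc m) * ι b            ∎

  ι-1 : ι 1ℤ ≈ 1#
  ι-1 = +-identityʳ 1#

  private
    ι-morphism : ACR._-Raw-AlmostCommutative⟶_ ℤ.+-*-rawRing (ACR.fromCommutativeRing K)
    ι-morphism = record
      { ⟦_⟧ = ι ; +-homo = ι-+ ; *-homo = ι-* ; -‿homo = ι-neg ; 0-homo = refl ; 1-homo = ι-1 }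

    ι-≟ : WeaklyDecidable (ACR.Induced-equivalence ι-morphism)
    ι-≟ a b = Maybe.map (λ eq → reflexive (≡.cong ι eq)) (dec⇒maybe (a ℤₚ.≟ b))

  -- Coefficients are taken from ℤ, where equality is decidable, and not from K, where it need not
  -- be.
  module Solver = Algebra.Solver.Ring ℤ.+-*-rawRing (ACR.fromCommutativeRing K) ι-morphism ι-≟

-- Powers, finite products and binary forms over a ring.

module Ring {c ℓ : Level} (K : CommutativeRing c ℓ) where
  open CommutativeRing K public hiding (zero)
  open import Relation.Binary.Reasoning.Setoid setoid public
  open IntegerImage K public
  open Solver public using (solve; _:=_; _:+_; _:*_; _:-_; :-_; con)

  pow : Carrier → ℕ → Carrier
  pow x n = powK K n x

  pow-+ : ∀ x m n → pow x (m ℕ.+ n) ≈ pow x m * pow x n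
  pow-+ x zero    n = sym (*-identityˡ _)
  pow-+ x (suc m) n = trans (*-congˡ (pow-+ x m n)) (sym (*-assoc _ _ _))

  pow-cong : ∀ {x y} n → x ≈ y → pow x n ≈ pow y n
  pow-cong zero    x≈y = refl
  pow-cong (suc n) x≈y = *-cong x≈y (pow-cong n x≈y)

  pow-* : ∀ x m n → pow x (m ℕ.* n) ≈ pow (pow x n) m
  pow-* x zero    n = refl
  pow-* x (suc m) n = trans (pow-+ x n (m ℕ.* n)) (*-congˡ (pow-* x m n))

  pow-1# : ∀ n → pow 1# n ≈ 1#
  pow-1# zero    = refl
  pow-1# (suc n) = trans (*-identityˡ _) (pow-1# n)

  ∏₁ : ℕ → (ℕ → Carrier) → Carrier
  ∏₁ zero    f = 1#
  ∏₁ (suc n) f = ∏₁ n f * f (suc n)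

  ∏₁-cong : ∀ n {f g} → (∀ k → 1 ℕ.≤ k → k ℕ.≤ n → f k ≈ g k) → ∏₁ n f ≈ ∏₁ n g
  ∏₁-cong zero    eq = refl
  ∏₁-cong (suc n) eq =
    *-cong (∏₁-cong n (λ k 1≤k k≤n → eq k 1≤k (ℕₚ.m≤n⇒m≤1+n k≤n))) (eq (suc n) (s≤s z≤n) ℕₚ.≤-refl)

  ∏₁-* : ∀ n f g → ∏₁ n (λ k → f k * g k) ≈ ∏₁ n f * ∏₁ n g
  ∏₁-* zero    f g = sym (*-identityˡ _)
  ∏₁-* (suc n) f g = trans (*-congʳ (∏₁-* n f g))
    (solve 4 (λ a b x y → (a :* b) :* (x :* y) := (a :* x) :* (b :* y)) refl _ _ _ _)

  ∏₁-one : ∀ n {f} → (∀ k → 1 ℕ.≤ k → k ℕ.≤ n → f k ≈ 1#) → ∏₁ n f ≈ 1#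
  ∏₁-one zero    eq = refl
  ∏₁-one (suc n) eq = trans (*-cong (∏₁-one n (λ k 1≤k k≤n → eq k 1≤k (ℕₚ.m≤n⇒m≤1+n k≤n)))
                                    (eq (suc n) (s≤s z≤n) ℕₚ.≤-refl)) (*-identityˡ _)

  when : ∀ {p} {P : Set p} → Dec P → Carrier → Carrier
  when P? a = if does P? then a else 1#

  when-yes : ∀ {p} {P : Set p} (P? : Dec P) {a} → P → when P? a ≡ a
  when-yes P? p = ≡.cong (if_then _ else _) (dec-true P? p)

  when-no : ∀ {p} {P : Set p} (P? : Dec P) {a} → ¬ P → when P? a ≡ 1#
  when-no P? ¬p = ≡.cong (if_then _ else _) (dec-false P? ¬p)

  ∏₁-single : ∀ n e (f : ℕ → Carrier) → 1 ℕ.≤ e → e ℕ.≤ n → ∏₁ n (λ k → when (k ℕ.≟ e) (f k)) ≈ f e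
  ∏₁-single zero    e f 1≤e e≤0 = contradiction (ℕₚ.≤-trans 1≤e e≤0) λ ()
  ∏₁-single (suc n) e f 1≤e e≤1+n = lemma (suc n ℕ.≟ e)
    where
    lemma : Dec (suc n ≡ e) → ∏₁ (suc n) (λ k → when (k ℕ.≟ e) (f k)) ≈ f e
    lemma (yes ≡.refl) = trans
      (*-cong (∏₁-one n (λ k _ k≤n → reflexive (when-no (k ℕ.≟ e) (ℕₚ.<⇒≢ (s≤s k≤n)))))
              (reflexive (when-yes (suc n ℕ.≟ e) ≡.refl)))
      (*-identityˡ _)
    lemma (no 1+n≢e) = trans
      (*-cong (∏₁-single n e f 1≤e (ℕ.s≤s⁻¹ (ℕₚ.≤∧≢⇒< e≤1+n (λ e≡1+n → 1+n≢e (≡.sym e≡1+n)))))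
              (reflexive (when-no (suc n ℕ.≟ e) 1+n≢e)))
      (*-identityʳ _)

  -- Coefficients are listed from the highest power of x down, and the form has degree one less than their number.
  form : List ℤ → Carrier → Carrier → Carrier
  form []       x y = 0#
  form (c ∷ cs) x y = ι c * pow x (length cs) + y * form cs x y

  form-zero : ∀ {cs} → All (_≡ 0ℤ) cs → ∀ x y → form cs x y ≈ 0#
  form-zero []                      x y = refl
  form-zero {c ∷ cs} (≡.refl ∷ eqs) x y =
    trans (+-cong (zeroˡ _) (trans (*-congˡ (form-zero eqs x y)) (zeroʳ _))) (+-identityˡ _)

  monic : List ℤ → Carrier → Carrier → Carrier
  monic as = form (1ℤ ∷ as)

-- Long division of coefficient lists by monic ones.

-- One step of long division: `as` is the divisor without its leading 1, which has cancelled the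
-- coefficient c of the dividend.
subtractFront : ℤ → List ℤ → List ℤ → List ℤ
subtractFront c []       bs       = bs
subtractFront c (a ∷ as) []       = []
subtractFront c (a ∷ as) (b ∷ bs) = b ℤ.- c ℤ.* a ∷ subtractFront c as bs

length-subtractFront : ∀ c as bs → length (subtractFront c as bs) ≡ length bs
length-subtractFront c []       bs       = ≡.refl
length-subtractFront c (a ∷ as) []       = ≡.refl
length-subtractFront c (a ∷ as) (b ∷ bs) = ≡.cong suc (length-subtractFront c as bs)

-- The divisor is `1ℤ ∷ as`, so no coefficient is ever divided and all stay in ℤ. The number counts
-- the coefficients of the quotient, one more than its degree.
quot rem : ℕ → List ℤ → List ℤ → List ℤ
quot zero    as cs       = []
quot (suc n) as []       = []
quot (suc n) as (c ∷ cs) = c ∷ quot n as (subtractFront c as cs)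
rem zero    as cs       = cs
rem (suc n) as []       = []
rem (suc n) as (c ∷ cs) = rem n as (subtractFront c as cs)

length-quot : ∀ n as cs → length cs ≡ n ℕ.+ length as → length (quot n as cs) ≡ n
length-quot zero    as cs       eq = ≡.refl
length-quot (suc n) as (c ∷ cs) eq =
  ≡.cong suc (length-quot n as _ (≡.trans (length-subtractFront c as cs) (ℕₚ.suc-injective eq)))

length-rem : ∀ n as cs → length cs ≡ n ℕ.+ length as → length (rem n as cs) ≡ length as
length-rem zero    as cs       eq = eq
length-rem (suc n) as (c ∷ cs) eq =
  length-rem n as _ (≡.trans (length-subtractFront c as cs) (ℕₚ.suc-injective eq))

module FormDivision {c ℓ : Level} (K : CommutativeRing c ℓ) where
  open Ring K

  form-subtractFront : ∀ c k as bs x y → length bs ≡ k ℕ.+ length as →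
    form (subtractFront c as bs) x y ≈ form bs x y - ι c * pow x k * form as x y
  form-subtractFront c k []       bs       x y eq =
    solve 2 (λ b d → b := b :- d :* con 0ℤ) refl (form bs x y) (ι c * pow x k)
  form-subtractFront c k (a ∷ as) []       x y eq with () ← ≡.trans eq (ℕₚ.+-suc k (length as))
  form-subtractFront c k (a ∷ as) (b ∷ bs) x y eq = begin
    ι (b ℤ.- c ℤ.* a) * pow x (length (subtractFront c as bs)) + y * form (subtractFront c as bs) x y
      ≈⟨ +-cong (*-cong coefficient (trans (reflexive (≡.cong (pow x) (length-subtractFront c as bs))) power))
                (*-congˡ (form-subtractFront c k as bs x y |bs|≡)) ⟩
    (ι b - ι c * ι a) * (pow x k * pow x (length as)) + y * (form bs x y - ι c * pow x k * form as x y)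
      ≈⟨ solve 8 (λ y b c a xk xl B A → (b :- c :* a) :* (xk :* xl) :+ y :* (B :- c :* xk :* A) :=
                   (b :* (xk :* xl) :+ y :* B) :- c :* xk :* (a :* xl :+ y :* A))
           refl y (ι b) (ι c) (ι a) (pow x k) (pow x (length as)) (form bs x y) (form as x y) ⟩
    (ι b * (pow x k * pow x (length as)) + y * form bs x y) -
      ι c * pow x k * (ι a * pow x (length as) + y * form as x y)
      ≈⟨ +-congʳ (+-congʳ (*-congˡ power)) ⟨
    form (b ∷ bs) x y - ι c * pow x k * form (a ∷ as) x y ∎
    where
    |bs|≡ : length bs ≡ k ℕ.+ length as
    |bs|≡ = ℕₚ.suc-injective (≡.trans eq (ℕₚ.+-suc k (length as)))
    coefficient : ι (b ℤ.- c ℤ.* a) ≈ ι b - ι c * ι a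
    coefficient = trans (ι-+ b (ℤ.- (c ℤ.* a))) (+-congˡ (trans (ι-neg (c ℤ.* a)) (-‿cong (ι-* c a))))
    power : pow x (length bs) ≈ pow x k * pow x (length as)
    power = trans (reflexive (≡.cong (pow x) |bs|≡)) (pow-+ x k (length as))

  -- The identity is homogeneous: the remainder has n coefficients fewer than the dividend, and yⁿ
  -- makes up the degree.
  form-quot-rem : ∀ n as cs x y → length cs ≡ n ℕ.+ length as →
    form cs x y ≈ monic as x y * form (quot n as cs) x y + pow y n * form (rem n as cs) x y
  form-quot-rem zero as cs x y eq =
    trans (solve 2 (λ c a → c := a :* con 0ℤ :+ c) refl (form cs x y) (monic as x y))
          (+-congˡ (sym (*-identityˡ _)))
  form-quot-rem (suc n) as (c ∷ cs) x y eq = begin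
    ι c * pow x (length cs) + y * form cs x y
      ≈⟨ +-cong (*-congˡ (trans (reflexive (≡.cong (pow x) |cs|≡)) (pow-+ x n (length as)))) refl ⟩
    ι c * (xn * xl) + y * form cs x y
      ≈⟨ solve 6 (λ y c xn xl C A → c :* (xn :* xl) :+ y :* C :=
                     (con 1ℤ :* xl :+ y :* A) :* (c :* xn) :+ y :* (C :- c :* xn :* A))
           refl y (ι c) xn xl (form cs x y) (form as x y) ⟩
    monic as x y * (ι c * xn) + y * (form cs x y - ι c * xn * form as x y)
      ≈⟨ +-congˡ (*-congˡ (form-subtractFront c n as cs x y |cs|≡)) ⟨
    monic as x y * (ι c * xn) + y * form cs′ x y
      ≈⟨ +-congˡ (*-congˡ (form-quot-rem n as cs′ x y |cs′|≡)) ⟩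
    monic as x y * (ι c * xn) + y * (monic as x y * Q + pow y n * R)
      ≈⟨ solve 6 (λ m cx y q yn r → m :* cx :+ y :* (m :* q :+ yn :* r) := m :* (cx :+ y :* q) :+ y :* yn :* r)
           refl (monic as x y) (ι c * xn) y Q (pow y n) R ⟩
    monic as x y * (ι c * xn + y * Q) + y * pow y n * R
      ≈⟨ +-congʳ (*-congˡ (+-congʳ (*-congˡ (reflexive (≡.cong (pow x) (length-quot n as cs′ |cs′|≡)))))) ⟨
    monic as x y * form (c ∷ quot n as cs′) x y + pow y (suc n) * R ∎
    where
    cs′ = subtractFront c as cs
    |cs|≡ = ℕₚ.suc-injective eq
    |cs′|≡ = ≡.trans (length-subtractFront c as cs) |cs|≡
    xn = pow x n
    xl = pow x (length as)
    Q = form (quot n as cs′) x y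
    R = form (rem n as cs′) x y

-- Quotients of monic forms with zero remainder, recorded independently of the ring of evaluation.
record ExactQuotient (fs as qs : List ℤ) : Set where
  field
    degree    : ℕ
    length-≡  : length (1ℤ ∷ fs) ≡ degree ℕ.+ length as
    quot-≡    : quot degree as (1ℤ ∷ fs) ≡ 1ℤ ∷ qs
    rem-≡     : All (_≡ 0ℤ) (rem degree as (1ℤ ∷ fs))

module _ {c ℓ} (K : CommutativeRing c ℓ) where
  open Ring K
  monic-factor : ∀ {fs as qs} → ExactQuotient fs as qs → ∀ x y → monic fs x y ≈ monic as x y * monic qs x y
  monic-factor {fs} {as} {qs} exact x y = begin
    monic fs x y
      ≈⟨ FormDivision.form-quot-rem K degree as (1ℤ ∷ fs) x y length-≡ ⟩
    monic as x y * form (quot degree as (1ℤ ∷ fs)) x y + pow y degree * form (rem degree as (1ℤ ∷ fs)) x y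
      ≈⟨ +-cong (*-congˡ (reflexive (≡.cong (λ cs → form cs x y) quot-≡)))
                (trans (*-congˡ (form-zero rem-≡ x y)) (zeroʳ _)) ⟩
    monic as x y * monic qs x y + 0#
      ≈⟨ +-identityʳ _ ⟩
    monic as x y * monic qs x y ∎
    where
    open ExactQuotient exact

-- Growth of integer polynomials and exact division.

module 𝒵 = Ring ℤₚ.+-*-commutativeRing

ι-id : ∀ z → 𝒵.ι z ≡ z
ι-id (+ n)    = ν-id n
  where
  ν-id : ∀ n → 𝒵.ι (+ n) ≡ + n
  ν-id zero    = ≡.refl
  ν-id (suc n) = ≡.cong (λ z → 1ℤ ℤ.+ z) (ν-id n)
ι-id -[1+ n ] = ≡.cong ℤ.-_ (ι-id (+ suc n))

eval : List ℤ → ℕ → ℤ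
eval cs x = 𝒵.form cs (+ x) 1ℤ

size : List ℤ → ℕ
size []       = 0
size (c ∷ cs) = ∣ c ∣ ℕ.+ size cs

pow-+ⁿ : ∀ x n → 𝒵.pow (+ x) n ≡ + (x ℕ.^ n)
pow-+ⁿ x zero    = ≡.refl
pow-+ⁿ x (suc n) = ≡.trans (≡.cong (λ z → + x ℤ.* z) (pow-+ⁿ x n)) (≡.sym (ℤₚ.pos-* x (x ℕ.^ n)))

eval-∷ : ∀ c cs x → eval (c ∷ cs) x ≡ c ℤ.* + (x ℕ.^ length cs) ℤ.+ eval cs x
eval-∷ c cs x = ≡.cong₂ ℤ._+_ (≡.cong₂ ℤ._*_ (ι-id c) (pow-+ⁿ x (length cs))) (ℤₚ.*-identityˡ (eval cs x))

-- A polynomial with l coefficients is at most the sum of their absolute values times x to the power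
-- l - 1; the extra x on both sides avoids the subtraction.
∣eval∣-bound : ∀ cs x → 1 ℕ.≤ x → ∣ eval cs x ∣ ℕ.* x ℕ.≤ size cs ℕ.* x ℕ.^ length cs
∣eval∣-bound []       x 1≤x = z≤n
∣eval∣-bound (c ∷ cs) x 1≤x = begin
  ∣ eval (c ∷ cs) x ∣ ℕ.* x
    ≡⟨ ≡.cong (λ z → ∣ z ∣ ℕ.* x) (eval-∷ c cs x) ⟩
  ∣ c ℤ.* + X ℤ.+ eval cs x ∣ ℕ.* x
    ≤⟨ ℕₚ.*-monoˡ-≤ x (ℤₚ.∣i+j∣≤∣i∣+∣j∣ (c ℤ.* + X) (eval cs x)) ⟩
  (∣ c ℤ.* + X ∣ ℕ.+ ∣ eval cs x ∣) ℕ.* x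
    ≡⟨ ≡.cong (λ z → (z ℕ.+ ∣ eval cs x ∣) ℕ.* x) (ℤₚ.abs-* c (+ X)) ⟩
  (∣ c ∣ ℕ.* X ℕ.+ ∣ eval cs x ∣) ℕ.* x
    ≡⟨ lemma (∣ c ∣) X (∣ eval cs x ∣) x ⟩
  ∣ c ∣ ℕ.* (x ℕ.* X) ℕ.+ ∣ eval cs x ∣ ℕ.* x
    ≤⟨ ℕₚ.+-monoʳ-≤ (∣ c ∣ ℕ.* (x ℕ.* X)) (ℕₚ.≤-trans (∣eval∣-bound cs x 1≤x)
         (ℕₚ.*-monoʳ-≤ (size cs) (ℕₚ.m≤n*m X x))) ⟩
  ∣ c ∣ ℕ.* (x ℕ.* X) ℕ.+ size cs ℕ.* (x ℕ.* X)
    ≡⟨ ℕₚ.*-distribʳ-+ (x ℕ.* X) ∣ c ∣ (size cs) ⟨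
  size (c ∷ cs) ℕ.* x ℕ.^ length (c ∷ cs) ∎
  where
  open ℕₚ.≤-Reasoning
  instance _ = ℕ.>-nonZero 1≤x
  X = x ℕ.^ length cs
  lemma : ∀ c X e x → (c ℕ.* X ℕ.+ e) ℕ.* x ≡ c ℕ.* (x ℕ.* X) ℕ.+ e ℕ.* x
  lemma = ℕ-solve-∀

monic-bound : ∀ as x → 1 ℕ.≤ x →
  x ℕ.^ length as ℕ.* x ℕ.≤ ∣ eval (1ℤ ∷ as) x ∣ ℕ.* x ℕ.+ size as ℕ.* x ℕ.^ length as
monic-bound as x 1≤x = begin
  X ℕ.* x
    ≡⟨ ≡.cong (λ z → ∣ z ∣ ℕ.* x) (≡.trans (lemma (+ X) (eval as x)) (≡.cong (ℤ._- eval as x) (≡.sym (eval-∷ 1ℤ as x)))) ⟩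
  ∣ eval (1ℤ ∷ as) x ℤ.- eval as x ∣ ℕ.* x
    ≤⟨ ℕₚ.*-monoˡ-≤ x (ℤₚ.∣i-j∣≤∣i∣+∣j∣ (eval (1ℤ ∷ as) x) (eval as x)) ⟩
  (∣ eval (1ℤ ∷ as) x ∣ ℕ.+ ∣ eval as x ∣) ℕ.* x
    ≡⟨ ℕₚ.*-distribʳ-+ x (∣ eval (1ℤ ∷ as) x ∣) (∣ eval as x ∣) ⟩
  ∣ eval (1ℤ ∷ as) x ∣ ℕ.* x ℕ.+ ∣ eval as x ∣ ℕ.* x
    ≤⟨ ℕₚ.+-monoʳ-≤ (∣ eval (1ℤ ∷ as) x ∣ ℕ.* x) (∣eval∣-bound as x 1≤x) ⟩
  ∣ eval (1ℤ ∷ as) x ∣ ℕ.* x ℕ.+ size as ℕ.* X ∎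
  where
  open ℕₚ.≤-Reasoning
  X = x ℕ.^ length as
  lemma : ∀ X e → X ≡ 1ℤ ℤ.* X ℤ.+ e ℤ.- e
  lemma = ℤ-solve-∀

-- If h were nonzero, the value of the monic divisor would be at most N times that of a polynomial
-- of smaller degree, which fails once x exceeds the stated combination of coefficient sizes.
eval-multiple-zero : ∀ as rs N .{{_ : ℕ.NonZero N}} x h → length rs ℕ.≤ length as → N ℕ.* size rs ℕ.+ size as ℕ.< x →
  + N ℤ.* eval rs x ≡ eval (1ℤ ∷ as) x ℤ.* h → eval rs x ≡ 0ℤ
eval-multiple-zero as rs N x h |rs|≤|as| x-large eq with h ℤₚ.≟ 0ℤ
... | yes ≡.refl with ℤₚ.i*j≡0⇒i≡0∨j≡0 (+ N) (≡.trans eq (ℤₚ.*-zeroʳ (eval (1ℤ ∷ as) x)))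
...   | inj₁ +N≡0 = contradiction (ℤₚ.+-injective +N≡0) (ℕ.≢-nonZero⁻¹ N)
...   | inj₂ r≡0  = r≡0
eval-multiple-zero as rs N x h |rs|≤|as| x-large eq | no h≢0 = contradiction impossible (ℕₚ.<-irrefl ≡.refl)
  where
  open ℕₚ.≤-Reasoning
  X = x ℕ.^ length as
  1≤x : 1 ℕ.≤ x
  1≤x = ℕₚ.≤-trans (s≤s z≤n) x-large
  instance
    _ = ℕ.>-nonZero 1≤x
    _ = ℕₚ.m^n≢0 x (length as)
    _ = ℕ.≢-nonZero (h≢0 ∘ ℤₚ.∣i∣≡0⇒i≡0)
  a≤Nr : ∣ eval (1ℤ ∷ as) x ∣ ℕ.≤ N ℕ.* ∣ eval rs x ∣
  a≤Nr = begin
    ∣ eval (1ℤ ∷ as) x ∣             ≤⟨ ℕₚ.m≤m*n (∣ eval (1ℤ ∷ as) x ∣) (∣ h ∣) ⟩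
    ∣ eval (1ℤ ∷ as) x ∣ ℕ.* ∣ h ∣   ≡⟨ ℤₚ.abs-* (eval (1ℤ ∷ as) x) h ⟨
    ∣ eval (1ℤ ∷ as) x ℤ.* h ∣       ≡⟨ ≡.cong ∣_∣ eq ⟨
    ∣ + N ℤ.* eval rs x ∣            ≡⟨ ℤₚ.abs-* (+ N) (eval rs x) ⟩
    N ℕ.* ∣ eval rs x ∣              ∎
  impossible : X ℕ.* x ℕ.< X ℕ.* x
  impossible = begin-strict
    X ℕ.* x
      ≤⟨ monic-bound as x 1≤x ⟩
    ∣ eval (1ℤ ∷ as) x ∣ ℕ.* x ℕ.+ size as ℕ.* X
      ≤⟨ ℕₚ.+-monoˡ-≤ (size as ℕ.* X) (ℕₚ.*-monoˡ-≤ x a≤Nr) ⟩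
    N ℕ.* ∣ eval rs x ∣ ℕ.* x ℕ.+ size as ℕ.* X
      ≡⟨ ≡.cong (ℕ._+ size as ℕ.* X) (ℕₚ.*-assoc N ∣ eval rs x ∣ x) ⟩
    N ℕ.* (∣ eval rs x ∣ ℕ.* x) ℕ.+ size as ℕ.* X
      ≤⟨ ℕₚ.+-monoˡ-≤ (size as ℕ.* X) (ℕₚ.*-monoʳ-≤ N (ℕₚ.≤-trans (∣eval∣-bound rs x 1≤x)
           (ℕₚ.*-monoʳ-≤ (size rs) (ℕₚ.^-monoʳ-≤ x |rs|≤|as|)))) ⟩
    N ℕ.* (size rs ℕ.* X) ℕ.+ size as ℕ.* X
      ≡⟨ lemma N (size rs) (size as) X ⟩
    X ℕ.* (N ℕ.* size rs ℕ.+ size as)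
      <⟨ ℕₚ.*-monoʳ-< X x-large ⟩
    X ℕ.* x ∎
    where
    lemma : ∀ N r a X → N ℕ.* (r ℕ.* X) ℕ.+ a ℕ.* X ≡ X ℕ.* (N ℕ.* r ℕ.+ a)
    lemma = ℕ-solve-∀

-- At a point beyond the size of the tail, a nonzero leading term outweighs all the others. Once the
-- leading coefficient is known to be 0, the tail vanishes at the same points.
eval-zero⇒All-zero : ∀ rs x₀ → (∀ x → x₀ ℕ.≤ x → eval rs x ≡ 0ℤ) → All (_≡ 0ℤ) rs
eval-zero⇒All-zero []       x₀ vanish = []
eval-zero⇒All-zero (c ∷ cs) x₀ vanish = c≡0 ∷ eval-zero⇒All-zero cs x₀ tail-vanishes
  where
  open ℕₚ.≤-Reasoning
  x = suc (size cs ℕ.+ x₀)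
  X = x ℕ.^ length cs
  instance
    _ = ℕₚ.m^n≢0 x (length cs)
  balance : ∀ x → x₀ ℕ.≤ x → c ℤ.* + (x ℕ.^ length cs) ℤ.+ eval cs x ≡ 0ℤ
  balance x x₀≤x = ≡.trans (≡.sym (eval-∷ c cs x)) (vanish x x₀≤x)
  ∣c∣X≡ : ∣ c ∣ ℕ.* X ≡ ∣ eval cs x ∣
  ∣c∣X≡ = ≡.trans (≡.sym (ℤₚ.abs-* c (+ X))) (≡.trans (≡.cong ∣_∣ (≡.trans (lemma (c ℤ.* + X) (eval cs x)) (≡.trans (≡.cong (ℤ._- eval cs x) (balance x x₀≤x)) (ℤₚ.+-identityˡ (ℤ.- eval cs x))))) (ℤₚ.∣-i∣≡∣i∣ (eval cs x)))
    where
    lemma : ∀ i j → i ≡ i ℤ.+ j ℤ.- j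
    lemma = ℤ-solve-∀
    x₀≤x : x₀ ℕ.≤ x
    x₀≤x = ℕₚ.m≤n⇒m≤1+n (ℕₚ.m≤n+m x₀ (size cs))
  c≡0 : c ≡ 0ℤ
  c≡0 with ∣ c ∣ in ∣c∣≡
  ... | zero  = ℤₚ.∣i∣≡0⇒i≡0 ∣c∣≡
  ... | suc k = contradiction impossible (ℕₚ.<-irrefl ≡.refl)
    where
    impossible : X ℕ.* x ℕ.< X ℕ.* x
    impossible = begin-strict
      X ℕ.* x                        ≤⟨ ℕₚ.m≤n*m (X ℕ.* x) (suc k) ⟩
      suc k ℕ.* (X ℕ.* x)            ≡⟨ ℕₚ.*-assoc (suc k) X x ⟨
      suc k ℕ.* X ℕ.* x              ≡⟨ ≡.cong (λ k → k ℕ.* X ℕ.* x) ∣c∣≡ ⟨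
      ∣ c ∣ ℕ.* X ℕ.* x              ≡⟨ ≡.cong (ℕ._* x) ∣c∣X≡ ⟩
      ∣ eval cs x ∣ ℕ.* x            ≤⟨ ∣eval∣-bound cs x (s≤s z≤n) ⟩
      size cs ℕ.* X                  ≡⟨ ℕₚ.*-comm (size cs) X ⟩
      X ℕ.* size cs                  <⟨ ℕₚ.*-monoʳ-< X (s≤s (ℕₚ.m≤m+n (size cs) x₀)) ⟩
      X ℕ.* x                        ∎
  tail-vanishes : ∀ x → x₀ ℕ.≤ x → eval cs x ≡ 0ℤ
  tail-vanishes x x₀≤x = ≡.trans (≡.sym (ℤₚ.+-identityˡ (eval cs x)))
    (≡.trans (≡.cong (λ c → c ℤ.* + (x ℕ.^ length cs) ℤ.+ eval cs x) (≡.sym c≡0)) (balance x x₀≤x))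

-- A remainder r of f by a satisfies a(x) ∣ N r(x) at all large x, which is impossible for deg r < deg a unless r = 0.
exactQuotient : ∀ fs as N .{{_ : ℕ.NonZero N}} x₀ →
  (∀ x → x₀ ℕ.≤ x → ∃[ h ] + N ℤ.* eval (1ℤ ∷ fs) x ≡ eval (1ℤ ∷ as) x ℤ.* h) →
  ∃[ qs ] ExactQuotient fs as qs
exactQuotient fs as N x₀ divisible with length (1ℤ ∷ fs) ℕ.≤? length as
-- A dividend of smaller degree than the divisor is its own remainder, hence would be zero in spite
-- of its leading 1.
... | yes |f|≤|a| = contradiction (All.head f≡0) λ ()
  where
  bound = x₀ ℕ.+ suc (N ℕ.* size (1ℤ ∷ fs) ℕ.+ size as)
  f≡0 : All (_≡ 0ℤ) (1ℤ ∷ fs)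
  f≡0 = eval-zero⇒All-zero (1ℤ ∷ fs) bound λ x bound≤x →
    let h , eq = divisible x (ℕₚ.≤-trans (ℕₚ.m≤m+n x₀ _) bound≤x) in
    eval-multiple-zero as (1ℤ ∷ fs) N x h |f|≤|a| (ℕₚ.≤-trans (ℕₚ.m≤n+m _ x₀) bound≤x) eq
-- Because `suc n` is a successor, the quotient computes to a list with head `1ℤ`; its tail is found
-- by unification.
... | no |f|≰|a| = _ , record { degree = suc n ; length-≡ = |f|≡ ; quot-≡ = ≡.refl ; rem-≡ = rem≡0 }
  where
  n = length fs ℕ.∸ length as
  |f|≡ : length (1ℤ ∷ fs) ≡ suc n ℕ.+ length as
  |f|≡ = ≡.cong suc (≡.sym (ℕₚ.m∸n+n≡m (ℕ.s≤s⁻¹ (ℕₚ.≰⇒> |f|≰|a|))))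
  qs = quot (suc n) as (1ℤ ∷ fs)
  rs = rem (suc n) as (1ℤ ∷ fs)
  bound = x₀ ℕ.+ suc (N ℕ.* size rs ℕ.+ size as)
  lemma : ∀ N f a q y r h → f ≡ a ℤ.* q ℤ.+ y ℤ.* r → y ≡ 1ℤ → N ℤ.* f ≡ a ℤ.* h → N ℤ.* r ≡ a ℤ.* (h ℤ.- N ℤ.* q)
  lemma N _ a q _ r h ≡.refl ≡.refl eq = ≡.trans (identity N a q r) (≡.trans (≡.cong (ℤ._- N ℤ.* (a ℤ.* q)) eq) (identity′ N a q h))
    where
    identity : ∀ N a q r → N ℤ.* r ≡ N ℤ.* (a ℤ.* q ℤ.+ 1ℤ ℤ.* r) ℤ.- N ℤ.* (a ℤ.* q)
    identity = ℤ-solve-∀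
    identity′ : ∀ N a q h → a ℤ.* h ℤ.- N ℤ.* (a ℤ.* q) ≡ a ℤ.* (h ℤ.- N ℤ.* q)
    identity′ = ℤ-solve-∀
  rem≡0 : All (_≡ 0ℤ) rs
  rem≡0 = eval-zero⇒All-zero rs bound λ x bound≤x →
    let h , eq = divisible x (ℕₚ.≤-trans (ℕₚ.m≤m+n x₀ _) bound≤x) in
    eval-multiple-zero as rs N x (h ℤ.- + N ℤ.* eval qs x) (ℕₚ.≤-reflexive (length-rem (suc n) as (1ℤ ∷ fs) |f|≡))
      (ℕₚ.≤-trans (ℕₚ.m≤n+m _ x₀) bound≤x)
      (lemma (+ N) (eval (1ℤ ∷ fs) x) (eval (1ℤ ∷ as) x) (eval qs x) (𝒵.pow 1ℤ (suc n)) (eval rs x) h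
        (FormDivision.form-quot-rem ℤₚ.+-*-commutativeRing (suc n) as (1ℤ ∷ fs) (+ x) 1ℤ |f|≡)
        (𝒵.pow-1# (suc n)) eq)

-- Cyclotomic forms, characterised by the factorisations of Xᵏ - Yᵏ.

extend : (ℕ → List ℤ) → ℕ → List ℤ → ℕ → List ℤ
extend Φ n q e = if does (e ℕ.≟ n) then q else Φ e

extend-new : ∀ Φ n q → extend Φ n q n ≡ q
extend-new Φ n q = ≡.cong (if_then q else Φ n) (dec-true (n ℕ.≟ n) ≡.refl)

extend-old : ∀ Φ n q e → e ≢ n → extend Φ n q e ≡ Φ e
extend-old Φ n q e e≢n = ≡.cong (if_then q else Φ e) (dec-false (e ℕ.≟ n) e≢n)

module Cyclotomics {c ℓ} (R : CommutativeRing c ℓ) where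
  open Ring R

  factor : (ℕ → List ℤ) → ℕ → Carrier → Carrier → ℕ → Carrier
  factor Φ k x y e = when (e ∣? k) (monic (Φ e) x y)

  -- The forms are specified by these factorisations and not by roots of unity, which the ring need
  -- not contain.
  Cyclotomic : (ℕ → List ℤ) → ℕ → Set (c ⊔ ℓ)
  Cyclotomic Φ n = ∀ k → 1 ℕ.≤ k → k ℕ.≤ n → ∀ x y → pow x k - pow y k ≈ ∏₁ n (factor Φ k x y)

  -- q is what is left of Xᵏ - Yᵏ after division by the Φ e with e ≤ j.
  Partial : (ℕ → List ℤ) → ℕ → ℕ → List ℤ → Set (c ⊔ ℓ)
  Partial Φ k j q = ∀ x y → pow x k - pow y k ≈ ∏₁ j (factor Φ k x y) * monic q x y

  -- The coefficients of Xⁿ⁺¹ - Yⁿ⁺¹ without the leading 1.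
  binomial : ℕ → List ℤ
  binomial n = replicate n 0ℤ ++ ℤ.-1ℤ ∷ []

  partial-zero : ∀ Φ n → Partial Φ (suc n) 0 (binomial n)
  partial-zero Φ n x y = begin
    pow x (suc n) - pow y (suc n)
      ≈⟨ solve 3 (λ a y b → a :- y :* b := con 1ℤ :* a :+ y :* (:- b)) refl (pow x (suc n)) y (pow y n) ⟩
    ι 1ℤ * pow x (suc n) + y * - pow y n
      ≈⟨ +-cong (*-congˡ (reflexive (≡.cong (pow x) (≡.sym length-binomial)))) (*-congˡ (sym (form-binomial n))) ⟩
    monic (binomial n) x y
      ≈⟨ *-identityˡ _ ⟨
    1# * monic (binomial n) x y ∎
    where
    length-binomial : length (binomial n) ≡ suc n
    length-binomial = ≡.trans (length-++ (replicate n 0ℤ))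
      (≡.trans (≡.cong (ℕ._+ 1) (length-replicate n)) (ℕₚ.+-comm n 1))
    form-binomial : ∀ n → form (binomial n) x y ≈ - pow y n
    form-binomial zero    = begin
      - ι 1ℤ * 1# + y * 0#  ≈⟨ +-cong (*-identityʳ _) (zeroʳ y) ⟩
      - ι 1ℤ + 0#           ≈⟨ +-identityʳ _ ⟩
      - ι 1ℤ                ≈⟨ -‿cong ι-1 ⟩
      - 1#                  ∎
    form-binomial (suc n) = begin
      0# * pow x (length (binomial n)) + y * form (binomial n) x y  ≈⟨ +-cong (zeroˡ _) (*-congˡ (form-binomial n)) ⟩
      0# + y * - pow y n  ≈⟨ solve 2 (λ y b → con 0ℤ :+ y :* (:- b) := :- (y :* b)) refl y (pow y n) ⟩
      - pow y (suc n) ∎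

  partial-skip : ∀ {Φ k j q} → ¬ suc j ∣ k → Partial Φ k j q → Partial Φ k (suc j) q
  partial-skip {Φ} {k} {j} {q} j∤k partial x y = trans (partial x y)
    (*-congʳ (sym (trans (*-congˡ (reflexive (when-no (suc j ∣? k) j∤k))) (*-identityʳ _))))

  partial-divide : ∀ {Φ k j q q′} → suc j ∣ k → ExactQuotient q (Φ (suc j)) q′ →
    Partial Φ k j q → Partial Φ k (suc j) q′
  partial-divide {Φ} {k} {j} {q} {q′} j∣k exact partial x y = begin
    pow x k - pow y k                                            ≈⟨ partial x y ⟩
    ∏₁ j F * monic q x y                                         ≈⟨ *-congˡ (monic-factor R exact x y) ⟩
    ∏₁ j F * (monic (Φ (suc j)) x y * monic q′ x y)              ≈⟨ *-assoc _ _ _ ⟨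
    ∏₁ j F * monic (Φ (suc j)) x y * monic q′ x y
      ≈⟨ *-congʳ (*-congˡ (reflexive (when-yes (suc j ∣? k) j∣k))) ⟨
    ∏₁ (suc j) F * monic q′ x y                                  ∎
    where F = factor Φ k x y

  -- The new form is what remains of Xⁿ⁺¹ - Yⁿ⁺¹ after all its proper divisors are used up. The
  -- factorisations for k ≤ n are unaffected, as n + 1 does not divide such k.
  cyclotomic-extend : ∀ {Φ n q} → Cyclotomic Φ n → Partial Φ (suc n) n q → Cyclotomic (extend Φ (suc n) q) (suc n)
  cyclotomic-extend {Φ} {n} {q} cyc partial k 1≤k k≤1+n x y = lemma (k ℕ.≟ suc n)
    where
    Φ′ = extend Φ (suc n) q
    F≈F′ : ∏₁ n (factor Φ k x y) ≈ ∏₁ n (factor Φ′ k x y)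
    F≈F′ = ∏₁-cong n λ e _ e≤n →
      reflexive (≡.cong (λ cs → when (e ∣? k) (monic cs x y)) (≡.sym (extend-old Φ (suc n) q e (ℕₚ.<⇒≢ (s≤s e≤n)))))
    lemma : Dec (k ≡ suc n) → pow x k - pow y k ≈ ∏₁ (suc n) (factor Φ′ k x y)
    lemma (yes ≡.refl) = trans (partial x y) (*-cong F≈F′ (reflexive (≡.sym (≡.trans
      (when-yes (suc n ∣? k) ∣-refl) (≡.cong (λ cs → monic cs x y) (extend-new Φ (suc n) q))))))
    lemma (no k≢1+n) = trans (cyc k 1≤k (ℕ.s≤s⁻¹ k<1+n) x y) (trans F≈F′ (sym (trans
      (*-congˡ (reflexive (when-no (suc n ∣? k) (ℕₚ.<⇒≱ k<1+n ∘ ∣⇒≤ {{ℕ.>-nonZero 1≤k}})))) (*-identityʳ _))))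
      where
      k<1+n : k ℕ.< suc n
      k<1+n = ℕₚ.≤∧≢⇒< k≤1+n k≢1+n

open Cyclotomics ℤₚ.+-*-commutativeRing using ()
  renaming (Cyclotomic to ℤ-Cyclotomic; Partial to ℤ-Partial; factor to ℤ-factor)

-- Coprimality, up to a constant, of the values of cyclotomic forms.

pow-1 : ℕ → ℕ → ℤ
pow-1 x k = 𝒵.pow (+ x) k ℤ.- 1ℤ

-- G is 1 + Y + ... + Yᵗ⁻¹, and S witnesses that it is congruent to t modulo Y - 1.
geometric : ∀ (Y : ℤ) t → ∃₂ λ G S → 𝒵.pow Y t ℤ.- 1ℤ ≡ (Y ℤ.- 1ℤ) ℤ.* G × G ≡ + t ℤ.+ (Y ℤ.- 1ℤ) ℤ.* S
geometric Y zero    = 0ℤ , 0ℤ , ≡.sym (ℤₚ.*-zeroʳ (Y ℤ.- 1ℤ)) , ≡.sym (≡.trans (ℤₚ.+-identityˡ _) (ℤₚ.*-zeroʳ (Y ℤ.- 1ℤ)))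
geometric Y (suc t) with geometric Y t
... | G , S , Yᵗ-1≡ , G≡ = Y ℤ.* G ℤ.+ 1ℤ , Y ℤ.* S ℤ.+ + t ,
  ≡.trans (lemma₁ Y (𝒵.pow Y t)) (≡.trans (≡.cong (λ z → Y ℤ.* z ℤ.+ (Y ℤ.- 1ℤ)) Yᵗ-1≡) (lemma₂ Y G)) ,
  ≡.trans (≡.cong (λ z → Y ℤ.* z ℤ.+ 1ℤ) G≡) (lemma₃ Y S (+ t))
  where
  lemma₁ : ∀ Y P → Y ℤ.* P ℤ.- 1ℤ ≡ Y ℤ.* (P ℤ.- 1ℤ) ℤ.+ (Y ℤ.- 1ℤ)
  lemma₁ = ℤ-solve-∀
  lemma₂ : ∀ Y G → Y ℤ.* ((Y ℤ.- 1ℤ) ℤ.* G) ℤ.+ (Y ℤ.- 1ℤ) ≡ (Y ℤ.- 1ℤ) ℤ.* (Y ℤ.* G ℤ.+ 1ℤ)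
  lemma₂ = ℤ-solve-∀
  lemma₃ : ∀ Y S t → Y ℤ.* (t ℤ.+ (Y ℤ.- 1ℤ) ℤ.* S) ℤ.+ 1ℤ ≡ 1ℤ ℤ.+ t ℤ.+ (Y ℤ.- 1ℤ) ℤ.* (Y ℤ.* S ℤ.+ t)
  lemma₃ = ℤ-solve-∀

pow-1-∣ : ∀ x {g e} → g ∣ e → pow-1 x g ℤ∣.∣ pow-1 x e
pow-1-∣ x {g} (divides t ≡.refl) with geometric (𝒵.pow (+ x) g) t
... | G , _ , eq , _ = ℤ∣.divides G (≡.trans (≡.cong (ℤ._- 1ℤ) (𝒵.pow-* (+ x) t g)) (≡.trans eq (ℤₚ.*-comm _ G)))

-- The sum n exhibits n as an element of the ideal generated by a and b.
record Combination (n a b : ℤ) : Set where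
  constructor combination
  field
    {left right} : ℤ
    left-∣  : a ℤ∣.∣ left
    right-∣ : b ℤ∣.∣ right
    sum-≡   : left ℤ.+ right ≡ n

Combination-swap : ∀ {n a b} → Combination n a b → Combination n b a
Combination-swap (combination {l} {r} a∣l b∣r eq) = combination b∣r a∣l (≡.trans (ℤₚ.+-comm r l) eq)

-- As for coprimality: in the product (l + r) (l′ + r′) every term except r r′ is a multiple of a.
Combination-* : ∀ {m n a b c} → Combination m a b → Combination n a c → Combination (m ℤ.* n) a (b ℤ.* c)
Combination-* (combination {l} {r} a∣l b∣r ≡.refl) (combination {l′} {r′} a∣l′ c∣r′ ≡.refl) =
  combination (ℤ∣.∣m∣n⇒∣m+n (ℤ∣.∣m⇒∣m*n (l′ ℤ.+ r′) a∣l) (ℤ∣.∣n⇒∣m*n r a∣l′))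
              (∣-* b∣r c∣r′) (lemma l r l′ r′)
  where
  lemma : ∀ l r l′ r′ → l ℤ.* (l′ ℤ.+ r′) ℤ.+ r ℤ.* l′ ℤ.+ r ℤ.* r′ ≡ (l ℤ.+ r) ℤ.* (l′ ℤ.+ r′)
  lemma = ℤ-solve-∀
  ∣-* : ∀ {b c r r′} → b ℤ∣.∣ r → c ℤ∣.∣ r′ → b ℤ.* c ℤ∣.∣ r ℤ.* r′
  ∣-* {b} {c} (ℤ∣.divides q ≡.refl) (ℤ∣.divides q′ ≡.refl) = ℤ∣.divides (q ℤ.* q′) (lemma′ q b q′ c)
    where
    lemma′ : ∀ q b q′ c → q ℤ.* b ℤ.* (q′ ℤ.* c) ≡ q ℤ.* q′ ℤ.* (b ℤ.* c)
    lemma′ = ℤ-solve-∀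

-- For A = g + B one has (x^A - 1) - x^g (x^B - 1) = x^g - 1. This moves a Bézout identity between
-- exponents to the numbers x^e - 1 and x^e′ - 1.
pow-1-combination : ∀ x {e e′} g A B → e ∣ A → e′ ∣ B → g ℕ.+ B ≡ A →
  Combination (pow-1 x g) (pow-1 x e) (pow-1 x e′)
pow-1-combination x g A B e∣A e′∣B eq =
  combination (pow-1-∣ x e∣A) (ℤ∣.∣n⇒∣m*n (ℤ.- 𝒵.pow (+ x) g) (pow-1-∣ x e′∣B))
    (lemma (𝒵.pow (+ x) A) (𝒵.pow (+ x) g) (𝒵.pow (+ x) B)
      (≡.trans (≡.cong (𝒵.pow (+ x)) (≡.sym eq)) (𝒵.pow-+ (+ x) g B)))
  where
  lemma : ∀ A g B → A ≡ g ℤ.* B → (A ℤ.- 1ℤ) ℤ.+ ℤ.- g ℤ.* (B ℤ.- 1ℤ) ≡ g ℤ.- 1ℤ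
  lemma _ g B ≡.refl = identity g B
    where
    identity : ∀ g B → (g ℤ.* B ℤ.- 1ℤ) ℤ.+ ℤ.- g ℤ.* (B ℤ.- 1ℤ) ≡ g ℤ.- 1ℤ
    identity = ℤ-solve-∀

pow-1-gcd : ∀ x e e′ → Combination (pow-1 x (gcd e e′)) (pow-1 x e) (pow-1 x e′)
pow-1-gcd x e e′ with Bézout.identity (gcd-GCD e e′)
... | Bézout.+- a b eq = pow-1-combination x _ (a ℕ.* e) (b ℕ.* e′) (divides a ≡.refl) (divides b ≡.refl) eq
... | Bézout.-+ a b eq = Combination-swap
  (pow-1-combination x _ (b ℕ.* e′) (a ℕ.* e) (divides b ≡.refl) (divides a ≡.refl) eq)

pow-1-nonZero : ∀ x g → 2 ℕ.≤ x → 1 ℕ.≤ g → pow-1 x g ≢ 0ℤ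
pow-1-nonZero x g 2≤x 1≤g eq with ℕₚ.m^n≡1⇒n≡0∨m≡1 x g (ℤₚ.+-injective
    (≡.trans (≡.sym (pow-+ⁿ x g)) (ℤₚ.i-j≡0⇒i≡j (𝒵.pow (+ x) g) 1ℤ eq)))
... | inj₁ ≡.refl = contradiction 1≤g λ ()
... | inj₂ ≡.refl = contradiction 2≤x λ { (s≤s ()) }

module _ {Φ n} (cyc : ℤ-Cyclotomic Φ n) where

  value : ℕ → ℕ → ℤ
  value x e = eval (1ℤ ∷ Φ e) x

  private
    F : ℕ → ℕ → ℕ → ℤ
    F x k = ℤ-factor Φ k (+ x) 1ℤ

  pow-1≡∏ : ∀ x k → 1 ℕ.≤ k → k ℕ.≤ n → pow-1 x k ≡ 𝒵.∏₁ n (F x k)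
  pow-1≡∏ x k 1≤k k≤n =
    ≡.trans (≡.cong (λ z → 𝒵.pow (+ x) k ℤ.- z) (≡.sym (𝒵.pow-1# k))) (cyc k 1≤k k≤n (+ x) 1ℤ)

  -- The factors of x^g - 1 are among those of x^e - 1, and Φₑ is not one of them because e does not
  -- divide its proper divisor g; w collects the other factors.
  pow-1-split : ∀ x {g e} → 1 ℕ.≤ g → 1 ℕ.≤ e → e ℕ.≤ n → g ∣ e → g ≢ e →
    ∃[ w ] pow-1 x e ≡ pow-1 x g ℤ.* (value x e ℤ.* w)
  pow-1-split x {g} {e} 1≤g 1≤e e≤n g∣e g≢e = 𝒵.∏₁ n cofactor , (begin
    pow-1 x e
      ≡⟨ pow-1≡∏ x e 1≤e e≤n ⟩
    𝒵.∏₁ n (F x e)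
      ≡⟨ 𝒵.∏₁-cong n (λ i _ _ → proj₂ (split i (i ∣? e) (i ∣? g) (i ℕ.≟ e))) ⟩
    𝒵.∏₁ n (λ i → F x g i ℤ.* (𝒵.when (i ℕ.≟ e) (value x i) ℤ.* cofactor i))
      ≡⟨ 𝒵.∏₁-* n (F x g) (λ i → 𝒵.when (i ℕ.≟ e) (value x i) ℤ.* cofactor i) ⟩
    𝒵.∏₁ n (F x g) ℤ.* 𝒵.∏₁ n (λ i → 𝒵.when (i ℕ.≟ e) (value x i) ℤ.* cofactor i)
      ≡⟨ ≡.cong (λ z → 𝒵.∏₁ n (F x g) ℤ.* z) (𝒵.∏₁-* n (λ i → 𝒵.when (i ℕ.≟ e) (value x i)) cofactor) ⟩
    𝒵.∏₁ n (F x g) ℤ.* (𝒵.∏₁ n (λ i → 𝒵.when (i ℕ.≟ e) (value x i)) ℤ.* 𝒵.∏₁ n cofactor)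
      ≡⟨ ≡.cong₂ (λ a b → a ℤ.* (b ℤ.* 𝒵.∏₁ n cofactor))
           (≡.sym (pow-1≡∏ x g 1≤g (ℕₚ.≤-trans (∣⇒≤ {{ℕ.>-nonZero 1≤e}} g∣e) e≤n)))
           (𝒵.∏₁-single n e (value x) 1≤e e≤n) ⟩
    pow-1 x g ℤ.* (value x e ℤ.* 𝒵.∏₁ n cofactor) ∎)
    where
    open ≡.≡-Reasoning
    split : ∀ i (i∣?e : Dec (i ∣ e)) (i∣?g : Dec (i ∣ g)) (i≟e : Dec (i ≡ e)) →
      ∃[ w ] 𝒵.when i∣?e (value x i) ≡ 𝒵.when i∣?g (value x i) ℤ.* (𝒵.when i≟e (value x i) ℤ.* w)
    split i i∣?e      (yes i∣g) (yes ≡.refl) =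
      contradiction (∣-antisym g∣e i∣g) g≢e
    split i (yes _)   (yes _)   (no _)       = 1ℤ , ≡.sym (ℤₚ.*-identityʳ (value x i))
    split i (yes _)   (no _)    (yes _)      =
      1ℤ , ≡.sym (≡.trans (ℤₚ.*-identityˡ (value x i ℤ.* 1ℤ)) (ℤₚ.*-identityʳ (value x i)))
    split i (yes _)   (no _)    (no _)       =
      value x i , ≡.sym (≡.trans (ℤₚ.*-identityˡ (1ℤ ℤ.* value x i)) (ℤₚ.*-identityˡ (value x i)))
    split i (no i∤e)  (yes i∣g) _            = contradiction (∣-trans i∣g g∣e) i∤e
    split i (no i∤e)  (no _)    (yes ≡.refl) = contradiction ∣-refl i∤e
    split i (no _)    (no _)    (no _)       = 1ℤ , ≡.refl
    cofactor : ℕ → ℤ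
    cofactor i = proj₁ (split i (i ∣? e) (i ∣? g) (i ℕ.≟ e))

  value-∣-pow-1 : ∀ x {e} → 1 ℕ.≤ e → e ℕ.≤ n → value x e ℤ∣.∣ pow-1 x e
  value-∣-pow-1 x {e} 1≤e e≤n = ℤ∣.divides (𝒵.∏₁ n rest) (begin
    pow-1 x e
      ≡⟨ pow-1≡∏ x e 1≤e e≤n ⟩
    𝒵.∏₁ n (F x e)
      ≡⟨ 𝒵.∏₁-cong n (λ i _ _ → proj₂ (split i (i ∣? e) (i ℕ.≟ e))) ⟩
    𝒵.∏₁ n (λ i → rest i ℤ.* 𝒵.when (i ℕ.≟ e) (value x i))
      ≡⟨ 𝒵.∏₁-* n rest (λ i → 𝒵.when (i ℕ.≟ e) (value x i)) ⟩
    𝒵.∏₁ n rest ℤ.* 𝒵.∏₁ n (λ i → 𝒵.when (i ℕ.≟ e) (value x i))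
      ≡⟨ ≡.cong (λ z → 𝒵.∏₁ n rest ℤ.* z) (𝒵.∏₁-single n e (value x) 1≤e e≤n) ⟩
    𝒵.∏₁ n rest ℤ.* value x e ∎)
    where
    open ≡.≡-Reasoning
    split : ∀ i (i∣?e : Dec (i ∣ e)) (i≟e : Dec (i ≡ e)) →
      ∃[ w ] 𝒵.when i∣?e (value x i) ≡ w ℤ.* 𝒵.when i≟e (value x i)
    split i i∣?e (no _)            = 𝒵.when i∣?e (value x i) , ≡.sym (ℤₚ.*-identityʳ _)
    split i (yes _)  (yes _)       = 1ℤ , ≡.sym (ℤₚ.*-identityˡ _)
    split i (no i∤e) (yes ≡.refl)  = contradiction ∣-refl i∤e
    rest : ℕ → ℤ
    rest i = proj₁ (split i (i ∣? e) (i ℕ.≟ e))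

  -- The constant N must not depend on x. It takes the place of coprimality over ℚ; genuine
  -- coprimality of the values fails, as for x - 1 and x + 1 at odd x.
  NearlyCoprime : (ℕ → ℤ) → (ℕ → ℤ) → Set
  NearlyCoprime a b = ∃[ N ] ℕ.NonZero N × ∀ x → 2 ℕ.≤ x → Combination (+ N) (a x) (b x)

  -- Modulo Φₑ and Φₑ′ also x^g - 1 vanishes, for g = gcd e e′, and Φₑ divides
  -- (x^e - 1) / (x^g - 1), which is congruent to e / g modulo x^g - 1.
  values-nearlyCoprime-gcd : ∀ {e e′} → 1 ℕ.≤ e → e ℕ.≤ n → 1 ℕ.≤ e′ → e′ ℕ.≤ n → gcd e e′ ≢ e →
    NearlyCoprime (λ x → value x e) (λ x → value x e′)
  values-nearlyCoprime-gcd {e} {e′} 1≤e e≤n 1≤e′ e′≤n g≢e with gcd[m,n]∣m e e′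
  ... | divides t e≡tg = t , t≢0 , comb
    where
    g = gcd e e′
    tg≢0 : ℕ.NonZero (t ℕ.* g)
    tg≢0 = ≡.subst ℕ.NonZero e≡tg (ℕ.>-nonZero 1≤e)
    t≢0 : ℕ.NonZero t
    t≢0 = ℕₚ.m*n≢0⇒m≢0 t {{tg≢0}}
    1≤g : 1 ℕ.≤ g
    1≤g = ℕ.>-nonZero⁻¹ g {{ℕₚ.m*n≢0⇒n≢0 t {{tg≢0}}}}
    comb : ∀ x → 2 ℕ.≤ x → Combination (+ t) (value x e) (value x e′)
    comb x 2≤x with pow-1-split x 1≤g 1≤e e≤n (divides t e≡tg) g≢e
                  | geometric (𝒵.pow (+ x) g) t | pow-1-gcd x e e′
    ... | w , split | G , S , geo , G≡ | combination {l} {r} uₑ∣l uₑ′∣r l+r≡ =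
      -- Writing u = x^g - 1 = l + r, the cofactor gives Φₑ(x) w = t + u S, hence t = (Φₑ(x) w - S
      -- l) - S r. The values of Φₑ and Φₑ′ divide l and r through x^e - 1 and x^e′ - 1.
      combination {left = value x e ℤ.* w ℤ.+ ℤ.- S ℤ.* l} {right = ℤ.- S ℤ.* r}
        (ℤ∣.∣m∣n⇒∣m+n (ℤ∣.∣m⇒∣m*n w ℤ∣.∣-refl)
                       (ℤ∣.∣n⇒∣m*n (ℤ.- S) (ℤ∣.∣-trans (value-∣-pow-1 x 1≤e e≤n) uₑ∣l)))
        (ℤ∣.∣n⇒∣m*n (ℤ.- S) (ℤ∣.∣-trans (value-∣-pow-1 x 1≤e′ e′≤n) uₑ′∣r))
        (identity (value x e ℤ.* w) l r S (pow-1 x g) (+ t) (≡.trans (≡.sym G≡vw) G≡) l+r≡)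
      where
      instance _ = ℤ.≢-nonZero (pow-1-nonZero x g 2≤x 1≤g)
      G≡vw : G ≡ value x e ℤ.* w
      G≡vw = ℤₚ.*-cancelˡ-≡ (pow-1 x g) G (value x e ℤ.* w)
        (≡.trans (≡.sym geo) (≡.trans (≡.cong (ℤ._- 1ℤ)
          (≡.trans (≡.sym (𝒵.pow-* (+ x) t g)) (≡.cong (𝒵.pow (+ x)) (≡.sym e≡tg)))) split))
      identity : ∀ vw l r S u t → vw ≡ t ℤ.+ u ℤ.* S → l ℤ.+ r ≡ u → vw ℤ.+ ℤ.- S ℤ.* l ℤ.+ ℤ.- S ℤ.* r ≡ t
      identity _ l r S _ t ≡.refl ≡.refl = solved l r S t
        where
        solved : ∀ l r S t → t ℤ.+ (l ℤ.+ r) ℤ.* S ℤ.+ ℤ.- S ℤ.* l ℤ.+ ℤ.- S ℤ.* r ≡ t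
        solved = ℤ-solve-∀

  -- If gcd e e′ were equal to both e and e′, the two would coincide; so the asymmetric case applies
  -- in at least one of the two orders.
  values-nearlyCoprime : ∀ {e e′} → 1 ℕ.≤ e → e ℕ.≤ n → 1 ℕ.≤ e′ → e′ ℕ.≤ n → e ≢ e′ →
    NearlyCoprime (λ x → value x e) (λ x → value x e′)
  values-nearlyCoprime {e} {e′} 1≤e e≤n 1≤e′ e′≤n e≢e′ with gcd e e′ ℕ.≟ e | gcd e′ e ℕ.≟ e′
  ... | no g≢e | _       = values-nearlyCoprime-gcd 1≤e e≤n 1≤e′ e′≤n g≢e
  ... | yes _  | no g≢e′ = map₂ (map₂ λ comb x 2≤x → Combination-swap (comb x 2≤x))
                             (values-nearlyCoprime-gcd 1≤e′ e′≤n 1≤e e≤n g≢e′)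
  ... | yes g≡e | yes g≡e′ = contradiction
    (∣-antisym (≡.subst (_∣ e′) g≡e (gcd[m,n]∣n e e′)) (≡.subst (_∣ e) g≡e′ (gcd[m,n]∣n e′ e))) e≢e′

  value-product-nearlyCoprime : ∀ k {e} j → j ℕ.< e → e ℕ.≤ n →
    NearlyCoprime (λ x → value x e) (λ x → 𝒵.∏₁ j (F x k))
  value-product-nearlyCoprime k zero    _   _   = 1 , _ , λ x _ →
    combination (ℤ∣.divides 0ℤ ≡.refl) (ℤ∣.∣-refl {1ℤ}) ≡.refl
  value-product-nearlyCoprime k {e} (suc j) j<e e≤n
    with value-product-nearlyCoprime k j (ℕₚ.<-trans (ℕₚ.n<1+n j) j<e) e≤n | last (suc j ∣? k)
    where
    last : (j∣?k : Dec (suc j ∣ k)) → NearlyCoprime (λ x → value x e) (λ x → 𝒵.when j∣?k (value x (suc j)))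
    last (yes _) = values-nearlyCoprime (ℕₚ.≤-trans (s≤s z≤n) j<e) e≤n (s≤s z≤n)
                     (ℕₚ.≤-trans (ℕₚ.<⇒≤ j<e) e≤n) (ℕₚ.>⇒≢ j<e)
    last (no _)  = 1 , _ , λ x _ → combination (ℤ∣.divides 0ℤ ≡.refl) (ℤ∣.∣-refl {1ℤ}) ≡.refl
  ... | N , N≢0 , comb | N′ , N′≢0 , comb′ = N ℕ.* N′ , ℕₚ.m*n≢0 N N′ {{N≢0}} {{N′≢0}} , λ x 2≤x →
    ≡.subst (λ z → Combination z _ _) (≡.sym (ℤₚ.pos-* N N′)) (Combination-* (comb x 2≤x) (comb′ x 2≤x))

  module _ {c ℓ} (K : CommutativeRing c ℓ) where
    open Cyclotomics K using () renaming (Partial to K-Partial)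

    -- One coefficient list is built for ℤ and K together: exactness of each division is proved with
    -- integer values, and as a statement about coefficients it holds in K too.
    partial-exists : ∀ j → j ℕ.≤ n → ∃[ q ] ℤ-Partial Φ (suc n) j q × K-Partial Φ (suc n) j q
    partial-exists zero    _   = Cyclotomics.binomial K n ,
      Cyclotomics.partial-zero ℤₚ.+-*-commutativeRing Φ n , Cyclotomics.partial-zero K Φ n
    partial-exists (suc j) j<n with partial-exists j (ℕₚ.<⇒≤ j<n) | suc j ∣? suc n
    ... | q , pℤ , pK | no j∤n = q , Cyclotomics.partial-skip ℤₚ.+-*-commutativeRing {Φ} {q = q} j∤n pℤ ,
                                     Cyclotomics.partial-skip K {Φ} {q = q} j∤n pK
    ... | q , pℤ , pK | yes j∣n with value-product-nearlyCoprime (suc n) j (ℕₚ.n<1+n j) j<n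
    ...   | N , N≢0 , comb = map₂ (λ exact →
              Cyclotomics.partial-divide ℤₚ.+-*-commutativeRing {Φ} j∣n exact pℤ ,
              Cyclotomics.partial-divide K {Φ} j∣n exact pK)
            -- From x = 2 on, the numbers x^g - 1 with g ≥ 1 are nonzero, so the coprimality of
            -- values is available.
            (exactQuotient q (Φ (suc j)) N {{N≢0}} 2 multiple)
      where
      -- Let p be the product of the earlier factors and N = l + r with r = r′ p. Then N q = l q +
      -- r′ (xⁿ⁺¹ - 1), and the value of the divisor divides both terms.
      multiple : ∀ x → 2 ℕ.≤ x → ∃[ h ] + N ℤ.* eval (1ℤ ∷ q) x ≡ value x (suc j) ℤ.* h
      multiple x 2≤x with comb x 2≤x
      ... | combination {l} {r} v∣l (ℤ∣.divides r′ r≡) l+r≡N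
        with ℤ∣.∣m∣n⇒∣m+n (ℤ∣.∣m⇒∣m*n (eval (1ℤ ∷ q) x) v∣l)
               (ℤ∣.∣n⇒∣m*n r′ (ℤ∣.∣-trans (value-∣-pow-1 x (s≤s z≤n) j<n) (pow-1-∣ x j∣n)))
      ... | ℤ∣.divides h eq = h , ≡.trans (identity (+ N) (eval (1ℤ ∷ q) x) l r r′ (𝒵.∏₁ j (F x (suc n))) (pow-1 x (suc n))
                                            l+r≡N r≡ pow-1≡) (≡.trans eq (ℤₚ.*-comm h (value x (suc j))))
        where
        pow-1≡ : pow-1 x (suc n) ≡ 𝒵.∏₁ j (F x (suc n)) ℤ.* eval (1ℤ ∷ q) x
        pow-1≡ = ≡.trans (≡.cong (λ z → 𝒵.pow (+ x) (suc n) ℤ.- z) (≡.sym (𝒵.pow-1# (suc n)))) (pℤ (+ x) 1ℤ)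
        identity : ∀ N q l r r′ p u → l ℤ.+ r ≡ N → r ≡ r′ ℤ.* p → u ≡ p ℤ.* q → N ℤ.* q ≡ l ℤ.* q ℤ.+ r′ ℤ.* u
        identity _ q l _ r′ p _ ≡.refl ≡.refl ≡.refl = solved q l r′ p
          where
          solved : ∀ q l r′ p → (l ℤ.+ r′ ℤ.* p) ℤ.* q ≡ l ℤ.* q ℤ.+ r′ ℤ.* (p ℤ.* q)
          solved = ℤ-solve-∀

cyclotomic-exists : ∀ {c ℓ} (K : CommutativeRing c ℓ) n → ∃[ Φ ] ℤ-Cyclotomic Φ n × Cyclotomics.Cyclotomic K Φ n
cyclotomic-exists K zero    = (λ _ → []) , (λ { zero () _ ; (suc _) _ () }) , (λ { zero () _ ; (suc _) _ () })
cyclotomic-exists K (suc n) with cyclotomic-exists K n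
... | Φ , cycℤ , cycK with partial-exists {Φ} cycℤ K n ℕₚ.≤-refl
...   | q , pℤ , pK = extend Φ (suc n) q ,
  Cyclotomics.cyclotomic-extend ℤₚ.+-*-commutativeRing {Φ} {q = q} cycℤ pℤ ,
  Cyclotomics.cyclotomic-extend K {Φ} {q = q} cycK pK

-- Products over unordered pairs of list entries.

module PairProducts {c ℓ} (K : CommutativeRing c ℓ) where
  open Ring K

  row : ∀ {a} {A : Set a} → (A → A → Carrier) → A → List A → Carrier
  row φ x ys = foldr (λ y r → φ x y * r) 1# ys

  -- The entries are of any type, so that products over roots can be indexed by `Fin d`: membership
  -- and repetition are decidable for indices, but not for elements of K.
  pairs : ∀ {a} {A : Set a} → (A → A → Carrier) → List A → Carrier
  pairs φ []       = 1#
  pairs φ (x ∷ xs) = row φ x xs * pairs φ xs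

  squaredDifference : Carrier → Carrier → Carrier
  squaredDifference x y = (x - y) * (x - y)

  discK≡pairs : ∀ bs → discK K bs ≡ pairs squaredDifference bs
  discK≡pairs []       = ≡.refl
  discK≡pairs (b ∷ bs) = ≡.cong (row squaredDifference b bs *_) (discK≡pairs bs)

  row-map : ∀ {a b} {A : Set a} {B : Set b} φ (f : A → B) x ys →
    row φ (f x) (List.map f ys) ≡ row (λ x y → φ (f x) (f y)) x ys
  row-map φ f x []       = ≡.refl
  row-map φ f x (y ∷ ys) = ≡.cong (φ (f x) (f y) *_) (row-map φ f x ys)

  pairs-map : ∀ {a b} {A : Set a} {B : Set b} φ (f : A → B) xs →
    pairs φ (List.map f xs) ≡ pairs (λ x y → φ (f x) (f y)) xs
  pairs-map φ f []       = ≡.refl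
  pairs-map φ f (x ∷ xs) = ≡.cong₂ _*_ (row-map φ f x xs) (pairs-map φ f xs)

  row-cong : ∀ {a} {A : Set a} {φ ψ : A → A → Carrier} → (∀ x y → φ x y ≈ ψ x y) → ∀ x ys → row φ x ys ≈ row ψ x ys
  row-cong eq x []       = refl
  row-cong eq x (y ∷ ys) = *-cong (eq x y) (row-cong eq x ys)

  pairs-cong : ∀ {a} {A : Set a} {φ ψ : A → A → Carrier} → (∀ x y → φ x y ≈ ψ x y) → ∀ xs → pairs φ xs ≈ pairs ψ xs
  pairs-cong eq []       = refl
  pairs-cong eq (x ∷ xs) = *-cong (row-cong eq x xs) (pairs-cong eq xs)

  private
    *-interchange : ∀ a b x y → (a * b) * (x * y) ≈ (a * x) * (b * y)
    *-interchange = solve 4 (λ a b x y → (a :* b) :* (x :* y) := (a :* x) :* (b :* y)) refl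

  row-* : ∀ {a} {A : Set a} (φ ψ : A → A → Carrier) x ys → row (λ x y → φ x y * ψ x y) x ys ≈ row φ x ys * row ψ x ys
  row-* φ ψ x []       = sym (*-identityˡ _)
  row-* φ ψ x (y ∷ ys) = trans (*-congˡ (row-* φ ψ x ys)) (*-interchange _ _ _ _)

  pairs-* : ∀ {a} {A : Set a} (φ ψ : A → A → Carrier) xs → pairs (λ x y → φ x y * ψ x y) xs ≈ pairs φ xs * pairs ψ xs
  pairs-* φ ψ []       = sym (*-identityˡ _)
  pairs-* φ ψ (x ∷ xs) = trans (*-cong (row-* φ ψ x xs) (pairs-* φ ψ xs)) (*-interchange _ _ _ _)

  pairs-one : ∀ {a} {A : Set a} (xs : List A) → pairs (λ _ _ → 1#) xs ≈ 1#
  pairs-one []       = refl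
  pairs-one (x ∷ xs) = trans (*-cong (row-one xs) (pairs-one xs)) (*-identityˡ _)
    where
    row-one : ∀ ys → row (λ _ _ → 1#) x ys ≈ 1#
    row-one []       = refl
    row-one (y ∷ ys) = trans (*-identityˡ _) (row-one ys)

  pairs-when : ∀ {a} {A : Set a} {p} {P : Set p} (P? : Dec P) (φ : A → A → Carrier) xs →
    pairs (λ x y → when P? (φ x y)) xs ≈ when P? (pairs φ xs)
  pairs-when (yes _) φ xs = refl
  pairs-when (no _)  φ xs = pairs-one xs

  pairs-∏₁ : ∀ {a} {A : Set a} n (φ : ℕ → A → A → Carrier) xs →
    pairs (λ x y → ∏₁ n (λ e → φ e x y)) xs ≈ ∏₁ n (λ e → pairs (φ e) xs)
  pairs-∏₁ zero    φ xs = pairs-one xs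
  pairs-∏₁ (suc n) φ xs = trans (pairs-* _ (φ (suc n)) xs) (*-congʳ (pairs-∏₁ n φ xs))

  module _ {a} {A : Set a} {φ : A → A → Carrier} where

    row-∈ : ∀ x {y ys} → y ∈ ys → ∃[ w ] row φ x ys ≈ φ x y * w
    row-∈ x {ys = y ∷ ys} (here ≡.refl) = row φ x ys , refl
    row-∈ x {ys = y ∷ ys} (there y∈ys) with row-∈ x y∈ys
    ... | w , eq = φ x y * w , trans (*-congˡ eq) (lemma _ _ _)
      where
      lemma : ∀ a b w → a * (b * w) ≈ b * (a * w)
      lemma = solve 3 (λ a b w → a :* (b :* w) := b :* (a :* w)) refl

    row-↭ : ∀ x {ys zs} → ys ↭ zs → row φ x ys ≈ row φ x zs
    row-↭ x Perm.refl               = refl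
    row-↭ x (prep y ys↭zs)     = *-congˡ (row-↭ x ys↭zs)
    row-↭ x (swap y z ys↭zs)   = trans (*-congˡ (*-congˡ (row-↭ x ys↭zs))) (lemma _ _ _)
      where
      lemma : ∀ a b w → a * (b * w) ≈ b * (a * w)
      lemma = solve 3 (λ a b w → a :* (b :* w) := b :* (a :* w)) refl
    row-↭ x (Perm.trans ys↭zs zs↭ws) = trans (row-↭ x ys↭zs) (row-↭ x zs↭ws)

    module _ (φ-sym : ∀ x y → φ x y ≈ φ y x) where

      pairs-↭ : ∀ {xs ys} → xs ↭ ys → pairs φ xs ≈ pairs φ ys
      pairs-↭ Perm.refl           = refl
      pairs-↭ (prep x xs↭ys) = *-cong (row-↭ x xs↭ys) (pairs-↭ xs↭ys)
      pairs-↭ (swap {xs} {ys} x y xs↭ys) = begin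
        φ x y * row φ x xs * (row φ y xs * pairs φ xs)
          ≈⟨ *-cong (*-cong (φ-sym x y) (row-↭ x xs↭ys)) (*-cong (row-↭ y xs↭ys) (pairs-↭ xs↭ys)) ⟩
        φ y x * row φ x ys * (row φ y ys * pairs φ ys)
          ≈⟨ solve 4 (λ a b c d → a :* b :* (c :* d) := a :* c :* (b :* d)) refl _ _ _ _ ⟩
        φ y x * row φ y ys * (row φ x ys * pairs φ ys) ∎
      pairs-↭ (Perm.trans xs↭ys ys↭zs) = trans (pairs-↭ xs↭ys) (pairs-↭ ys↭zs)

      pairs-∈ : ∀ {x y xs} → x ∈ xs → y ∈ xs → x ≢ y → ∃[ w ] pairs φ xs ≈ φ x y * w
      pairs-∈ (here ≡.refl) (here ≡.refl) x≢y = contradiction ≡.refl x≢y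
      pairs-∈ {x} (here ≡.refl) (there y∈xs) x≢y with row-∈ x y∈xs
      ... | w , eq = w * _ , trans (*-congʳ eq) (*-assoc _ _ _)
      pairs-∈ {x} {y} (there x∈xs) (here ≡.refl) x≢y with row-∈ y x∈xs
      ... | w , eq = w * _ , trans (*-congʳ (trans eq (*-congʳ (φ-sym y x)))) (*-assoc _ _ _)
      pairs-∈ {x} {y} {z ∷ xs} (there x∈xs) (there y∈xs) x≢y with pairs-∈ x∈xs y∈xs x≢y
      ... | w , eq = row φ z xs * w , trans (*-congˡ eq)
        (solve 3 (λ a b w → a :* (b :* w) := b :* (a :* w)) refl (row φ z xs) (φ x y) w)

-- Integrality of elementary symmetric polynomials and power sums.

module IntegerElements {c ℓ} (K : CommutativeRing c ℓ) where
  open Ring K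

  IsInteger : Carrier → Set ℓ
  IsInteger a = ∃[ z ] ι z ≈ a

  int-resp : ∀ {a b} → a ≈ b → IsInteger a → IsInteger b
  int-resp a≈b (z , eq) = z , trans eq a≈b

  int-+ : ∀ {a b} → IsInteger a → IsInteger b → IsInteger (a + b)
  int-+ (y , eq) (z , eq′) = y ℤ.+ z , trans (ι-+ y z) (+-cong eq eq′)

  int-* : ∀ {a b} → IsInteger a → IsInteger b → IsInteger (a * b)
  int-* (y , eq) (z , eq′) = y ℤ.* z , trans (ι-* y z) (*-cong eq eq′)

  int-neg : ∀ {a} → IsInteger a → IsInteger (- a)
  int-neg (z , eq) = ℤ.- z , trans (ι-neg z) (-‿cong eq)

  int-0 : IsInteger 0#
  int-0 = 0ℤ , refl

  int-1 : IsInteger 1#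
  int-1 = 1ℤ , ι-1

  int-ι : ∀ z → IsInteger (ι z)
  int-ι z = z , refl

  -- The coefficient of tᵏ in ∏ (1 - a t), so the k-th elementary symmetric polynomial up to the sign (-1)ᵏ.
  elementary : ∀ {d} → Vec Carrier d → ℕ → Carrier
  elementary []      zero    = 1#
  elementary []      (suc k) = 0#
  elementary (a ∷ α) zero    = elementary α zero
  elementary (a ∷ α) (suc k) = elementary α (suc k) - a * elementary α k

  ∑ᶠ : ∀ d → (Fin d → Carrier) → Carrier
  ∑ᶠ zero    f = 0#
  ∑ᶠ (suc d) f = f zero + ∑ᶠ d (f ∘ suc)

  powerSum : ∀ {d} → Vec Carrier d → ℕ → Carrier
  powerSum {d} α k = ∑ᶠ d (λ i → pow (lookup α i) k)

  convolve : (ℕ → Carrier) → (ℕ → Carrier) → ℕ → Carrier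
  convolve f g zero    = f 0 * g 0
  convolve f g (suc k) = f 0 * g (suc k) + convolve (f ∘ suc) g k

  convolve-+ʳ : ∀ f g h k → convolve f (λ i → g i + h i) k ≈ convolve f g k + convolve f h k
  convolve-+ʳ f g h zero    = distribˡ _ _ _
  convolve-+ʳ f g h (suc k) = trans (+-cong (distribˡ _ _ _) (convolve-+ʳ (f ∘ suc) g h k))
    (solve 4 (λ a b c d → a :+ b :+ (c :+ d) := a :+ c :+ (b :+ d)) refl _ _ _ _)

  convolve-linearˡ : ∀ f f′ a g k → convolve (λ i → f i - a * f′ i) g k ≈ convolve f g k - a * convolve f′ g k
  convolve-linearˡ f f′ a g zero    =
    solve 4 (λ f f′ a g → (f :- a :* f′) :* g := f :* g :- a :* (f′ :* g)) refl _ _ _ _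
  convolve-linearˡ f f′ a g (suc k) = trans (+-congˡ (convolve-linearˡ (f ∘ suc) (f′ ∘ suc) a g k))
    (solve 6 (λ f f′ a g C C′ → (f :- a :* f′) :* g :+ (C :- a :* C′) := f :* g :+ C :- a :* (f′ :* g :+ C′))
      refl _ _ _ _ _ _)

  convolve-geometric : ∀ f a k → convolve f (pow a) (suc k) ≈ f (suc k) + a * convolve f (pow a) k
  convolve-geometric f a zero    = trans (+-cong (*-congˡ (*-identityʳ a)) (*-identityʳ _))
    (trans (solve 3 (λ f a f′ → f :* a :+ f′ := f′ :+ a :* f) refl _ _ _) (+-congˡ (*-congˡ (sym (*-identityʳ _)))))
  convolve-geometric f a (suc k) = trans (+-congˡ (convolve-geometric (f ∘ suc) a k))
    (solve 5 (λ f a p f′ C → f :* (a :* p) :+ (f′ :+ a :* C) := f′ :+ a :* (f :* p :+ C)) refl _ _ _ _ _)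

  -- Newton's identities: with E(t) = ∏ (1 - a t) of degree d, E(t) ∑ pₖ tᵏ = d E(t) - t E′(t).
  newton : ∀ {d} (α : Vec Carrier d) k →
    convolve (elementary α) (powerSum α) k ≈ (ι (+ d) - ι (+ k)) * elementary α k
  newton []      k = trans (convolve-zero (elementary []) k) (sym (vanish k))
    where
    convolve-zero : ∀ f k → convolve f (λ _ → 0#) k ≈ 0#
    convolve-zero f zero    = zeroʳ _
    convolve-zero f (suc k) = trans (+-cong (zeroʳ _) (convolve-zero (f ∘ suc) k)) (+-identityˡ _)
    vanish : ∀ k → (0# - ι (+ k)) * elementary [] k ≈ 0#
    vanish zero    = solve 1 (λ a → (con 0ℤ :- con 0ℤ) :* a := con 0ℤ) refl 1#
    vanish (suc k) = zeroʳ _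
  newton {suc d} (a ∷ α) k = begin
    convolve (elementary (a ∷ α)) (λ i → pow a i + powerSum α i) k
      ≈⟨ convolve-+ʳ _ (pow a) (powerSum α) k ⟩
    convolve (elementary (a ∷ α)) (pow a) k + convolve (elementary (a ∷ α)) (powerSum α) k
      ≈⟨ +-cong (geometric-part k) (rest k) ⟩
    elementary α k + weighted k
      ≈⟨ combine k ⟩
    (ι (+ suc d) - ι (+ k)) * elementary (a ∷ α) k ∎
    where
    E = elementary α
    -- The coefficients of (1 - a t) (d E(t) - t E′(t)).
    weighted : ℕ → Carrier
    weighted zero    = (ι (+ d) - ι (+ 0)) * E 0
    weighted (suc k) = (ι (+ d) - ι (+ suc k)) * E (suc k) - a * ((ι (+ d) - ι (+ k)) * E k)
    multiply : ∀ g k → convolve (elementary (a ∷ α)) g (suc k) ≈ convolve E g (suc k) - a * convolve E g k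
    multiply g k = trans (+-congˡ (convolve-linearˡ (E ∘ suc) E a g k))
      (solve 4 (λ x C a C′ → x :+ (C :- a :* C′) := x :+ C :- a :* C′) refl _ _ _ _)
    -- The series ∑ aᵏ tᵏ is inverse to the new factor 1 - a t, which leaves E(t).
    geometric-part : ∀ k → convolve (elementary (a ∷ α)) (pow a) k ≈ E k
    geometric-part zero    = *-identityʳ _
    geometric-part (suc k) = trans (multiply (pow a) k) (trans (+-congʳ (convolve-geometric E a k))
      (solve 2 (λ e x → e :+ x :- x := e) refl _ _))
    rest : ∀ k → convolve (elementary (a ∷ α)) (powerSum α) k ≈ weighted k
    rest zero    = newton α 0
    rest (suc k) = trans (multiply (powerSum α) k) (+-cong (newton α (suc k)) (-‿cong (*-congˡ (newton α k))))
    ι-suc : ∀ n → ι (+ suc n) ≈ ι 1ℤ + ι (+ n)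
    ι-suc n = ι-+ 1ℤ (+ n)
    combine : ∀ k → E k + weighted k ≈ (ι (+ suc d) - ι (+ k)) * elementary (a ∷ α) k
    combine zero    = trans (solve 2 (λ d e → e :+ (d :- con 0ℤ) :* e := (con 1ℤ :+ d :- con 0ℤ) :* e) refl _ _)
                            (*-congʳ (+-congʳ (sym (ι-suc d))))
    combine (suc k) = begin
      E (suc k) + ((ι (+ d) - ι (+ suc k)) * E (suc k) - a * ((ι (+ d) - ι (+ k)) * E k))
        ≈⟨ +-congˡ (+-congʳ (*-congʳ (+-congˡ (-‿cong (ι-suc k))))) ⟩
      E (suc k) + ((ι (+ d) - (ι 1ℤ + ι (+ k))) * E (suc k) - a * ((ι (+ d) - ι (+ k)) * E k))
        ≈⟨ solve 5 (λ e′ d k a e → e′ :+ ((d :- (con 1ℤ :+ k)) :* e′ :- a :* ((d :- k) :* e)) :=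
                       (con 1ℤ :+ d :- (con 1ℤ :+ k)) :* (e′ :- a :* e)) refl _ _ _ _ _ ⟩
      (ι 1ℤ + ι (+ d) - (ι 1ℤ + ι (+ k))) * (E (suc k) - a * E k)
        ≈⟨ *-congʳ (+-cong (sym (ι-suc d)) (-‿cong (sym (ι-suc k)))) ⟩
      (ι (+ suc d) - ι (+ suc k)) * (E (suc k) - a * E k) ∎

  elementary-0 : ∀ {d} (α : Vec Carrier d) → elementary α 0 ≡ 1#
  elementary-0 []      = ≡.refl
  elementary-0 (a ∷ α) = elementary-0 α

  convolve-int : ∀ {f g} k → (∀ i → IsInteger (f i)) → (∀ j → j ℕ.≤ k → IsInteger (g j)) → IsInteger (convolve f g k)
  convolve-int zero    f-int g-int = int-* (f-int 0) (g-int 0 z≤n)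
  convolve-int (suc k) f-int g-int = int-+ (int-* (f-int 0) (g-int (suc k) ℕₚ.≤-refl))
    (convolve-int k (f-int ∘ suc) (λ j j≤k → g-int j (ℕₚ.m≤n⇒m≤1+n j≤k)))

  -- Newton's identities are solved for pₖ without division: its coefficient is the constant term of
  -- E(t), which is 1.
  powerSum-int : ∀ {d} (α : Vec Carrier d) → (∀ k → IsInteger (elementary α k)) → ∀ k → IsInteger (powerSum α k)
  powerSum-int {d} α e-int k = bounded k k ℕₚ.≤-refl
    where
    newton-int : ∀ k → IsInteger (convolve (elementary α) (powerSum α) k)
    newton-int k = int-resp (sym (newton α k)) (int-* (int-+ (int-ι (+ d)) (int-neg (int-ι (+ k)))) (e-int k))
    e₀*_ : ∀ x → elementary α 0 * x ≈ x
    e₀* x = trans (*-congʳ (reflexive (elementary-0 α))) (*-identityˡ x)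
    bounded : ∀ k j → j ℕ.≤ k → IsInteger (powerSum α j)
    bounded k       zero    _         = int-resp (e₀* _) (newton-int 0)
    bounded (suc k) (suc j) (s≤s j≤k) = int-resp
      (trans (solve 2 (λ x y → x :+ y :- y := x) refl _ _) (e₀* _))
      (int-+ (newton-int (suc j)) (int-neg (convolve-int {elementary α ∘ suc} {powerSum α} j (e-int ∘ suc)
        (λ i i≤j → bounded k i (ℕₚ.≤-trans i≤j j≤k)))))

  coefficient : List Carrier → ℕ → Carrier
  coefficient []       i       = 0#
  coefficient (x ∷ xs) zero    = x
  coefficient (x ∷ xs) (suc i) = coefficient xs i

  coefficient-int : ∀ {xs} → All IsInteger xs → ∀ i → IsInteger (coefficient xs i)
  coefficient-int []         i       = int-0
  coefficient-int (x ∷ xs)   zero    = x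
  coefficient-int (_ ∷ xs)   (suc i) = coefficient-int xs i

  coefficient-mulLin : ∀ a p i → coefficient (mulLin K a p) i ≈ coefficient (0# ∷ p) i - a * coefficient p i
  coefficient-mulLin a p = go 0# p
    where
    go : ∀ u p i → coefficient (zipWith (λ u v → u - v) (u ∷ p) (List.map (a *_) p ++ (0# ∷ []))) i ≈
                   coefficient (u ∷ p) i - a * coefficient p i
    go u []      zero    = solve 2 (λ u a → u :- con 0ℤ := u :- a :* con 0ℤ) refl u a
    go u []      (suc i) = solve 1 (λ a → con 0ℤ := con 0ℤ :- a :* con 0ℤ) refl a
    go u (v ∷ p) zero    = refl
    go u (v ∷ p) (suc i) = go v p i

  elementary-large : ∀ {d} (α : Vec Carrier d) k → d ℕ.< k → elementary α k ≈ 0#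
  elementary-large []      (suc k) _         = refl
  elementary-large (a ∷ α) (suc k) (s≤s d<k) =
    trans (+-cong (elementary-large α (suc k) (ℕₚ.m≤n⇒m≤1+n d<k)) (-‿cong (*-congˡ (elementary-large α k d<k))))
          (solve 1 (λ a → con 0ℤ :- a :* con 0ℤ := con 0ℤ) refl a)

  coefficient-large : ∀ {d} (α : Vec Carrier d) i → d ℕ.< i → coefficient (prodLin K (toList α)) i ≈ 0#
  coefficient-large []      (suc i) _         = refl
  coefficient-large (a ∷ α) (suc i) (s≤s d<i) = trans (coefficient-mulLin a (prodLin K (toList α)) (suc i))
    (trans (+-cong (coefficient-large α i d<i) (-‿cong (*-congˡ (coefficient-large α (suc i) (ℕₚ.m≤n⇒m≤1+n d<i)))))
           (solve 1 (λ a → con 0ℤ :- a :* con 0ℤ := con 0ℤ) refl a))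

  -- The polynomials ∏ (x - a) and ∏ (1 - a t) are reversals of each other, which is why the two
  -- indices add up to d.
  coefficient≈elementary : ∀ {d} (α : Vec Carrier d) i k → i ℕ.+ k ≡ d →
    coefficient (prodLin K (toList α)) i ≈ elementary α k
  coefficient≈elementary []      zero    zero    eq = refl
  coefficient≈elementary {suc d} (a ∷ α) i k eq =
    trans (coefficient-mulLin a p i) (lemma i k eq)
    where
    p = prodLin K (toList α)
    lemma : ∀ i k → i ℕ.+ k ≡ suc d → coefficient (0# ∷ p) i - a * coefficient p i ≈ elementary (a ∷ α) k
    lemma zero    (suc k) eq = +-cong (sym (elementary-large α (suc k) (ℕₚ.≤-reflexive (≡.sym eq))))
                                      (-‿cong (*-congˡ (coefficient≈elementary α 0 k (ℕₚ.suc-injective eq))))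
    lemma (suc i) zero    eq = trans (+-cong (coefficient≈elementary α i 0 (ℕₚ.suc-injective eq))
        (-‿cong (*-congˡ (coefficient-large α (suc i) (ℕₚ.≤-reflexive (≡.sym (≡.trans (≡.sym (ℕₚ.+-identityʳ (suc i))) eq)))))))
      (solve 2 (λ e a → e :- a :* con 0ℤ := e) refl _ _)
    lemma (suc i) (suc k) eq = +-cong (coefficient≈elementary α i (suc k) (ℕₚ.suc-injective eq))
      (-‿cong (*-congˡ (coefficient≈elementary α (suc i) k (≡.trans (≡.sym (ℕₚ.+-suc i k)) (ℕₚ.suc-injective eq)))))

  elementary-int : ∀ {d} (coef : Vec ℤ d) (α : Vec Carrier d) → Splits K coef α → ∀ k → IsInteger (elementary α k)
  elementary-int {d} coef α splits k with k ℕ.≤? d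
  ... | yes k≤d = int-resp (coefficient≈elementary α (d ℕ.∸ k) k (ℕₚ.m∸n+n≡m k≤d))
                           (coefficient-int (transport splits monic-int) (d ℕ.∸ k))
    where
    monic-int : All IsInteger (monicK K coef)
    monic-int = Allₚ.++⁺ (Allₚ.map⁺ (All.universal int-ι (toList coef))) (int-1 ∷ [])
    transport : ∀ {xs ys} → Pointwise _≈_ xs ys → All IsInteger ys → All IsInteger xs
    transport []           []       = []
    transport (x≈y ∷ rest) (y ∷ ys) = int-resp (sym x≈y) y ∷ transport rest ys
  ... | no k≰d = int-resp (sym (elementary-large α k (ℕₚ.≰⇒> k≰d))) int-0

-- Bounded denominators in ℕ, and lists of indices without repetition.

coprime-^ : ∀ {m n} k → Coprime m n → Coprime (m ℕ.^ k) n
coprime-^ zero    m⊥n = 1-coprimeTo _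
coprime-^ {m} (suc k) m⊥n {i} (i∣m*mᵏ , i∣n) =
  coprime-^ k m⊥n (coprime-divisor i⊥m i∣m*mᵏ , i∣n)
  where
  i⊥m : Coprime i m
  i⊥m (j∣i , j∣m) = m⊥n (j∣m , ℕ∣.∣-trans j∣i i∣n)

n<m^n : ∀ m n → 2 ℕ.≤ m → n ℕ.< m ℕ.^ n
n<m^n m zero    2≤m = s≤s z≤n
n<m^n m (suc n) 2≤m = ℕₚ.≤-trans (s≤s (n<m^n m n 2≤m)) (ℕₚ.^-monoʳ-< m 2≤m (ℕₚ.n<1+n n))

-- Removing g = gcd m z from m = m′ g and z = z′ g gives m′ᵏ ∣ m z′ᵏ, hence m′ᵏ ∣ m by coprimality.
-- For m′ ≥ 2 this fails already at k = m, where m < m′ᵏ; so m = g.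
powers-∣⇒∣ : ∀ m z .{{_ : ℕ.NonZero m}} → (∀ k → m ℕ.^ k ∣ m ℕ.* z ℕ.^ k) → m ∣ z
powers-∣⇒∣ m z powers with gcd[m,n]∣m m z | gcd[m,n]∣n m z
... | divides m′ m≡m′g | divides z′ z≡z′g = ≡.subst (_∣ z) (≡.sym m≡g) (gcd[m,n]∣n m z)
  where
  g = gcd m z
  instance
    g≢0 : ℕ.NonZero g
    g≢0 = ℕ.≢-nonZero (gcd[m,n]≢0 m z (inj₁ (ℕ.≢-nonZero⁻¹ m)))
  m′⊥z′ : Coprime m′ z′
  m′⊥z′ {i} (i∣m′ , i∣z′) = ℕ∣.∣1⇒≡1 (ℕ∣.*-cancelʳ-∣ g (≡.subst (i ℕ.* g ∣_) (≡.sym (ℕₚ.*-identityˡ g))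
      (gcd-greatest (≡.subst (i ℕ.* g ∣_) (≡.sym m≡m′g) (ℕ∣.*-monoˡ-∣ g i∣m′))
                    (≡.subst (i ℕ.* g ∣_) (≡.sym z≡z′g) (ℕ∣.*-monoˡ-∣ g i∣z′)))))
  ^-distrib : ∀ a b k → (a ℕ.* b) ℕ.^ k ≡ a ℕ.^ k ℕ.* b ℕ.^ k
  ^-distrib a b zero    = ≡.refl
  ^-distrib a b (suc k) = ≡.trans (≡.cong (a ℕ.* b ℕ.*_) (^-distrib a b k)) (interchange a b (a ℕ.^ k) (b ℕ.^ k))
    where
    interchange : ∀ a b x y → a ℕ.* b ℕ.* (x ℕ.* y) ≡ a ℕ.* x ℕ.* (b ℕ.* y)
    interchange = ℕ-solve-∀
  m′ᵏ∣m : ∀ k → m′ ℕ.^ k ∣ m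
  m′ᵏ∣m k = coprime-divisor m′ᵏ⊥z′ᵏ (ℕ∣.*-cancelʳ-∣ (g ℕ.^ k) {{ℕₚ.m^n≢0 g k}} (≡.subst₂ _∣_
      (≡.trans (≡.cong (ℕ._^ k) m≡m′g) (^-distrib m′ g k))
      (≡.trans (≡.cong (λ z → m ℕ.* z ℕ.^ k) z≡z′g)
        (≡.trans (≡.cong (m ℕ.*_) (^-distrib z′ g k)) (lemma m (z′ ℕ.^ k) (g ℕ.^ k))))
      (powers k)))
    where
    lemma : ∀ m z g → m ℕ.* (z ℕ.* g) ≡ z ℕ.* m ℕ.* g
    lemma = ℕ-solve-∀
    m′ᵏ⊥z′ᵏ : Coprime (m′ ℕ.^ k) (z′ ℕ.^ k)
    m′ᵏ⊥z′ᵏ = coprime-^ k (Coprimality.sym (coprime-^ k (Coprimality.sym m′⊥z′)))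
  m′≡1 : ∀ m′ → m ≡ m′ ℕ.* g → (∀ k → m′ ℕ.^ k ∣ m) → m′ ≡ 1
  m′≡1 zero              m≡0 _ = contradiction m≡0 (ℕ.≢-nonZero⁻¹ m)
  m′≡1 (suc zero)        _   _ = ≡.refl
  m′≡1 m′@(suc (suc _)) _   m′ᵏ∣m =
    contradiction (ℕ∣.∣⇒≤ (m′ᵏ∣m m)) (ℕₚ.<⇒≱ (n<m^n m′ m (s≤s (s≤s z≤n))))
  m≡g : m ≡ g
  m≡g = ≡.trans m≡m′g (≡.trans (≡.cong (ℕ._* g) (m′≡1 m′ m≡m′g m′ᵏ∣m)) (ℕₚ.*-identityˡ g))

unique-lookup : ∀ {a} {A : Set a} {xs : List A} → Unique xs → ∀ i j → i Fin.< j → List.lookup xs i ≢ List.lookup xs j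
unique-lookup {xs = x ∷ xs} (x∉xs ∷ _) zero    (suc j) _         = All.lookup x∉xs (∈-lookup j)
unique-lookup {xs = x ∷ xs} (_ ∷ uniq) (suc i) (suc j) (s≤s i<j) = unique-lookup uniq i j i<j

_∈ᶠ?_ : ∀ {d} (i : Fin d) is → Dec (i ∈ is)
_∈ᶠ?_ = _∈?_
  where
  open import Data.List.Membership.DecPropositional Fin._≟_ using (_∈?_)

-- A missing index could be put in front, giving d + 1 distinct elements of `Fin d`, against the
-- pigeonhole principle.
unique⇒↭allFin : ∀ {d} {xs : List (Fin d)} → Unique xs → length xs ≡ d → xs ↭ allFin d
unique⇒↭allFin {d} {xs} uniq |xs|≡d =
  ∼bag⇒↭ (unique∧set⇒bag uniq (allFin⁺ d) (λ {i} → mk⇔ (λ _ → ∈-allFin i) (λ _ → every i)))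
  where
  every : ∀ i → i ∈ xs
  every i with i ∈ᶠ? xs
  ... | yes i∈xs = i∈xs
  ... | no  i∉xs with Finₚ.pigeonhole {d} {suc (length xs)} (s≤s (ℕₚ.≤-reflexive (≡.sym |xs|≡d))) (List.lookup (i ∷ xs))
  ...   | j , k , j<k , eq = contradiction eq (unique-lookup (Allₚ.¬Any⇒All¬ xs i∉xs ∷ uniq) j k j<k)

-- Sums of integer polynomials over all tuples of roots.

module Traces {c ℓ} (K : CommutativeRing c ℓ) where
  open Ring K
  open IntegerElements K
  open PairProducts K

  monomial : ∀ {n} → Vec ℕ n → Vec Carrier n → Carrier
  monomial []       []      = 1#
  monomial (k ∷ ks) (x ∷ v) = pow x k * monomial ks v

  monomial-+ : ∀ {n} (ks ls : Vec ℕ n) v → monomial (Vec.zipWith ℕ._+_ ks ls) v ≈ monomial ks v * monomial ls v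
  monomial-+ []       []       []      = sym (*-identityˡ _)
  monomial-+ (k ∷ ks) (l ∷ ls) (x ∷ v) = trans (*-cong (pow-+ x k l) (monomial-+ ks ls v))
    (solve 4 (λ a b x y → (a :* b) :* (x :* y) := (a :* x) :* (b :* y)) refl _ _ _ _)

  -- Functions given by integer polynomials, kept as sums of monomials so that a trace can be taken
  -- term by term; `resp` admits any pointwise equal expression.
  data IsPolynomial {n} : (Vec Carrier n → Carrier) → Set (c ⊔ ℓ) where
    term : ∀ z ks → IsPolynomial (λ v → ι z * monomial ks v)
    add  : ∀ {F G} → IsPolynomial F → IsPolynomial G → IsPolynomial (λ v → F v + G v)
    resp : ∀ {F G} → (∀ v → F v ≈ G v) → IsPolynomial F → IsPolynomial G

  poly-* : ∀ {n} {F G : Vec Carrier n → Carrier} → IsPolynomial F → IsPolynomial G → IsPolynomial (λ v → F v * G v)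
  poly-* (term y ks) (term z ls) = resp
    (λ v → trans (*-cong (ι-* y z) (monomial-+ ks ls v))
      (solve 4 (λ a b x y → (a :* b) :* (x :* y) := (a :* x) :* (b :* y)) refl _ _ _ _))
    (term (y ℤ.* z) (Vec.zipWith ℕ._+_ ks ls))
  poly-* p@(term _ _) (add q r)  = resp (λ v → sym (distribˡ _ _ _)) (add (poly-* p q) (poly-* p r))
  poly-* p@(term _ _) (resp eq q) = resp (λ v → *-congˡ (eq v)) (poly-* p q)
  poly-* (add p q)    r           = resp (λ v → sym (distribʳ _ _ _)) (add (poly-* p r) (poly-* q r))
  poly-* (resp eq p)  q           = resp (λ v → *-congʳ (eq v)) (poly-* p q)

  monomial-0 : ∀ {n} (v : Vec Carrier n) → monomial (Vec.replicate n 0) v ≈ 1#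
  monomial-0 []      = refl
  monomial-0 (x ∷ v) = trans (*-identityˡ _) (monomial-0 v)

  poly-ι : ∀ {n} z → IsPolynomial {n} (λ _ → ι z)
  poly-ι z = resp (λ v → trans (*-congˡ (monomial-0 v)) (*-identityʳ _)) (term z (Vec.replicate _ 0))

  poly-1 : ∀ {n} → IsPolynomial {n} (λ _ → 1#)
  poly-1 = resp (λ _ → ι-1) (poly-ι 1ℤ)

  poly-- : ∀ {n} {F G : Vec Carrier n → Carrier} → IsPolynomial F → IsPolynomial G → IsPolynomial (λ v → F v - G v)
  poly-- p q = resp (λ v → +-congˡ (solve 1 (λ x → con ℤ.-1ℤ :* x := :- x) refl _))
                    (add p (poly-* (poly-ι ℤ.-1ℤ) q))

  unit : ∀ {n} → Fin n → Vec ℕ n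
  unit zero    = 1 ∷ Vec.replicate _ 0
  unit (suc i) = 0 ∷ unit i

  monomial-unit : ∀ {n} (i : Fin n) v → monomial (unit i) v ≈ lookup v i
  monomial-unit zero    (x ∷ v) = trans (*-cong (*-identityʳ x) (monomial-0 v)) (*-identityʳ x)
  monomial-unit (suc i) (x ∷ v) = trans (*-identityˡ _) (monomial-unit i v)

  poly-lookup : ∀ {n} i → IsPolynomial {n} (λ v → lookup v i)
  poly-lookup i = resp (λ v → trans (*-congʳ ι-1) (trans (*-identityˡ _) (monomial-unit i v))) (term 1ℤ (unit i))

  poly-pow : ∀ {n} {F : Vec Carrier n → Carrier} → IsPolynomial F → ∀ k → IsPolynomial (λ v → pow (F v) k)
  poly-pow p zero    = poly-1
  poly-pow p (suc k) = poly-* p (poly-pow p k)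

  poly-form : ∀ {n} {F G : Vec Carrier n → Carrier} → IsPolynomial F → IsPolynomial G → ∀ cs → IsPolynomial (λ v → form cs (F v) (G v))
  poly-form p q []       = poly-ι 0ℤ
  poly-form p q (c ∷ cs) = add (poly-* (poly-ι c) (poly-pow p (length cs))) (poly-* q (poly-form p q cs))

  poly-pairs : ∀ {n} (φ : Carrier → Carrier → Carrier) → (∀ (i j : Fin n) → IsPolynomial {n} (λ v → φ (lookup v i) (lookup v j))) →
    ∀ is → IsPolynomial {n} (λ v → pairs (λ i j → φ (lookup v i) (lookup v j)) is)
  poly-pairs φ poly []       = poly-1
  poly-pairs φ poly (i ∷ is) = poly-* (poly-row is) (poly-pairs φ poly is)
    where
    poly-row : ∀ js → IsPolynomial (λ v → row (λ i j → φ (lookup v i) (lookup v j)) i js)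
    poly-row []       = poly-1
    poly-row (j ∷ js) = poly-* (poly i j) (poly-row js)

  toList≡ : ∀ {n a} {A : Set a} (v : Vec A n) → toList v ≡ List.map (lookup v) (allFin n)
  toList≡ {n} v = ≡.trans (go v) (≡.sym (map-tabulate (λ i → i) (lookup v)))
    where
    go : ∀ {a} {A : Set a} {n} (v : Vec A n) → toList v ≡ List.tabulate (lookup v)
    go []      = ≡.refl
    go (x ∷ v) = ≡.cong (x ∷_) (go v)

  ∑ᶠ-cong : ∀ d {f g : Fin d → Carrier} → (∀ i → f i ≈ g i) → ∑ᶠ d f ≈ ∑ᶠ d g
  ∑ᶠ-cong zero    eq = refl
  ∑ᶠ-cong (suc d) eq = +-cong (eq zero) (∑ᶠ-cong d (eq ∘ suc))

  ∑ᶠ-+ : ∀ d (f g : Fin d → Carrier) → ∑ᶠ d (λ i → f i + g i) ≈ ∑ᶠ d f + ∑ᶠ d g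
  ∑ᶠ-+ zero    f g = sym (+-identityˡ _)
  ∑ᶠ-+ (suc d) f g = trans (+-congˡ (∑ᶠ-+ d _ _))
    (solve 4 (λ a b x y → (a :+ b) :+ (x :+ y) := (a :+ x) :+ (b :+ y)) refl _ _ _ _)

  ∑ᶠ-*ʳ : ∀ d (f : Fin d → Carrier) x → ∑ᶠ d (λ i → f i * x) ≈ ∑ᶠ d f * x
  ∑ᶠ-*ʳ zero    f x = sym (zeroˡ _)
  ∑ᶠ-*ʳ (suc d) f x = trans (+-congˡ (∑ᶠ-*ʳ d _ x)) (sym (distribʳ _ _ _))

  module _ {d : ℕ} where

    -- The sum over all words of length n, repetitions included: without a restriction to distinct
    -- entries it factors over the positions of a monomial.
    trace : ∀ n → (Vec (Fin d) n → Carrier) → Carrier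
    trace zero    G = G []
    trace (suc n) G = ∑ᶠ d (λ i → trace n (λ w → G (i ∷ w)))

    trace-cong : ∀ n {G H} → (∀ w → G w ≈ H w) → trace n G ≈ trace n H
    trace-cong zero    eq = eq []
    trace-cong (suc n) eq = ∑ᶠ-cong d (λ i → trace-cong n (λ w → eq (i ∷ w)))

    trace-+ : ∀ n G H → trace n (λ w → G w + H w) ≈ trace n G + trace n H
    trace-+ zero    G H = refl
    trace-+ (suc n) G H = trans (∑ᶠ-cong d (λ i → trace-+ n _ _)) (∑ᶠ-+ d _ _)

    trace-*ʳ : ∀ n G x → trace n (λ w → G w * x) ≈ trace n G * x
    trace-*ʳ zero    G x = refl
    trace-*ʳ (suc n) G x = trans (∑ᶠ-cong d (λ i → trace-*ʳ n _ x)) (∑ᶠ-*ʳ d _ x)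

    trace-*ˡ : ∀ n x G → trace n (λ w → x * G w) ≈ x * trace n G
    trace-*ˡ n x G = trans (trace-cong n (λ w → *-comm x (G w))) (trans (trace-*ʳ n G x) (*-comm _ x))

    -- The trace of a monomial is the product of the power sums that belong to its exponents.
    trace-int : (α : Vec Carrier d) → (∀ k → IsInteger (powerSum α k)) →
      ∀ {n F} → IsPolynomial {n} F → IsInteger (trace n (λ w → F (Vec.map (lookup α) w)))
    trace-int α p-int {n} (term z ks) = int-resp (sym (trace-*ˡ n (ι z) (λ w → monomial ks (Vec.map (lookup α) w))))
      (int-* (int-ι z) (monomial-int ks))
      where
      monomial-int : ∀ {n} (ks : Vec ℕ n) → IsInteger (trace n (λ w → monomial ks (Vec.map (lookup α) w)))
      monomial-int []           = int-1
      monomial-int {suc n} (k ∷ ks) = int-resp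
        (sym (trans (∑ᶠ-cong d (λ i → trace-*ˡ n (pow (lookup α i) k) (λ w → monomial ks (Vec.map (lookup α) w))))
                    (∑ᶠ-*ʳ d (λ i → pow (lookup α i) k) _)))
        (int-* (p-int k) (monomial-int ks))
    trace-int α p-int {n} (add p q) =
      int-resp (sym (trace-+ n _ _)) (int-+ (trace-int α p-int p) (trace-int α p-int q))
    trace-int α p-int {n} (resp eq p) =
      int-resp (trace-cong n (λ w → eq (Vec.map (lookup α) w))) (trace-int α p-int p)

    ∑ⁿ : ∀ d → (Fin d → ℕ) → ℕ
    ∑ⁿ zero    f = 0
    ∑ⁿ (suc d) f = f zero ℕ.+ ∑ⁿ d (f ∘ suc)

    count : ∀ n → (Vec (Fin d) n → ℕ) → ℕ
    count zero    t = t []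
    count (suc n) t = ∑ⁿ d (λ i → count n (λ w → t (i ∷ w)))

    count-≥ : ∀ n t w → t w ℕ.≤ count n t
    count-≥ zero    t []      = ℕₚ.≤-refl
    count-≥ (suc n) t (i ∷ w) = ℕₚ.≤-trans (count-≥ n (λ w → t (i ∷ w)) w) (∑ⁿ-≥ d (λ i → count n (λ w → t (i ∷ w))) i)
      where
      ∑ⁿ-≥ : ∀ d f (i : Fin d) → f i ℕ.≤ ∑ⁿ d f
      ∑ⁿ-≥ (suc d) f zero    = ℕₚ.m≤m+n _ _
      ∑ⁿ-≥ (suc d) f (suc i) = ℕₚ.≤-trans (∑ⁿ-≥ d (f ∘ suc) i) (ℕₚ.m≤n+m _ (f zero))

    trace-ι : ∀ n t → trace n (λ w → ι (+ t w)) ≈ ι (+ count n t)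
    trace-ι zero    t = refl
    trace-ι (suc n) t = trans (∑ᶠ-cong d (λ i → trace-ι n _)) (∑ᶠ-ι d _)
      where
      ∑ᶠ-ι : ∀ d f → ∑ᶠ d (λ i → ι (+ f i)) ≈ ι (+ ∑ⁿ d f)
      ∑ᶠ-ι zero    f = refl
      ∑ᶠ-ι (suc d) f = trans (+-congˡ (∑ᶠ-ι d (f ∘ suc))) (sym (ι-+ (+ f zero) (+ ∑ⁿ d (f ∘ suc))))

  TorsionFree : Set (c ⊔ ℓ)
  TorsionFree = ∀ z → z ≢ 0ℤ → ∀ a → ι z * a ≈ 0# → a ≈ 0#

  module _ (char0 : CharZero K) (torsion-free : TorsionFree) where

    ι-injective : ∀ {y z} → ι y ≈ ι z → y ≡ z
    ι-injective {y} {z} eq = ℤₚ.i-j≡0⇒i≡j y z (char0 (y ℤ.- z)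
      (trans (ι-+ y (ℤ.- z)) (trans (+-cong eq (ι-neg z)) (-‿inverseʳ _))))

    ι-cancel : ∀ z → z ≢ 0ℤ → ∀ {a b} → ι z * a ≈ ι z * b → a ≈ b
    ι-cancel z z≢0 {a} {b} eq = trans (solve 2 (λ a b → a := a :- b :+ b) refl a b)
      (trans (+-congʳ (torsion-free z z≢0 (a - b)
        (trans (solve 3 (λ z a b → z :* (a :- b) := z :* a :- z :* b) refl (ι z) a b)
               (trans (+-congʳ eq) (-‿inverseʳ _))))) (+-identityˡ b))

    ι-^ : ∀ z k → ι (z ℤ.^ k) ≈ pow (ι z) k
    ι-^ z zero    = ι-1
    ι-^ z (suc k) = trans (ι-* z (z ℤ.^ k)) (*-congˡ (ι-^ z k))

    pow-distrib : ∀ x y k → pow (x * y) k ≈ pow x k * pow y k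
    pow-distrib x y zero    = sym (*-identityˡ _)
    pow-distrib x y (suc k) = trans (*-congˡ (pow-distrib x y k))
      (solve 4 (λ a b x y → (a :* b) :* (x :* y) := (a :* x) :* (b :* y)) refl _ _ _ _)

    -- A fraction all of whose powers have a common denominator is an integer.
    bounded-denominator⇒int : ∀ M → M ≢ 0ℤ → ∀ E → (∀ k → IsInteger (ι M * pow E k)) → IsInteger E
    bounded-denominator⇒int M M≢0 E powers-int with powers-int 1
    ... | z , ιz≈ = conclude (powers-∣⇒∣ (∣ M ∣) (∣ z ∣) powers)
      where
      instance _ = ℕ.≢-nonZero (M≢0 ∘ ℤₚ.∣i∣≡0⇒i≡0)
      ιz≈ME : ι z ≈ ι M * E
      ιz≈ME = trans ιz≈ (*-congˡ (*-identityʳ E))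
      abs-^ : ∀ z k → ∣ z ℤ.^ k ∣ ≡ ∣ z ∣ ℕ.^ k
      abs-^ z zero    = ≡.refl
      abs-^ z (suc k) = ≡.trans (ℤₚ.abs-* z (z ℤ.^ k)) (≡.cong (∣ z ∣ ℕ.*_) (abs-^ z k))
      -- From z = M E and y = M Eᵏ follows M zᵏ = y Mᵏ.
      powers : ∀ k → ∣ M ∣ ℕ.^ k ∣ ∣ M ∣ ℕ.* ∣ z ∣ ℕ.^ k
      powers k with powers-int k
      ... | y , ιy≈ = divides (∣ y ∣) (≡.trans (≡.cong (∣ M ∣ ℕ.*_) (≡.sym (abs-^ z k)))
        (≡.trans (≡.sym (ℤₚ.abs-* M (z ℤ.^ k))) (≡.trans (≡.cong ∣_∣ Mzᵏ≡yMᵏ)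
          (≡.trans (ℤₚ.abs-* y (M ℤ.^ k)) (≡.cong (∣ y ∣ ℕ.*_) (abs-^ M k))))))
        where
        Mzᵏ≡yMᵏ : M ℤ.* z ℤ.^ k ≡ y ℤ.* M ℤ.^ k
        Mzᵏ≡yMᵏ = ι-injective (begin
          ι (M ℤ.* z ℤ.^ k)                 ≈⟨ ι-* M (z ℤ.^ k) ⟩
          ι M * ι (z ℤ.^ k)                 ≈⟨ *-congˡ (trans (ι-^ z k) (pow-cong k ιz≈ME)) ⟩
          ι M * pow (ι M * E) k             ≈⟨ *-congˡ (pow-distrib (ι M) E k) ⟩
          ι M * (pow (ι M) k * pow E k)     ≈⟨ solve 3 (λ m p e → m :* (p :* e) := (m :* e) :* p) refl _ _ _ ⟩
          ι M * pow E k * pow (ι M) k       ≈⟨ *-cong (sym ιy≈) (sym (ι-^ M k)) ⟩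
          ι y * ι (M ℤ.^ k)                 ≈⟨ ι-* y (M ℤ.^ k) ⟨
          ι (y ℤ.* M ℤ.^ k)                 ∎)
      conclude : ∣ M ∣ ∣ ∣ z ∣ → IsInteger E
      conclude M∣z with ℤ∣.∣ᵤ⇒∣ {M} {z} M∣z
      ... | ℤ∣.divides q z≡qM = q , ι-cancel M M≢0 (begin
        ι M * ι q      ≈⟨ *-comm _ _ ⟩
        ι q * ι M      ≈⟨ ι-* q M ⟨
        ι (q ℤ.* M)    ≡⟨ ≡.cong ι z≡qM ⟨
        ι z            ≈⟨ ιz≈ME ⟩
        ι M * E        ∎)

    -- A repeated index puts a diagonal value of φ, that is 0, into the product. The decision is
    -- made on indices, so equal roots at different indices count as distinct here.
    pairs-unique : ∀ {d} (φ : Fin d → Fin d → Carrier) → (∀ i → φ i i ≈ 0#) →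
      ∀ is → pairs φ is ≈ 0# ⊎ Unique is
    pairs-unique φ φ-diag []       = inj₂ []
    pairs-unique {d} φ φ-diag (i ∷ is) with i ∈ᶠ? is
    ... | yes i∈is = let w , eq = row-∈ {φ = φ} i i∈is in
      inj₁ (trans (*-congʳ (trans eq (trans (*-congʳ (φ-diag i)) (zeroˡ w)))) (zeroˡ _))
    ... | no i∉is with pairs-unique φ φ-diag is
    ...   | inj₁ eq   = inj₁ (trans (*-congˡ eq) (zeroʳ _))
    ...   | inj₂ uniq = inj₂ (Allₚ.¬Any⇒All¬ is i∉is ∷ uniq)

    module _ {d} (α : Vec Carrier d) (p-int : ∀ k → IsInteger (powerSum α k))
             (Δ : ℤ) (Δ≢0 : Δ ≢ 0ℤ) (Δ≈ : ι Δ ≈ discK K (toList α)) where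

      on-roots : (Carrier → Carrier → Carrier) → Fin d → Fin d → Carrier
      on-roots φ i j = φ (lookup α i) (lookup α j)

      pairs-toList : ∀ φ {n} (w : Vec (Fin d) n) →
        pairs φ (toList (Vec.map (lookup α) w)) ≡ pairs (on-roots φ) (toList w)
      pairs-toList φ w = ≡.trans (≡.cong (pairs φ) (Vecₚ.toList-map (lookup α) w)) (pairs-map φ (lookup α) (toList w))

      pairs-roots : ∀ φ → pairs φ (toList α) ≡ pairs (on-roots φ) (allFin d)
      pairs-roots φ = ≡.trans (≡.cong (pairs φ) (toList≡ α)) (pairs-map φ (lookup α) (allFin d))

      -- Summing Eᵏ Δ over all d-tuples of roots gives an integer; the tuples with a repetition contribute nothing,
      -- and the others are rearrangements of the roots, contributing equally.
      symmetric-pairs-int : ∀ cs → (∀ i j → on-roots (form cs) i j ≈ on-roots (form cs) j i) →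
        IsInteger (pairs (form cs) (toList α))
      symmetric-pairs-int cs cs-sym = bounded-denominator⇒int (+ N ℤ.* Δ) NΔ≢0 E λ k →
        int-resp (begin
          trace d (sample k)                         ≈⟨ trace-cong d (λ w → contribution k w (classify w)) ⟩
          trace d (λ w → ι (+ t w) * (pow E k * ι Δ))  ≈⟨ trace-*ʳ d (λ w → ι (+ t w)) _ ⟩
          trace d (λ w → ι (+ t w)) * (pow E k * ι Δ)  ≈⟨ *-congʳ (trace-ι d t) ⟩
          ι (+ N) * (pow E k * ι Δ)             ≈⟨ solve 3 (λ n e δ → n :* (e :* δ) := n :* δ :* e) refl _ _ _ ⟩
          ι (+ N) * ι Δ * pow E k               ≈⟨ *-congʳ (ι-* (+ N) Δ) ⟨
          ι (+ N ℤ.* Δ) * pow E k               ∎)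
        (trace-int α p-int (summand-poly k))
        where
        E = pairs (form cs) (toList α)
        square = squaredDifference
        summand : ℕ → Vec Carrier d → Carrier
        summand k v = pow (pairs (form cs) (toList v)) k * pairs square (toList v)
        poly-on : ∀ (φ : Carrier → Carrier → Carrier) → (∀ i j → IsPolynomial {d} (λ v → φ (lookup v i) (lookup v j))) →
          IsPolynomial {d} (λ v → pairs φ (toList v))
        poly-on φ poly = resp
          (λ v → reflexive (≡.sym (≡.trans (≡.cong (pairs φ) (toList≡ v)) (pairs-map φ (lookup v) (allFin d)))))
          (poly-pairs φ poly (allFin d))
        summand-poly : ∀ k → IsPolynomial (summand k)
        summand-poly k = poly-* (poly-pow (poly-on (form cs) (λ i j → poly-form (poly-lookup i) (poly-lookup j) cs)) k)
                          (poly-on square (λ i j → poly-* (difference i j) (difference i j)))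
          where
          difference : ∀ i j → IsPolynomial (λ v → lookup v i - lookup v j)
          difference i j = poly-- (poly-lookup i) (poly-lookup j)
        sample : ℕ → Vec (Fin d) d → Carrier
        sample k w = summand k (Vec.map (lookup α) w)
        Class : Vec (Fin d) d → Set ℓ
        Class w = pairs (on-roots square) (toList w) ≈ 0# ⊎ toList w ↭ allFin d
        classify : ∀ w → Class w
        classify w with pairs-unique (on-roots square)
                          (λ i → solve 1 (λ x → (x :- x) :* (x :- x) := con 0ℤ) refl (lookup α i)) (toList w)
        ... | inj₁ eq   = inj₁ eq
        ... | inj₂ uniq = inj₂ (unique⇒↭allFin uniq (Vecₚ.length-toList w))
        weight : ∀ {w} → Class w → ℕ
        weight (inj₁ _) = 0
        weight (inj₂ _) = 1
        t : Vec (Fin d) d → ℕ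
        t w = weight (classify w)
        -- The number of words of length d without repetition, that is d!.
        N = count d t
        square-sym : ∀ x y → square x y ≈ square y x
        square-sym = solve 2 (λ x y → (x :- y) :* (x :- y) := (y :- x) :* (y :- x)) refl
        Δ≈pairs : ι Δ ≈ pairs square (toList α)
        Δ≈pairs = trans Δ≈ (reflexive (discK≡pairs (toList α)))
        contribution : ∀ k w (class : Class w) → sample k w ≈ ι (+ weight class) * (pow E k * ι Δ)
        contribution k w (inj₁ eq) = trans (*-congˡ (trans (reflexive (pairs-toList square w)) eq))
          (trans (zeroʳ _) (sym (zeroˡ _)))
        contribution k w (inj₂ w↭) = trans
          (*-cong (pow-cong k (trans (reflexive (pairs-toList (form cs) w))
                                (trans (pairs-↭ cs-sym w↭) (reflexive (≡.sym (pairs-roots (form cs)))))))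
                  (trans (reflexive (pairs-toList square w))
                    (trans (pairs-↭ (λ i j → square-sym (lookup α i) (lookup α j)) w↭)
                      (trans (reflexive (≡.sym (pairs-roots square))) (sym Δ≈pairs)))))
          (sym (trans (*-congʳ ι-1) (*-identityˡ _)))
        -- N ≥ 1 because the identity word is classed as a rearrangement: the other class would give
        -- Δ = 0.
        NΔ≢0 : + N ℤ.* Δ ≢ 0ℤ
        NΔ≢0 eq with ℤₚ.i*j≡0⇒i≡0∨j≡0 (+ N) eq
        ... | inj₂ Δ≡0 = Δ≢0 Δ≡0
        ... | inj₁ N≡0 = contradiction (ℕₚ.≤-trans (identity-weight (classify identity)) (count-≥ d t identity))
                           (ℕₚ.<⇒≱ (s≤s (ℕₚ.≤-reflexive (ℤₚ.+-injective N≡0))))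
          where
          identity = Vec.allFin d
          identity-list : toList identity ≡ allFin d
          identity-list = ≡.trans (toList≡ identity) (≡.trans (map-cong (Vecₚ.lookup-allFin) (allFin d)) (map-id (allFin d)))
          identity-weight : (class : Class identity) → 1 ℕ.≤ weight class
          identity-weight (inj₂ _)  = ℕₚ.≤-refl
          identity-weight (inj₁ eq) = contradiction (char0 Δ (trans Δ≈pairs (trans
            (reflexive (≡.trans (pairs-roots square) (≡.cong (pairs (on-roots square)) (≡.sym identity-list)))) eq))) Δ≢0

-- The theorem over a torsion-free ring.

open MöbiusSums using (∏∣; twisted; twisted-nonneg; δ≡twisted)

-- The index 1 is left out, since its factor is Δ(P) itself; the descending order follows the
-- recursion of `∏₁`.
from2 : ℕ → List ℕ
from2 zero          = []
from2 (suc zero)    = []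
from2 (suc (suc m)) = suc (suc m) ∷ from2 (suc m)

z≢0⇒1≤z*z : ∀ z → z ≢ 0ℤ → 1ℤ ℤ.≤ z ℤ.* z
z≢0⇒1≤z*z (+ zero)  z≢0 = contradiction ≡.refl z≢0
z≢0⇒1≤z*z (+ suc n) _   = +≤+ (s≤s z≤n)
z≢0⇒1≤z*z -[1+ n ]  _   = +≤+ (s≤s z≤n)

module TorsionFreeCase {c ℓ} (K : CommutativeRing c ℓ) (char0 : CharZero K) where
  open Ring K
  open PairProducts K
  open IntegerElements K
  open Traces K
  open Cyclotomics K

  ∏₁-antisym : ∀ n f g → f 1 ≈ - g 1 → (∀ e → 2 ℕ.≤ e → e ℕ.≤ suc n → f e ≈ g e) → ∏₁ (suc n) f ≈ - ∏₁ (suc n) g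
  ∏₁-antisym zero    f g eq₁ eq = trans (*-congˡ eq₁) (solve 2 (λ x y → x :* (:- y) := :- (x :* y)) refl 1# (g 1))
  ∏₁-antisym (suc n) f g eq₁ eq = trans
    (*-cong (∏₁-antisym n f g eq₁ (λ e 2≤e e≤ → eq e 2≤e (ℕₚ.m≤n⇒m≤1+n e≤))) (eq (suc (suc n)) (s≤s (s≤s z≤n)) ℕₚ.≤-refl))
    (solve 2 (λ x y → (:- x) :* y := :- (x :* y)) refl _ _)

  ∏₁-zero : ∀ n {e} f → 1 ℕ.≤ e → e ℕ.≤ n → f e ≈ 0# → ∏₁ n f ≈ 0#
  ∏₁-zero zero    f 1≤e e≤0 eq = contradiction (ℕₚ.≤-trans 1≤e e≤0) λ ()
  ∏₁-zero (suc n) {e} f 1≤e e≤1+n eq with e ℕ.≟ suc n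
  ... | yes ≡.refl = trans (*-congˡ eq) (zeroʳ _)
  ... | no e≢1+n   = trans (*-congʳ (∏₁-zero n f 1≤e (ℕ.s≤s⁻¹ (ℕₚ.≤∧≢⇒< e≤1+n e≢1+n)) eq)) (zeroˡ _)

  module _ {Φ n} (cyc : Cyclotomic Φ n) where

    properFactor : ℕ → Carrier → Carrier → ℕ → Carrier
    properFactor k x y e = when (e ∣? k ×-dec ¬? (e ℕ.≟ k)) (monic (Φ e) x y)

    pow-difference : ∀ k → 1 ℕ.≤ k → k ℕ.≤ n → ∀ x y → pow x k - pow y k ≈ ∏₁ n (properFactor k x y) * monic (Φ k) x y
    pow-difference k 1≤k k≤n x y = begin
      pow x k - pow y k
        ≈⟨ cyc k 1≤k k≤n x y ⟩
      ∏₁ n (factor Φ k x y)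
        ≈⟨ ∏₁-cong n (λ e _ _ → split e (e ∣? k) (e ℕ.≟ k)) ⟩
      ∏₁ n (λ e → properFactor k x y e * when (e ℕ.≟ k) (monic (Φ e) x y))
        ≈⟨ ∏₁-* n _ _ ⟩
      ∏₁ n (properFactor k x y) * ∏₁ n (λ e → when (e ℕ.≟ k) (monic (Φ e) x y))
        ≈⟨ *-congˡ (∏₁-single n k (λ e → monic (Φ e) x y) 1≤k k≤n) ⟩
      ∏₁ n (properFactor k x y) * monic (Φ k) x y ∎
      where
      split : ∀ e {a} (e∣?k : Dec (e ∣ k)) (e≟k : Dec (e ≡ k)) →
        when e∣?k a ≈ when (e∣?k ×-dec ¬? e≟k) a * when e≟k a
      split e (yes _)  (yes _)      = sym (*-identityˡ _)
      split e (yes _)  (no _)       = sym (*-identityʳ _)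
      split e (no e∤k) (yes ≡.refl) = contradiction ∣-refl e∤k
      split e (no _)   (no _)       = sym (*-identityˡ _)

    monic-1 : 1 ℕ.≤ n → ∀ x y → monic (Φ 1) x y ≈ pow x 1 - pow y 1
    monic-1 1≤n x y = sym (trans (pow-difference 1 ℕₚ.≤-refl 1≤n x y) (trans
      (*-congʳ (∏₁-one n (λ e _ _ → reflexive (when-no (e ∣? 1 ×-dec ¬? (e ℕ.≟ 1)) (λ (e∣1 , e≢1) → e≢1 (∣1⇒≡1 e∣1))))))
      (*-identityˡ _)))

    -- Swapping x and y changes the sign of Xᵏ - Yᵏ and of Φ₁ = X - Y, hence by induction of no other Φₖ.
    monic-sym : ∀ x y → (∀ k → 1 ℕ.≤ k → ∀ {a b} → (pow x k - pow y k) * a ≈ (pow x k - pow y k) * b → a ≈ b) →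
      ∀ k → 2 ℕ.≤ k → k ℕ.≤ n → monic (Φ k) x y ≈ monic (Φ k) y x
    monic-sym x y cancel k = bounded k k ℕₚ.≤-refl
      where
      bounded : ∀ m k → k ℕ.≤ m → 2 ℕ.≤ k → k ℕ.≤ n → monic (Φ k) x y ≈ monic (Φ k) y x
      bounded zero    k k≤0   2≤k k≤n = contradiction (ℕₚ.≤-trans 2≤k k≤0) λ ()
      -- The difference xᵏ - yᵏ equals P ψ as well as P ψ′, so its products with ψ and with ψ′
      -- agree, and it is cancelled as a whole.
      bounded (suc m) k k≤1+m 2≤k k≤n = cancel k 1≤k (begin
        (pow x k - pow y k) * ψ   ≈⟨ *-congʳ swapped ⟩
        P * ψ′ * ψ                ≈⟨ solve 3 (λ p q r → p :* q :* r := p :* r :* q) refl P ψ′ ψ ⟩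
        P * ψ * ψ′                ≈⟨ *-congʳ (pow-difference k 1≤k k≤n x y) ⟨
        (pow x k - pow y k) * ψ′  ∎)
        where
        1≤k = ℕₚ.≤-trans (s≤s z≤n) 2≤k
        ψ = monic (Φ k) x y
        ψ′ = monic (Φ k) y x
        P = ∏₁ n (properFactor k x y)
        P′ = ∏₁ n (properFactor k y x)
        first : ∀ x y → properFactor k x y 1 ≈ pow x 1 - pow y 1
        first x y = trans (reflexive (when-yes (1 ∣? k ×-dec ¬? (1 ℕ.≟ k)) (1∣ k , ℕₚ.<⇒≢ 2≤k)))
                          (monic-1 (ℕₚ.≤-trans 1≤k k≤n) x y)
        others : ∀ e → 2 ℕ.≤ e → e ℕ.≤ n → properFactor k x y e ≈ properFactor k y x e
        others e 2≤e e≤n = case (e ∣? k ×-dec ¬? (e ℕ.≟ k))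
          where
          case : (d : Dec (e ∣ k × e ≢ k)) → when d (monic (Φ e) x y) ≈ when d (monic (Φ e) y x)
          case (yes (e∣k , e≢k)) = bounded m e (ℕ.s≤s⁻¹ (ℕₚ.≤-trans
            (ℕₚ.≤∧≢⇒< (∣⇒≤ {{ℕ.>-nonZero 1≤k}} e∣k) e≢k) k≤1+m)) 2≤e e≤n
          case (no _) = refl
        antisym : ∀ n → 1 ℕ.≤ n → (∀ e → 2 ℕ.≤ e → e ℕ.≤ n → properFactor k x y e ≈ properFactor k y x e) →
          ∏₁ n (properFactor k x y) ≈ - ∏₁ n (properFactor k y x)
        antisym (suc n) _ = ∏₁-antisym n _ _ (trans (first x y)
          (trans (solve 2 (λ a b → a :- b := :- (b :- a)) refl (pow x 1) (pow y 1)) (-‿cong (sym (first y x)))))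
        swapped : pow x k - pow y k ≈ P * ψ′
        swapped = begin
          pow x k - pow y k      ≈⟨ solve 2 (λ a b → a :- b := :- (b :- a)) refl (pow x k) (pow y k) ⟩
          - (pow y k - pow x k)  ≈⟨ -‿cong (pow-difference k 1≤k k≤n y x) ⟩
          - (P′ * ψ′)            ≈⟨ solve 2 (λ p q → :- (p :* q) := (:- p) :* q) refl P′ ψ′ ⟩
          - P′ * ψ′              ≈⟨ *-congʳ (antisym n (ℕₚ.≤-trans 1≤k k≤n) others) ⟨
          P * ψ′                 ∎

  module _ (torsion-free : TorsionFree) {d} (coef : Vec ℤ d) (α : Vec Carrier d) (splits : Splits K coef α)
           (D : ℕ → ℤ) (D≈ : ∀ n → 1 ℕ.≤ n → ι (D n) ≈ ΔnK K n α) (D≢0 : ∀ n → 1 ℕ.≤ n → D n ≢ 0ℤ) where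

    powDifferenceSquared : ℕ → Carrier → Carrier → Carrier
    powDifferenceSquared k x y = squaredDifference (pow x k) (pow y k)

    D≈pairs : ∀ k → 1 ℕ.≤ k → ι (D k) ≈ pairs (powDifferenceSquared k) (toList α)
    D≈pairs k 1≤k = trans (D≈ k 1≤k) (reflexive (≡.trans (discK≡pairs (List.map (powK K k) (toList α))) (pairs-map squaredDifference (powK K k) (toList α))))

    pow-difference-cancel : ∀ {i j} → i ≢ j → ∀ k → 1 ℕ.≤ k → ∀ {a b} →
      (pow (lookup α i) k - pow (lookup α j) k) * a ≈ (pow (lookup α i) k - pow (lookup α j) k) * b → a ≈ b
    pow-difference-cancel {i} {j} i≢j k 1≤k {a} {b} eq
      with pairs-∈ {φ = λ i j → powDifferenceSquared k (lookup α i) (lookup α j)}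
             (λ i j → solve 2 (λ x y → (x :- y) :* (x :- y) := (y :- x) :* (y :- x)) refl _ _)
             (∈-allFin i) (∈-allFin j) i≢j
    ... | w , pairs≈ = ι-cancel char0 torsion-free (D k) (D≢0 k 1≤k) (begin
      ι (D k) * a    ≈⟨ *-congʳ D≈δδw ⟩
      δ′ * δ′ * w * a  ≈⟨ solve 3 (λ δ w a → δ :* δ :* w :* a := δ :* w :* (δ :* a)) refl _ _ _ ⟩
      δ′ * w * (δ′ * a) ≈⟨ *-congˡ eq ⟩
      δ′ * w * (δ′ * b) ≈⟨ solve 3 (λ δ w a → δ :* δ :* w :* a := δ :* w :* (δ :* a)) refl _ _ _ ⟨
      δ′ * δ′ * w * b  ≈⟨ *-congʳ D≈δδw ⟨
      ι (D k) * b    ∎)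
      where
      δ′ = pow (lookup α i) k - pow (lookup α j) k
      D≈δδw : ι (D k) ≈ δ′ * δ′ * w
      D≈δδw = trans (D≈pairs k 1≤k) (trans (reflexive (≡.trans (≡.cong (pairs (powDifferenceSquared k)) (toList≡ α))
        (pairs-map (powDifferenceSquared k) (lookup α) (allFin d)))) pairs≈)

    module _ {n} (1≤n : 1 ℕ.≤ n) {Φ} (cyc : Cyclotomic Φ n) where

      E : ℕ → Carrier
      E e = pairs (monic (Φ e)) (toList α)

      E-int : ∀ e → 2 ℕ.≤ e → e ℕ.≤ n → IsInteger (E e)
      E-int e 2≤e e≤n = symmetric-pairs-int char0 torsion-free α (powerSum-int α (elementary-int coef α splits))
        (D 1) (D≢0 1 ℕₚ.≤-refl) disc≈ (1ℤ ∷ Φ e) symmetric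
        where
        disc≈ : ι (D 1) ≈ discK K (toList α)
        disc≈ = trans (D≈pairs 1 ℕₚ.≤-refl) (trans (pairs-cong (λ x y → *-cong (first x y) (first x y)) (toList α))
                  (reflexive (≡.sym (discK≡pairs (toList α)))))
          where
          first : ∀ x y → pow x 1 - pow y 1 ≈ x - y
          first x y = +-cong (*-identityʳ x) (-‿cong (*-identityʳ y))
        symmetric : ∀ i j → monic (Φ e) (lookup α i) (lookup α j) ≈ monic (Φ e) (lookup α j) (lookup α i)
        symmetric i j with i Fin.≟ j
        ... | yes ≡.refl = refl
        ... | no i≢j = monic-sym {Φ} cyc (lookup α i) (lookup α j) (pow-difference-cancel i≢j) e 2≤e e≤n

      norm : ℕ → ℕ → Carrier
      norm k e = when (e ∣? k) (E e)

      D≈∏ : ∀ k → 1 ℕ.≤ k → k ℕ.≤ n → ι (D k) ≈ ∏₁ n (λ e → norm k e * norm k e)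
      D≈∏ k 1≤k k≤n = begin
        ι (D k)
          ≈⟨ D≈pairs k 1≤k ⟩
        pairs (powDifferenceSquared k) (toList α)
          ≈⟨ pairs-cong (λ x y → *-cong (cyc k 1≤k k≤n x y) (cyc k 1≤k k≤n x y)) (toList α) ⟩
        pairs (λ x y → ∏₁ n (factor Φ k x y) * ∏₁ n (factor Φ k x y)) (toList α)
          ≈⟨ pairs-* _ _ (toList α) ⟩
        Q * Q
          ≈⟨ *-cong Q≈ Q≈ ⟩
        ∏₁ n (norm k) * ∏₁ n (norm k)
          ≈⟨ ∏₁-* n (norm k) (norm k) ⟨
        ∏₁ n (λ e → norm k e * norm k e) ∎
        where
        Q = pairs (λ x y → ∏₁ n (factor Φ k x y)) (toList α)
        Q≈ : Q ≈ ∏₁ n (norm k)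
        Q≈ = trans (pairs-∏₁ n (λ e x y → factor Φ k x y e) (toList α))
                   (∏₁-cong n (λ e _ _ → pairs-when (e ∣? k) (monic (Φ e)) (toList α)))

      root : ∀ {e} → Dec (2 ℕ.≤ e × e ℕ.≤ n) → ℤ
      root (yes (2≤e , e≤n)) = proj₁ (E-int _ 2≤e e≤n)
      -- The default 1 keeps `square e` ≥ 1 for every e, as the nonnegative expansion demands.
      root (no _)            = 1ℤ

      inRange? : ∀ e → Dec (2 ℕ.≤ e × e ℕ.≤ n)
      inRange? e = 2 ℕ.≤? e ×-dec e ℕ.≤? n

      square : ℕ → ℤ
      square e = root (inRange? e) ℤ.* root (inRange? e)

      square≥1 : ∀ e → 1ℤ ℤ.≤ square e
      square≥1 e = z≢0⇒1≤z*z (root (inRange? e)) (root≢0 (inRange? e))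
        where
        root≢0 : (r : Dec (2 ℕ.≤ e × e ℕ.≤ n)) → root r ≢ 0ℤ
        root≢0 (no _) ()
        root≢0 (yes (2≤e , e≤n)) root≡0 = D≢0 e 1≤e (char0 (D e) (trans (D≈∏ e 1≤e e≤n)
          (∏₁-zero n _ 1≤e e≤n (trans (*-congʳ (trans (reflexive (when-yes (e ∣? e) ∣-refl)) E≈0)) (zeroˡ _)))))
          where
          1≤e = ℕₚ.≤-trans (s≤s z≤n) 2≤e
          E≈0 : E e ≈ 0#
          E≈0 = trans (sym (proj₂ (E-int e 2≤e e≤n))) (reflexive (≡.cong ι root≡0))

      square≈ : ∀ e → 2 ℕ.≤ e → e ℕ.≤ n → ι (square e) ≈ E e * E e
      square≈ e 2≤e e≤n = trans (ι-* (root (inRange? e)) (root (inRange? e))) (*-cong (root≈ (inRange? e)) (root≈ (inRange? e)))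
        where
        root≈ : (r : Dec (2 ℕ.≤ e × e ℕ.≤ n)) → ι (root r) ≈ E e
        root≈ (yes (2≤e , e≤n)) = proj₂ (E-int e 2≤e e≤n)
        root≈ (no out)          = contradiction (2≤e , e≤n) out

      -- Index 1 divides every k and contributes Δ(P), since Φ₁ = X - Y; all other factors are
      -- squares of integers or 1.
      ∏-norms : ∀ k m → suc m ℕ.≤ n → ∏₁ (suc m) (λ e → norm k e * norm k e) ≈ ι (D 1 ℤ.* ∏∣ square (from2 (suc m)) k)
      ∏-norms k zero    _ = begin
        1# * (norm k 1 * norm k 1)
          ≈⟨ *-identityˡ _ ⟩
        norm k 1 * norm k 1
          ≈⟨ *-cong norm≈ norm≈ ⟩
        E 1 * E 1
          ≈⟨ pairs-* _ _ (toList α) ⟨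
        pairs (λ x y → monic (Φ 1) x y * monic (Φ 1) x y) (toList α)
          ≈⟨ pairs-cong (λ x y → *-cong (monic-1 {Φ} cyc 1≤n x y) (monic-1 {Φ} cyc 1≤n x y)) (toList α) ⟩
        pairs (powDifferenceSquared 1) (toList α)
          ≈⟨ D≈pairs 1 ℕₚ.≤-refl ⟨
        ι (D 1)
          ≡⟨ ≡.cong ι (ℤₚ.*-identityʳ (D 1)) ⟨
        ι (D 1 ℤ.* 1ℤ) ∎
        where
        norm≈ : norm k 1 ≈ E 1
        norm≈ = reflexive (when-yes (1 ∣? k) (1∣ k))
      ∏-norms k (suc m) 2+m≤n = begin
        ∏₁ (suc m) (λ e → norm k e * norm k e) * (norm k e * norm k e)
          ≈⟨ *-cong (∏-norms k m (ℕₚ.<⇒≤ 2+m≤n)) (last (e ∣? k)) ⟩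
        ι (D 1 ℤ.* R) * ι (if does (e ∣? k) then square e else 1ℤ)
          ≈⟨ ι-* (D 1 ℤ.* R) _ ⟨
        ι (D 1 ℤ.* R ℤ.* (if does (e ∣? k) then square e else 1ℤ))
          ≡⟨ ≡.cong ι (lemma (D 1) R _) ⟩
        ι (D 1 ℤ.* ∏∣ square (from2 (suc (suc m))) k) ∎
        where
        e = suc (suc m)
        R = ∏∣ square (from2 (suc m)) k
        lemma : ∀ d r s → d ℤ.* r ℤ.* s ≡ d ℤ.* (s ℤ.* r)
        lemma d r s = ≡.trans (ℤₚ.*-assoc d r s) (≡.cong (λ z → d ℤ.* z) (ℤₚ.*-comm r s))
        last : (e∣?k : Dec (e ∣ k)) → when e∣?k (E e) * when e∣?k (E e) ≈ ι (if does e∣?k then square e else 1ℤ)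
        last (yes _) = sym (square≈ e (s≤s (s≤s z≤n)) 2+m≤n)
        last (no _)  = trans (*-identityˡ _) (sym ι-1)

      D≡∏∣ : ∀ k → 1 ℕ.≤ k → k ℕ.≤ n → D k ≡ D 1 ℤ.* ∏∣ square (from2 n) k
      D≡∏∣ k 1≤k k≤n = ι-injective char0 torsion-free (trans (D≈∏ k 1≤k k≤n) (go n 1≤n ℕₚ.≤-refl))
        where
        go : ∀ m → 1 ℕ.≤ m → m ℕ.≤ n → ∏₁ m (λ e → norm k e * norm k e) ≈ ι (D 1 ℤ.* ∏∣ square (from2 m) k)
        go (suc m) _ = ∏-norms k m

    -- The forms and the squares are chosen anew for each n; the common factor `D 1` is what ties
    -- the signs for different n together.
    δ-multiple : ∀ n → 1 ℕ.≤ n → ∃[ t ] 0ℤ ℤ.≤ t × δ D n ≡ D 1 ℤ.* t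
    δ-multiple n 1≤n with cyclotomic-exists K n
    ... | Φ , _ , cyc = twisted squares 1≤n 1 (∏∣ squares (from2 n)) ,
      twisted-nonneg squares 1≤n (square≥1 1≤n {Φ} cyc) (from2 n) 1 ,
      δ≡twisted squares 1≤n D (from2 n) (D≡∏∣ 1≤n {Φ} cyc)
      where
      squares = square 1≤n {Φ} cyc

    sameSign : SameSign (δ D)
    sameSign with ℤₚ.≤-total 0ℤ (D 1)
    ... | inj₁ 0≤D₁ = inj₁ λ n 1≤n → let t , 0≤t , eq = δ-multiple n 1≤n in
      ≡.subst (0ℤ ℤ.≤_) (≡.sym eq) (≡.subst (ℤ._≤ D 1 ℤ.* t) (ℤₚ.*-zeroʳ (D 1))
        (ℤₚ.*-monoˡ-≤-nonNeg (D 1) {{ℤ.nonNegative 0≤D₁}} 0≤t))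
    ... | inj₂ D₁≤0 = inj₂ λ n 1≤n → let t , 0≤t , eq = δ-multiple n 1≤n in
      ≡.subst (ℤ._≤ 0ℤ) (≡.sym eq) (≡.subst (D 1 ℤ.* t ℤ.≤_) (ℤₚ.*-zeroʳ (D 1))
        (ℤₚ.*-monoˡ-≤-nonPos (D 1) {{ℤ.nonPositive D₁≤0}} 0≤t))

-- Reduction to the quotient by torsion.

module TorsionQuotient {c ℓ} (K : CommutativeRing c ℓ) where
  open Ring K

  infix 4 _≈ₜ_
  -- Congruence modulo the ideal of elements killed by a nonzero integer. Only the equality changes,
  -- so the roots and all constructions from them are kept as they are.
  _≈ₜ_ : Carrier → Carrier → Set ℓ
  a ≈ₜ b = ∃[ z ] z ≢ 0ℤ × ι z * a ≈ ι z * b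

  private
    *-≢0 : ∀ {y z} → y ≢ 0ℤ → z ≢ 0ℤ → y ℤ.* z ≢ 0ℤ
    *-≢0 {y} y≢0 z≢0 yz≡0 with ℤₚ.i*j≡0⇒i≡0∨j≡0 y yz≡0
    ... | inj₁ y≡0 = y≢0 y≡0
    ... | inj₂ z≡0 = z≢0 z≡0

  ≈⇒≈ₜ : ∀ {a b} → a ≈ b → a ≈ₜ b
  ≈⇒≈ₜ a≈b = 1ℤ , (λ ()) , *-congˡ a≈b

  ≈ₜ-trans : ∀ {a b e} → a ≈ₜ b → b ≈ₜ e → a ≈ₜ e
  ≈ₜ-trans {a} {b} {e} (y , y≢0 , ya≈yb) (z , z≢0 , zb≈ze) = y ℤ.* z , *-≢0 y≢0 z≢0 , (begin
    ι (y ℤ.* z) * a   ≈⟨ *-congʳ (ι-* y z) ⟩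
    ι y * ι z * a     ≈⟨ solve 3 (λ y z a → y :* z :* a := z :* (y :* a)) refl _ _ _ ⟩
    ι z * (ι y * a)   ≈⟨ *-congˡ ya≈yb ⟩
    ι z * (ι y * b)   ≈⟨ solve 3 (λ y z a → z :* (y :* a) := y :* (z :* a)) refl _ _ _ ⟩
    ι y * (ι z * b)   ≈⟨ *-congˡ zb≈ze ⟩
    ι y * (ι z * e)   ≈⟨ *-assoc _ _ _ ⟨
    ι y * ι z * e     ≈⟨ *-congʳ (ι-* y z) ⟨
    ι (y ℤ.* z) * e   ∎)

  ≈ₜ-+-cong : ∀ {a b a′ b′} → a ≈ₜ b → a′ ≈ₜ b′ → a + a′ ≈ₜ b + b′
  ≈ₜ-+-cong {a} {b} {a′} {b′} (y , y≢0 , ya≈yb) (z , z≢0 , za′≈zb′) = y ℤ.* z , *-≢0 y≢0 z≢0 , (begin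
    ι (y ℤ.* z) * (a + a′)               ≈⟨ *-congʳ (ι-* y z) ⟩
    ι y * ι z * (a + a′)                 ≈⟨ regroup _ _ _ _ ⟩
    ι z * (ι y * a) + ι y * (ι z * a′)   ≈⟨ +-cong (*-congˡ ya≈yb) (*-congˡ za′≈zb′) ⟩
    ι z * (ι y * b) + ι y * (ι z * b′)   ≈⟨ regroup _ _ _ _ ⟨
    ι y * ι z * (b + b′)                 ≈⟨ *-congʳ (ι-* y z) ⟨
    ι (y ℤ.* z) * (b + b′)               ∎)
    where
    regroup : ∀ y z a a′ → y * z * (a + a′) ≈ z * (y * a) + y * (z * a′)
    regroup = solve 4 (λ y z a a′ → y :* z :* (a :+ a′) := z :* (y :* a) :+ y :* (z :* a′)) refl

  ≈ₜ-*-cong : ∀ {a b a′ b′} → a ≈ₜ b → a′ ≈ₜ b′ → a * a′ ≈ₜ b * b′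
  ≈ₜ-*-cong {a} {b} {a′} {b′} (y , y≢0 , ya≈yb) (z , z≢0 , za′≈zb′) = y ℤ.* z , *-≢0 y≢0 z≢0 , (begin
    ι (y ℤ.* z) * (a * a′)       ≈⟨ *-congʳ (ι-* y z) ⟩
    ι y * ι z * (a * a′)         ≈⟨ regroup _ _ _ _ ⟩
    ι y * a * (ι z * a′)         ≈⟨ *-cong ya≈yb za′≈zb′ ⟩
    ι y * b * (ι z * b′)         ≈⟨ regroup _ _ _ _ ⟨
    ι y * ι z * (b * b′)         ≈⟨ *-congʳ (ι-* y z) ⟨
    ι (y ℤ.* z) * (b * b′)       ∎)
    where
    regroup : ∀ y z a a′ → y * z * (a * a′) ≈ y * a * (z * a′)
    regroup = solve 4 (λ y z a a′ → y :* z :* (a :* a′) := y :* a :* (z :* a′)) refl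

  ≈ₜ-neg-cong : ∀ {a b} → a ≈ₜ b → - a ≈ₜ - b
  ≈ₜ-neg-cong {a} {b} (z , z≢0 , za≈zb) = z , z≢0 , (begin
    ι z * - a    ≈⟨ solve 2 (λ z a → z :* (:- a) := :- (z :* a)) refl _ _ ⟩
    - (ι z * a)  ≈⟨ -‿cong za≈zb ⟩
    - (ι z * b)  ≈⟨ solve 2 (λ z a → z :* (:- a) := :- (z :* a)) refl _ _ ⟨
    ι z * - b    ∎)

  K/torsion : CommutativeRing c ℓ
  K/torsion = record
    { Carrier = Carrier
    ; _≈_ = _≈ₜ_
    ; _+_ = _+_
    ; _*_ = _*_
    ; -_ = -_
    ; 0# = 0#
    ; 1# = 1#
    ; isCommutativeRing = record
      { isRing = record
        { +-isAbelianGroup = record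
          { isGroup = record
            { isMonoid = record
              { isSemigroup = record
                { isMagma = record
                  { isEquivalence = record
                    { refl = ≈⇒≈ₜ refl
                    ; sym = λ (z , z≢0 , eq) → z , z≢0 , sym eq
                    ; trans = ≈ₜ-trans
                    }
                  ; ∙-cong = ≈ₜ-+-cong
                  }
                ; assoc = λ a b e → ≈⇒≈ₜ (+-assoc a b e)
                }
              ; identity = (λ a → ≈⇒≈ₜ (+-identityˡ a)) , (λ a → ≈⇒≈ₜ (+-identityʳ a))
              }
            ; inverse = (λ a → ≈⇒≈ₜ (-‿inverseˡ a)) , (λ a → ≈⇒≈ₜ (-‿inverseʳ a))
            ; ⁻¹-cong = ≈ₜ-neg-cong
            }
          ; comm = λ a b → ≈⇒≈ₜ (+-comm a b)
          }
        ; *-cong = ≈ₜ-*-cong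
        ; *-assoc = λ a b e → ≈⇒≈ₜ (*-assoc a b e)
        ; *-identity = (λ a → ≈⇒≈ₜ (*-identityˡ a)) , (λ a → ≈⇒≈ₜ (*-identityʳ a))
        ; distrib = (λ a b e → ≈⇒≈ₜ (distribˡ a b e)) , (λ a b e → ≈⇒≈ₜ (distribʳ a b e))
        }
      ; *-comm = λ a b → ≈⇒≈ₜ (*-comm a b)
      }
    }

  -- The definitions over a ring only use its operations, which the quotient shares with K.
  private
    natK≡ : ∀ n → natK K/torsion n ≡ natK K n
    natK≡ zero    = ≡.refl
    natK≡ (suc n) = ≡.cong (λ a → 1# + a) (natK≡ n)

    ιK≡ : ∀ z → ιK K/torsion z ≡ ιK K z
    ιK≡ (+ n)     = natK≡ n
    ιK≡ -[1+ n ]  = ≡.cong -_ (natK≡ (suc n))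

    powK≡ : ∀ n a → powK K/torsion n a ≡ powK K n a
    powK≡ zero    a = ≡.refl
    powK≡ (suc n) a = ≡.cong (a *_) (powK≡ n a)

    prodLin≡ : ∀ as → prodLin K/torsion as ≡ prodLin K as
    prodLin≡ []       = ≡.refl
    prodLin≡ (a ∷ as) = ≡.cong (mulLin K a) (prodLin≡ as)

    discK≡ : ∀ bs → discK K/torsion bs ≡ discK K bs
    discK≡ []       = ≡.refl
    discK≡ (b ∷ bs) =
      ≡.cong (foldr (λ b′ r → ((b + (- b′)) * (b + (- b′))) * r) 1# bs *_) (discK≡ bs)

  splits-torsion : ∀ {d} {coef : Vec ℤ d} {α : Vec Carrier d} → Splits K coef α → Splits K/torsion coef α
  splits-torsion {coef = coef} {α} splits = ≡.subst₂ (Pointwise _≈ₜ_) (≡.sym (prodLin≡ (toList α)))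
    (≡.cong (_++ (1# ∷ [])) (≡.sym (map-cong ιK≡ (toList coef)))) (Pointwise.map ≈⇒≈ₜ splits)

  ΔnK-torsion : ∀ {d} n z (α : Vec Carrier d) → ιK K z ≈ ΔnK K n α → ιK K/torsion z ≈ₜ ΔnK K/torsion n α
  ΔnK-torsion n z α eq = ≡.subst₂ _≈ₜ_ (≡.sym (ιK≡ z))
    (≡.sym (≡.trans (discK≡ (List.map (powK K/torsion n) (toList α))) (≡.cong (discK K) (map-cong (powK≡ n) (toList α))))) (≈⇒≈ₜ eq)

  -- If y kills the image of z, then y z has image 0 in K, so y z = 0 in ℤ with y nonzero.
  charZero-torsion : CharZero K → CharZero K/torsion
  charZero-torsion char0 z (y , y≢0 , yz≈0)
    with ℤₚ.i*j≡0⇒i≡0∨j≡0 y (char0 (y ℤ.* z) (begin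
           ι (y ℤ.* z)                 ≈⟨ ι-* y z ⟩
           ι y * ι z                   ≡⟨ ≡.cong (ι y *_) (ιK≡ z) ⟨
           ι y * ιK K/torsion z        ≈⟨ yz≈0 ⟩
           ι y * 0#                    ≈⟨ zeroʳ _ ⟩
           0#                          ∎))
  ... | inj₁ y≡0 = contradiction y≡0 y≢0
  ... | inj₂ z≡0 = z≡0

  torsionFree : Traces.TorsionFree K/torsion
  torsionFree z z≢0 a (y , y≢0 , yza≈0) = y ℤ.* z , *-≢0 y≢0 z≢0 , (begin
    ι (y ℤ.* z) * a               ≈⟨ *-congʳ (ι-* y z) ⟩
    ι y * ι z * a                 ≈⟨ *-assoc _ _ _ ⟩
    ι y * (ι z * a)               ≡⟨ ≡.cong (λ x → ι y * (x * a)) (ιK≡ z) ⟨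
    ι y * (ιK K/torsion z * a)    ≈⟨ yza≈0 ⟩
    ι y * 0#                      ≈⟨ trans (zeroʳ _) (sym (zeroʳ _)) ⟩
    ι (y ℤ.* z) * 0#              ∎)

theorem8p9 : ∀ {c ℓ} (K : CommutativeRing c ℓ) → CharZero K →
    (d : ℕ) (coef : Vec ℤ d) (α : Vec (CommutativeRing.Carrier K) d) →
    Splits K coef α →
    (D : ℕ → ℤ) →
    (∀ n → 1 ≤ n → CommutativeRing._≈_ K (ιK K (D n)) (ΔnK K n α)) →
    (∀ n → 1 ≤ n → D n ≢ 0ℤ) →
    SameSign (δ D)
theorem8p9 K char0 d coef α splits D D≈ D≢0 =
  TorsionFreeCase.sameSign K/torsion (charZero-torsion char0) torsionFree coef α
    (splits-torsion {coef = coef} {α} splits) D (λ n 1≤n → ΔnK-torsion n (D n) α (D≈ n 1≤n)) D≢0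
  where open TorsionQuotient K
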